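{- For each integer $\beta \geq 5$, the groups \[ \Gamma^{2^{\beta-1}, 2^{\beta}}(-1 + 2^{\beta-2},\ -3 + 2^{\beta-2},\ 1 - 2^{\beta-2},\ 3 + 2^{\beta-2}) \] and \[ \Gamma^{2^{\beta-1}, 2^{\beta}}(-1 + 2^{\beta-2},\ -3 - 2^{\beta-2},\ 1 - 2^{\beta-2},\ 3 - 2^{\beta-2}) \] are the automorphism groups of tight chiral polyhedra of type $\{2^{\beta-1}, 2^{\beta}\}$.
   Context: For integers $p,q,i_1,j_1,i_2,j_2$, $\Gamma^{p,q}(i_1,j_1,i_2,j_2)$ denotes the group with presentation $\langle \sigma_1,\sigma_2 \mid \sigma_1^p=\sigma_2^q=(\sigma_1\sigma_2)^2=1,\ \sigma_2^{ -1}\sigma_1=\sigma_1^{i_1}\sigma_2^{j_1},\ \sigma_2\sigma_1^{ -1}=\sigma_1^{i_2}\sigma_2^{j_2}\rangle$. An (abstract) polyhedron is a partially ordered set whose elements have rank $0$, $1$, $2$ (vertices, edges, faces), incidence meaning comparability, such that every edge is incident to exactly two vertices and two faces, whenever a vertex is incident to a face exactly two edges are incident to both, the incidence graph is connected, and for each vertex or face the subgraph of the incidence graph induced on its neighbours is connected. A flag is a mutually incident (vertex, edge, face) triple; $\Phi^i$ is the flag differing from $\Phi$ exactly in its rank-$i$ element. Type $\{p,q\}$: faces are incident to $p$ edges and vertices to $q$ edges. The polyhedron is chiral if its flags split into two classes with $\Phi,\Phi^i$ always in different classes and the automorphism group transitive on each class but not on all flags; then, fixing a base flag $\Phi$, the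 automorphism group is generated by $\sigma_1:\Phi\mapsto(\Phi^1)^0$ and $\sigma_2:\Phi\mapsto(\Phi^2)^1$. A group $\langle\sigma_1,\sigma_2\rangle$ "is the automorphism group of" such a polyhedron if there is an isomorphism onto it sending the generators $\sigma_1,\sigma_2$ to these distinguished generators. A polyhedron of type $\{p,q\}$ is tight if it has exactly $2pq$ flags. -}

module Defs where

open import Data.Bool using (Bool; true; false; T; not)
open import Data.Nat as ℕ using (ℕ)
open import Data.Integer as ℤ using (ℤ; +_; -[1+_])
open import Data.Fin using (Fin; zero; suc)
open import Data.Empty using (⊥)
open import Data.Product using (Σ; Σ-syntax; ∃; ∃-syntax; _×_; _,_; proj₁; proj₂)
open import Data.Sum using (_⊎_; inj₁; inj₂)
open import Data.List using (List; []; _∷_; _++_; replicate; foldr)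
open import Data.List.Membership.Propositional using (_∈_)
open import Relation.Nullary using (¬_)
open import Relation.Binary.PropositionalEquality
  using (_≡_; _≢_; refl; sym; trans; cong; cong₂; subst)
open import Relation.Binary.Construct.Closure.ReflexiveTransitive using (Star)
open import Function.Bundles using (_↔_; Inverse)
open import Function.Construct.Composition using (_↔-∘_)
open import Function.Construct.Symmetry using (↔-sym)
open import Function.Construct.Identity using (↔-id)

-- Finitely presented groups on two generators σ₁, σ₂ :
-- words in σ₁^{±1}, σ₂^{±1} modulo the congruence generated by free
-- cancellation and a list of defining relations  l = r.

data Gen : Set where
  g₁ g₂ : Gen

-- a letter: a generator together with a flag "inverted?"
Letter : Set
Letter = Gen × Bool

Word : Set
Word = List Letter

letterInv : Letter → Letter
letterInv (g , b) = (g , not b)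

pow : Gen → ℤ → Word
pow g (+ n)     = replicate n (g , false)
pow g -[1+ n ]  = replicate (ℕ.suc n) (g , true)

σ₁ σ₂ σ₁⁻¹ σ₂⁻¹ : Word
σ₁ = (g₁ , false) ∷ []
σ₂ = (g₂ , false) ∷ []
σ₁⁻¹ = (g₁ , true) ∷ []
σ₂⁻¹ = (g₂ , true) ∷ []

ε : Word
ε = []

Relations : Set
Relations = List (Word × Word)

data _≈⟨_⟩_ : Word → Relations → Word → Set where
  ≈-refl  : ∀ {R u} → u ≈⟨ R ⟩ u
  ≈-sym   : ∀ {R u v} → u ≈⟨ R ⟩ v → v ≈⟨ R ⟩ u
  ≈-trans : ∀ {R u v w} → u ≈⟨ R ⟩ v → v ≈⟨ R ⟩ w → u ≈⟨ R ⟩ w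
  ≈-cong  : ∀ {R u u′ v v′} → u ≈⟨ R ⟩ u′ → v ≈⟨ R ⟩ v′ →
            (u ++ v) ≈⟨ R ⟩ (u′ ++ v′)
  ≈-free  : ∀ {R} (x : Letter) → (x ∷ letterInv x ∷ []) ≈⟨ R ⟩ []
  ≈-rel   : ∀ {R l r} → (l , r) ∈ R → l ≈⟨ R ⟩ r

ΓRels : (p q i₁ j₁ i₂ j₂ : ℤ) → Relations
ΓRels p q i₁ j₁ i₂ j₂ =
    (pow g₁ p , ε)
  ∷ (pow g₂ q , ε)
  ∷ (σ₁ ++ σ₂ ++ σ₁ ++ σ₂ , ε)
  ∷ (σ₂⁻¹ ++ σ₁ , pow g₁ i₁ ++ pow g₂ j₁)
  ∷ (σ₂ ++ σ₁⁻¹ , pow g₁ i₂ ++ pow g₂ j₂)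
  ∷ []

-- Rank-2 posets: vertices, edges, faces; incidence = comparability.

record Poset₂ : Set₁ where
  field
    V E F : Set
    IVE : V → E → Bool
    IEF : E → F → Bool
    IVF : V → F → Bool
    trans-VEF : ∀ v e f → T (IVE v e) → T (IEF e f) → T (IVF v f)

  Elt : Set
  Elt = V ⊎ E ⊎ F

  Inc : Elt → Elt → Set
  Inc (inj₁ v)        (inj₂ (inj₁ e)) = T (IVE v e)
  Inc (inj₂ (inj₁ e)) (inj₁ v)        = T (IVE v e)
  Inc (inj₂ (inj₁ e)) (inj₂ (inj₂ f)) = T (IEF e f)
  Inc (inj₂ (inj₂ f)) (inj₂ (inj₁ e)) = T (IEF e f)
  Inc (inj₁ v)        (inj₂ (inj₂ f)) = T (IVF v f)
  Inc (inj₂ (inj₂ f)) (inj₁ v)        = T (IVF v f)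
  Inc _ _ = ⊥

  Connected : Set
  Connected = ∀ x y → Star Inc x y

  InducedConnected : (Elt → Set) → Set
  InducedConnected N =
    ∀ x y → N x → N y → Star (λ a b → N a × N b × Inc a b) x y

  record Flag : Set where
    constructor flag
    field
      fv : V
      fe : E
      ff : F
      ive : T (IVE fv fe)
      ief : T (IEF fe ff)
      ivf : T (IVF fv ff)

  open Flag public

  _≈F_ : Flag → Flag → Set
  Φ ≈F Ψ = (fv Φ ≡ fv Ψ) × (fe Φ ≡ fe Ψ) × (ff Φ ≡ ff Ψ)

  IsAdj : Fin 3 → Flag → Flag → Set
  IsAdj zero Φ Ψ =
    (fv Φ ≢ fv Ψ) × (fe Φ ≡ fe Ψ) × (ff Φ ≡ ff Ψ)
  IsAdj (suc zero) Φ Ψ =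
    (fv Φ ≡ fv Ψ) × (fe Φ ≢ fe Ψ) × (ff Φ ≡ ff Ψ)
  IsAdj (suc (suc zero)) Φ Ψ =
    (fv Φ ≡ fv Ψ) × (fe Φ ≡ fe Ψ) × (ff Φ ≢ ff Ψ)

record IsPolyhedron (P : Poset₂) : Set where
  open Poset₂ P
  field
    edge-two-vertices : ∀ e → Σ V (λ v → T (IVE v e)) ↔ Fin 2
    edge-two-faces    : ∀ e → Σ F (λ f → T (IEF e f)) ↔ Fin 2
    diamond : ∀ v f → T (IVF v f) →
              Σ E (λ e → T (IVE v e) × T (IEF e f)) ↔ Fin 2
    connected : Connected
    vertex-section : ∀ v → InducedConnected (λ x → Inc (inj₁ v) x)
    face-section   : ∀ f → InducedConnected (λ x → Inc (inj₂ (inj₂ f)) x)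

HasType : Poset₂ → ℕ → ℕ → Set
HasType P p q =
  (∀ f → Σ E (λ e → T (IEF e f)) ↔ Fin p) ×
  (∀ v → Σ E (λ e → T (IVE v e)) ↔ Fin q)
  where open Poset₂ P

Tight : Poset₂ → ℕ → ℕ → Set
Tight P p q = Poset₂.Flag P ↔ Fin (2 ℕ.* p ℕ.* q)

record Aut (P : Poset₂) : Set where
  open Poset₂ P
  field
    aV : V ↔ V
    aE : E ↔ E
    aF : F ↔ F
    pVE : ∀ v e → IVE (Inverse.to aV v) (Inverse.to aE e) ≡ IVE v e
    pEF : ∀ e f → IEF (Inverse.to aE e) (Inverse.to aF f) ≡ IEF e f
    pVF : ∀ v f → IVF (Inverse.to aV v) (Inverse.to aF f) ≡ IVF v f

module _ {P : Poset₂} where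
  open Poset₂ P
  open Aut

  _≐_ : Aut P → Aut P → Set
  a ≐ b = (∀ v → Inverse.to (aV a) v ≡ Inverse.to (aV b) v) ×
          (∀ e → Inverse.to (aE a) e ≡ Inverse.to (aE b) e) ×
          (∀ f → Inverse.to (aF a) f ≡ Inverse.to (aF b) f)

  idA : Aut P
  idA = record { aV = ↔-id V ; aE = ↔-id E ; aF = ↔-id F
               ; pVE = λ _ _ → refl ; pEF = λ _ _ → refl ; pVF = λ _ _ → refl }

  -- composition: (a ∘A b) x = a (b x)
  _∘A_ : Aut P → Aut P → Aut P
  a ∘A b = record
    { aV = aV a ↔-∘ aV b ; aE = aE a ↔-∘ aE b ; aF = aF a ↔-∘ aF b
    ; pVE = λ v e → trans (pVE a _ _) (pVE b v e)
    ; pEF = λ e f → trans (pEF a _ _) (pEF b e f)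
    ; pVF = λ v f → trans (pVF a _ _) (pVF b v f) }

  invA : Aut P → Aut P
  invA a = record
    { aV = ↔-sym (aV a) ; aE = ↔-sym (aE a) ; aF = ↔-sym (aF a)
    ; pVE = λ v e → trans (sym (pVE a _ _))
        (cong₂ IVE (Inverse.strictlyInverseˡ (aV a) v) (Inverse.strictlyInverseˡ (aE a) e))
    ; pEF = λ e f → trans (sym (pEF a _ _))
        (cong₂ IEF (Inverse.strictlyInverseˡ (aE a) e) (Inverse.strictlyInverseˡ (aF a) f))
    ; pVF = λ v f → trans (sym (pVF a _ _))
        (cong₂ IVF (Inverse.strictlyInverseˡ (aV a) v) (Inverse.strictlyInverseˡ (aF a) f)) }

  act : Aut P → Flag → Flag
  act a Φ = flag (Inverse.to (aV a) (fv Φ)) (Inverse.to (aE a) (fe Φ))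
                 (Inverse.to (aF a) (ff Φ))
                 (subst T (sym (pVE a _ _)) (ive Φ))
                 (subst T (sym (pEF a _ _)) (ief Φ))
                 (subst T (sym (pVF a _ _)) (ivf Φ))

  evalLetter : Aut P → Aut P → Letter → Aut P
  evalLetter s₁ s₂ (g₁ , false) = s₁
  evalLetter s₁ s₂ (g₁ , true)  = invA s₁
  evalLetter s₁ s₂ (g₂ , false) = s₂
  evalLetter s₁ s₂ (g₂ , true)  = invA s₂

  eval : Aut P → Aut P → Word → Aut P
  eval s₁ s₂ = foldr (λ x acc → evalLetter s₁ s₂ x ∘A acc) idA

  Chiral : Set
  Chiral =
    Σ[ cls ∈ (Flag → Bool) ]
      (∀ i Φ Ψ → IsAdj i Φ Ψ → cls Φ ≢ cls Ψ) ×
      (∀ Φ Ψ → cls Φ ≡ cls Ψ → ∃[ a ] act a Φ ≈F Ψ) ×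
      ¬ (∀ Φ Ψ → ∃[ a ] act a Φ ≈F Ψ)

  -- the group presented by R is Aut(P), with σ₁, σ₂ sent to the
  -- distinguished generators w.r.t. the base flag Φ:
  --   σ₁ : Φ ↦ (Φ¹)⁰,  σ₂ : Φ ↦ (Φ²)¹,
  -- and the induced map  (words / ≈⟨ R ⟩) → Aut(P)  is well defined,
  -- injective and surjective (it is a homomorphism by construction).
  IsAutGroupWith : Relations → Flag → Set
  IsAutGroupWith R Φ =
    Σ[ s₁ ∈ Aut P ] Σ[ s₂ ∈ Aut P ]
      (∃[ Ψ ] IsAdj (suc zero) Φ Ψ × IsAdj zero Ψ (act s₁ Φ)) ×
      (∃[ Ψ ] IsAdj (suc (suc zero)) Φ Ψ × IsAdj (suc zero) Ψ (act s₂ Φ)) ×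
      (∀ u w → u ≈⟨ R ⟩ w → eval s₁ s₂ u ≐ eval s₁ s₂ w) ×
      (∀ u w → eval s₁ s₂ u ≐ eval s₁ s₂ w → u ≈⟨ R ⟩ w) ×
      (∀ a → ∃[ w ] eval s₁ s₂ w ≐ a)

IsAutGroupOfTightChiral : Relations → ℕ → ℕ → Set₁
IsAutGroupOfTightChiral R p q =
  Σ[ P ∈ Poset₂ ]
    IsPolyhedron P × HasType P p q × Tight P p q × Chiral {P} ×
    Σ[ Φ ∈ Poset₂.Flag P ] IsAutGroupWith {P} R Φ

{-# OPTIONS --safe #-}

-- Write p = 16k, q = 2p, and let μ = ± p/4 be the residue modulo p with δ = 2μ the
-- perturbation of the σ₂-exponents. As ⟨σ₁⟩ and ⟨σ₂⟩ should factorise the group, every vertex lies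
-- on every face, vertices are residues v mod p, faces are numbers 2h + c mod 2p, and an edge is
-- a pair (a , h): it joins a to a + 1 + 2μh and lies on the faces 2h and 2k + 1, where
-- k = h - a - 1 + 2μha - μ a(a+1)/2. Since 4μ = 0 and μ² = 0, the rotations σ₁ : v ↦ v + 1 and
-- σ₂ : v ↦ -v + μ(v² - v) extend to automorphisms of this incidence structure.
-- An automorphism is determined by the image of one flag, so relations can be tested
-- at the base flag. In the presented group every word can be sorted into the form σ₁^i σ₂^j, and
-- such words are separated by the base vertex and the base face; hence the action is faithful.
-- A reflection of the base flag would conjugate the generators to their inverses and
-- so force σ₂^(2δ) = 1, which fails: the polyhedron is chiral.
module Submission where

open import Defs renaming (_≈⟨_⟩_ to Equal)
open import Algebra.Bundles using (CommutativeRing; RawRing)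
open import Algebra.Solver.Ring.AlmostCommutativeRing using (AlmostCommutativeRing; fromCommutativeRing; _-Raw-AlmostCommutative⟶_)
import Algebra.Solver.Ring as RingSolver
open import Algebra.Structures using (IsCommutativeRing)
open import Data.Bool using (Bool; true; false; not; T; _∨_; _xor_)
open import Data.Bool.Properties using (T-irrelevant; T-∨; not-involutive; not-injective; not-¬; ¬-not; xor-annihilates-not)
open import Data.Fin using (Fin; zero; suc; toℕ; fromℕ<)
import Data.Fin.Properties as Fin
open import Data.Integer as ℤ using (ℤ; +_; -[1+_]; ∣_∣; _%ℕ_; _/ℕ_)
import Data.Integer.DivMod as ℤ
import Data.Integer.Divisibility.Signed as ℤ
import Data.Integer.Properties as ℤ
open import Data.Integer.Solver using (module +-*-Solver)
open import Data.List using ([]; _∷_; _++_; map)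
open import Data.List.Membership.Propositional using (_∈_)
open import Data.List.Properties using (++-assoc; ++-identityʳ; map-++; map-replicate)
open import Data.List.Relation.Unary.Any using (here; there)
open import Data.Maybe using (Maybe; just; nothing)
open import Data.Nat as ℕ using (ℕ; zero; suc; NonZero; z≤n; s≤s; _≤_; _^_; _∸_)
import Data.Nat.DivMod as ℕ
import Data.Nat.Divisibility as ℕ
import Data.Nat.Properties as ℕ
import Data.Nat.Solver as ℕ
open import Data.Product using (Σ; ∃-syntax; _×_; _,_; proj₁; proj₂)
open import Data.Product.Function.NonDependent.Propositional using (_×-↔_)
open import Data.Sum using (_⊎_; inj₁; inj₂)
open import Data.Unit using (tt)
open import Function using (_∘_; id)
open import Function.Bundles using (_↔_; Inverse; mk↔ₛ′; Equivalence)
open import Function.Construct.Composition using (_↔-∘_)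
open import Function.Construct.Identity using (↔-id)
open import Function.Construct.Symmetry using (↔-sym)
open import Relation.Binary.Bundles using (Setoid)
open import Relation.Binary.Construct.Closure.ReflexiveTransitive using (Star; _◅_; _◅◅_; gmap; reverse) renaming (ε to done)
open import Relation.Binary.PropositionalEquality
import Relation.Binary.Reasoning.Setoid as SetoidReasoning
open import Relation.Nullary using (¬_; Dec; yes; no; contradiction)
open import Relation.Nullary.Decidable using (⌊_⌋; toWitness; fromWitness; map′)

-- The formulas of the model are those of a coset geometry: v stands for the coset σ₁^v⟨σ₂⟩, the
-- face 2h + c for σ₂^(2h + c)⟨σ₁⟩, and the generators act from the left. For instance, the fourth
-- relation forces σ₂⁻¹ to send the vertex 1 to -1 + 2μ. The obstacle is that a presentation bounds
-- its group only from above: sorting leaves at most 2p² elements, and it takes an explicit action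
-- to keep them apart. This action is quadratic and involves μ x(x - 1)/2, although 2 is not
-- invertible modulo p. The function still makes sense on residues, because the triangular number
-- belonging to p is a multiple of 4. The combinatorial axioms all come from one property: for each
-- choice of one of the two ends and one of the two sides, an edge is determined by the values at
-- that end and that side. The constant 16 has its origin in μ = ± p/4, whose square vanishes modulo
-- p exactly when 16 divides p; this is where β ≥ 5 enters. Both groups are treated at once, since
-- p/2 and -p/2 agree modulo p and the sign is visible modulo 2p only.

-- Residues modulo p behind an abstract interface.

record CyclicRing (p : ℕ) .{{_ : NonZero p}} : Set₁ where
  infixl 7 _*_
  infixl 6 _+_
  infix  8 -_
  field
    R     : Set
    _+_ _*_ : R → R → R
    -_    : R → R
    ι     : ℤ → R
    -- Zero and one are by definition the images of the integers 0 and 1, so that integer constants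
    -- in the ring solvers evaluate to them directly.
    isCommutativeRing : IsCommutativeRing _≡_ _+_ _*_ -_ (ι (+ 0)) (ι (+ 1))
    ι-+   : ∀ i j → ι (i ℤ.+ j) ≡ ι i + ι j
    ι-*   : ∀ i j → ι (i ℤ.* j) ≡ ι i * ι j
    ι-neg : ∀ i → ι (ℤ.- i) ≡ - ι i
    ι-surjective : ∀ x → ∃[ a ] ι (+ a) ≡ x
    ι-kernel     : ∀ {i j} → ι i ≡ ι j → i %ℕ p ≡ j %ℕ p
    ι-modulus    : ι (+ p) ≡ ι (+ 0)
    enumeration  : R ↔ Fin p

  commutativeRing : CommutativeRing _ _
  commutativeRing = record { isCommutativeRing = isCommutativeRing }

  ι-≡⇒congruent : ∀ {i j} → ι i ≡ ι j → ∃[ k ] i ≡ j ℤ.+ k ℤ.* + p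
  ι-≡⇒congruent {i} {j} eq = i /ℕ p ℤ.- j /ℕ p , (begin
    i                                         ≡⟨ ℤ.a≡a%ℕn+[a/ℕn]*n i p ⟩
    + (i %ℕ p) ℤ.+ (i /ℕ p) ℤ.* + p           ≡⟨ cong (λ r → + r ℤ.+ (i /ℕ p) ℤ.* + p) (ι-kernel eq) ⟩
    + (j %ℕ p) ℤ.+ (i /ℕ p) ℤ.* + p           ≡⟨ solve 4 (λ r a b P → r :+ a :* P := (r :+ b :* P) :+ (a :- b) :* P)
                                                   refl (+ (j %ℕ p)) (i /ℕ p) (j /ℕ p) (+ p) ⟩
    + (j %ℕ p) ℤ.+ (j /ℕ p) ℤ.* + p ℤ.+ (i /ℕ p ℤ.- j /ℕ p) ℤ.* + p
      ≡⟨ cong (ℤ._+ (i /ℕ p ℤ.- j /ℕ p) ℤ.* + p) (ℤ.a≡a%ℕn+[a/ℕn]*n j p) ⟨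
    j ℤ.+ (i /ℕ p ℤ.- j /ℕ p) ℤ.* + p ∎)
    where
    open ≡-Reasoning
    open +-*-Solver

%ℕ-unique : ∀ p .{{_ : NonZero p}} {r s : ℕ} → r ℕ.< p → s ℕ.< p →
            + p ℤ.∣ (+ r ℤ.- + s) → r ≡ s
%ℕ-unique p {r} {s} r<p s<p p∣r-s = go (ℕ.≤-total s r)
  where
  p∣ : p ℕ.∣ ∣ r ℤ.⊖ s ∣
  p∣ = subst (λ i → p ℕ.∣ ∣ i ∣) (ℤ.m-n≡m⊖n r s) (ℤ.∣⇒∣ᵤ p∣r-s)

  small : ∀ {d} → d ℕ.< p → p ℕ.∣ d → d ≡ 0
  small {0}     _   _   = refl
  small {suc d} d<p p∣d = contradiction p∣d (ℕ.>⇒∤ d<p)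

  go : _ → r ≡ s
  go (inj₁ s≤r) = ℕ.≤-antisym (ℕ.m∸n≡0⇒m≤n (small (ℕ.≤-<-trans (ℕ.m∸n≤m r s) r<p)
    (subst (p ℕ.∣_) (trans (ℤ.∣m⊖n∣≡∣n⊖m∣ r s) (ℤ.∣⊖∣-≤ s≤r)) p∣))) s≤r
  go (inj₂ r≤s) = ℕ.≤-antisym r≤s (ℕ.m∸n≡0⇒m≤n (small (ℕ.≤-<-trans (ℕ.m∸n≤m s r) s<p)
    (subst (p ℕ.∣_) (ℤ.∣⊖∣-≤ r≤s) p∣)))

module ResidueRing (p : ℕ) .{{p≢0 : NonZero p}} where
  open +-*-Solver

  residue : ℤ → Fin p
  residue i = fromℕ< (ℤ.n%ℕd<d i p)

  rep : Fin p → ℤ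
  rep x = + toℕ x

  -- With the quotient `k` given explicitly, compatibility of `residue` with each ring operation
  -- becomes one polynomial identity over ℤ in representatives and quotients.
  residue-cong : ∀ {i j} k → i ≡ j ℤ.+ k ℤ.* + p → residue i ≡ residue j
  residue-cong {i} {j} k i≡j+kp = Fin.fromℕ<-cong _ _
    (%ℕ-unique p (ℤ.n%ℕd<d i p) (ℤ.n%ℕd<d j p)
      (ℤ.divides (k ℤ.+ (j /ℕ p) ℤ.- (i /ℕ p)) (begin
        r ℤ.- s
          ≡⟨ solve 5 (λ r s a b P → r :- s := (r :+ a :* P) :- (s :+ b :* P) :+ (b :- a) :* P)
               refl r s (i /ℕ p) (j /ℕ p) (+ p) ⟩
        (r ℤ.+ (i /ℕ p) ℤ.* + p) ℤ.- (s ℤ.+ (j /ℕ p) ℤ.* + p) ℤ.+ (j /ℕ p ℤ.- i /ℕ p) ℤ.* + p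
          ≡⟨ cong₂ (λ a b → a ℤ.- b ℤ.+ (j /ℕ p ℤ.- i /ℕ p) ℤ.* + p)
               (trans (sym (ℤ.a≡a%ℕn+[a/ℕn]*n i p)) i≡j+kp)
               (sym (ℤ.a≡a%ℕn+[a/ℕn]*n j p)) ⟩
        (j ℤ.+ k ℤ.* + p) ℤ.- j ℤ.+ (j /ℕ p ℤ.- i /ℕ p) ℤ.* + p
          ≡⟨ solve 5 (λ j k a b P → (j :+ k :* P) :- j :+ (b :- a) :* P := (k :+ b :- a) :* P)
               refl j k (i /ℕ p) (j /ℕ p) (+ p) ⟩
        (k ℤ.+ (j /ℕ p) ℤ.- (i /ℕ p)) ℤ.* + p ∎)))
      _ _
    where
    open ≡-Reasoning
    r = + (i %ℕ p)
    s = + (j %ℕ p)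

  rep-residue : ∀ i → i ≡ rep (residue i) ℤ.+ (i /ℕ p) ℤ.* + p
  rep-residue i = trans (ℤ.a≡a%ℕn+[a/ℕn]*n i p)
    (cong (λ r → + r ℤ.+ (i /ℕ p) ℤ.* + p) (sym (Fin.toℕ-fromℕ< (ℤ.n%ℕd<d i p))))

  residue-rep : ∀ x → residue (rep x) ≡ x
  residue-rep x = Fin.toℕ-injective (trans (Fin.toℕ-fromℕ< _) (ℕ.m<n⇒m%n≡m (Fin.toℕ<n x)))

  infixl 7 _⊗_
  infixl 6 _⊕_
  _⊕_ _⊗_ : Fin p → Fin p → Fin p
  x ⊕ y = residue (rep x ℤ.+ rep y)
  x ⊗ y = residue (rep x ℤ.* rep y)

  ⊝_ : Fin p → Fin p
  ⊝ x = residue (ℤ.- rep x)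

  residue-+ : ∀ i j → residue (i ℤ.+ j) ≡ residue i ⊕ residue j
  residue-+ i j = residue-cong {j = rep (residue i) ℤ.+ rep (residue j)} (i /ℕ p ℤ.+ j /ℕ p) (trans
    (cong₂ ℤ._+_ (rep-residue i) (rep-residue j))
    (solve 5 (λ x a y b P → (x :+ a :* P) :+ (y :+ b :* P) := (x :+ y) :+ (a :+ b) :* P)
       refl (rep (residue i)) (i /ℕ p) (rep (residue j)) (j /ℕ p) (+ p)))

  residue-* : ∀ i j → residue (i ℤ.* j) ≡ residue i ⊗ residue j
  residue-* i j = residue-cong {j = rep (residue i) ℤ.* rep (residue j)}
    (a ℤ.* y ℤ.+ x ℤ.* b ℤ.+ a ℤ.* b ℤ.* + p) (trans
    (cong₂ ℤ._*_ (rep-residue i) (rep-residue j))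
    (solve 5 (λ x a y b P → (x :+ a :* P) :* (y :+ b :* P) :=
        (x :* y) :+ (a :* y :+ x :* b :+ a :* b :* P) :* P)
       refl x a y b (+ p)))
    where
    x = rep (residue i)
    y = rep (residue j)
    a = i /ℕ p
    b = j /ℕ p

  residue-neg : ∀ i → residue (ℤ.- i) ≡ ⊝ residue i
  residue-neg i = residue-cong {j = ℤ.- rep (residue i)} (ℤ.- (i /ℕ p)) (trans (cong ℤ.-_ (rep-residue i))
    (solve 3 (λ x a P → :- (x :+ a :* P) := (:- x) :+ (:- a) :* P)
       refl (rep (residue i)) (i /ℕ p) (+ p)))

  private
    R = Fin p

    -- As `rep` is a section of `residue`, an identity between integer expressions descends to
    -- residues once both sides commute with `residue`. The ring axioms are obtained in this way.
    lift₁ : {f g : R → R} (F G : ℤ → ℤ) →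
            (∀ i → residue (F i) ≡ f (residue i)) → (∀ i → residue (G i) ≡ g (residue i)) →
            (∀ i → F i ≡ G i) → ∀ x → f x ≡ g x
    lift₁ {f} {g} F G f-lift g-lift F≡G x = subst (λ x → f x ≡ g x) (residue-rep x)
      (trans (sym (f-lift (rep x))) (trans (cong residue (F≡G (rep x))) (g-lift (rep x))))

    lift₂ : {f g : R → R → R} (F G : ℤ → ℤ → ℤ) →
            (∀ i j → residue (F i j) ≡ f (residue i) (residue j)) →
            (∀ i j → residue (G i j) ≡ g (residue i) (residue j)) →
            (∀ i j → F i j ≡ G i j) → ∀ x y → f x y ≡ g x y
    lift₂ {f} {g} F G f-lift g-lift F≡G x y = subst (λ y → f x y ≡ g x y) (residue-rep y)
      (lift₁ (λ i → F i (rep y)) (λ i → G i (rep y)) (λ i → f-lift i (rep y))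
             (λ i → g-lift i (rep y)) (λ i → F≡G i (rep y)) x)

    lift₃ : {f g : R → R → R → R} (F G : ℤ → ℤ → ℤ → ℤ) →
            (∀ i j k → residue (F i j k) ≡ f (residue i) (residue j) (residue k)) →
            (∀ i j k → residue (G i j k) ≡ g (residue i) (residue j) (residue k)) →
            (∀ i j k → F i j k ≡ G i j k) → ∀ x y z → f x y z ≡ g x y z
    lift₃ {f} {g} F G f-lift g-lift F≡G x y z = subst (λ z → f x y z ≡ g x y z) (residue-rep z)
      (lift₂ (λ i j → F i j (rep z)) (λ i j → G i j (rep z)) (λ i j → f-lift i j (rep z))
             (λ i j → g-lift i j (rep z)) (λ i j → F≡G i j (rep z)) x y)

    ⊕-assoc : ∀ x y z → (x ⊕ y) ⊕ z ≡ x ⊕ (y ⊕ z)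
    ⊕-assoc = lift₃ (λ i j k → i ℤ.+ j ℤ.+ k) (λ i j k → i ℤ.+ (j ℤ.+ k))
      (λ i j k → trans (residue-+ (i ℤ.+ j) k) (cong (_⊕ residue k) (residue-+ i j)))
      (λ i j k → trans (residue-+ i _) (cong (residue i ⊕_) (residue-+ j k)))
      ℤ.+-assoc

    ⊗-assoc : ∀ x y z → (x ⊗ y) ⊗ z ≡ x ⊗ (y ⊗ z)
    ⊗-assoc = lift₃ (λ i j k → i ℤ.* j ℤ.* k) (λ i j k → i ℤ.* (j ℤ.* k))
      (λ i j k → trans (residue-* (i ℤ.* j) k) (cong (_⊗ residue k) (residue-* i j)))
      (λ i j k → trans (residue-* i _) (cong (residue i ⊗_) (residue-* j k)))
      ℤ.*-assoc

    ⊕-comm : ∀ x y → x ⊕ y ≡ y ⊕ x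
    ⊕-comm x y = cong residue (ℤ.+-comm (rep x) (rep y))

    ⊗-comm : ∀ x y → x ⊗ y ≡ y ⊗ x
    ⊗-comm x y = cong residue (ℤ.*-comm (rep x) (rep y))

    ⊕-identityˡ : ∀ x → residue (+ 0) ⊕ x ≡ x
    ⊕-identityˡ = lift₁ (λ i → + 0 ℤ.+ i) (λ i → i) (residue-+ (+ 0)) (λ _ → refl) ℤ.+-identityˡ

    ⊗-identityˡ : ∀ x → residue (+ 1) ⊗ x ≡ x
    ⊗-identityˡ = lift₁ (λ i → + 1 ℤ.* i) (λ i → i) (residue-* (+ 1)) (λ _ → refl) ℤ.*-identityˡ

    ⊝-inverseˡ : ∀ x → (⊝ x) ⊕ x ≡ residue (+ 0)
    ⊝-inverseˡ = lift₁ (λ i → ℤ.- i ℤ.+ i) (λ _ → + 0)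
      (λ i → trans (residue-+ (ℤ.- i) i) (cong (_⊕ residue i) (residue-neg i))) (λ _ → refl)
      ℤ.+-inverseˡ

    ⊗-distribˡ-⊕ : ∀ x y z → x ⊗ (y ⊕ z) ≡ x ⊗ y ⊕ x ⊗ z
    ⊗-distribˡ-⊕ = lift₃ (λ i j k → i ℤ.* (j ℤ.+ k)) (λ i j k → i ℤ.* j ℤ.+ i ℤ.* k)
      (λ i j k → trans (residue-* i _) (cong (residue i ⊗_) (residue-+ j k)))
      (λ i j k → trans (residue-+ (i ℤ.* j) (i ℤ.* k)) (cong₂ _⊕_ (residue-* i j) (residue-* i k)))
      ℤ.*-distribˡ-+

  isCommutativeRing : IsCommutativeRing _≡_ _⊕_ _⊗_ ⊝_ (residue (+ 0)) (residue (+ 1))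
  isCommutativeRing = record
    { isRing = record
      { +-isAbelianGroup = record
        { isGroup = record
          { isMonoid = record
            { isSemigroup = record
              { isMagma = record { isEquivalence = isEquivalence ; ∙-cong = cong₂ _⊕_ }
              ; assoc = ⊕-assoc }
            ; identity = ⊕-identityˡ , λ x → trans (⊕-comm x _) (⊕-identityˡ x) }
          ; inverse = ⊝-inverseˡ , λ x → trans (⊕-comm x _) (⊝-inverseˡ x)
          ; ⁻¹-cong = cong ⊝_ }
        ; comm = ⊕-comm }
      ; *-cong = cong₂ _⊗_
      ; *-assoc = ⊗-assoc
      ; *-identity = ⊗-identityˡ , λ x → trans (⊗-comm x _) (⊗-identityˡ x)
      ; distrib = ⊗-distribˡ-⊕ , λ x y z → trans (⊗-comm (y ⊕ z) x)
          (trans (⊗-distribˡ-⊕ x y z) (cong₂ _⊕_ (⊗-comm x y) (⊗-comm x z))) }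
    ; *-comm = ⊗-comm }

  residueRing : CyclicRing p
  residueRing = record
    { isCommutativeRing = isCommutativeRing
    ; ι = residue
    ; ι-+ = residue-+
    ; ι-* = residue-*
    ; ι-neg = residue-neg
    ; ι-surjective = λ x → toℕ x , residue-rep x
    ; ι-kernel = λ {i} {j} → Fin.fromℕ<-injective _ _ (ℤ.n%ℕd<d i p) (ℤ.n%ℕd<d j p)
    ; ι-modulus = residue-cong {j = + 0} (+ 1) (trans (sym (ℤ.*-identityˡ (+ p))) (sym (ℤ.+-identityˡ _)))
    ; enumeration = ↔-id (Fin p) }

-- The nilpotent perturbation μ and the quadratic function t.

record Twist {p : ℕ} .{{_ : NonZero p}} (C : CyclicRing p) : Set where
  open CyclicRing C
  field
    μ : R
    4μ≡0 : ι (+ 4) * μ ≡ ι (+ 0)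
    μ*μ≡0 : μ * μ ≡ ι (+ 0)
    -- `t x` plays the role of μ x(x - 1)/2. The recurrence expresses this without halving, which is
    -- impossible modulo an even p.
    t : R → R
    t-zero : t (ι (+ 0)) ≡ ι (+ 0)
    t-suc  : ∀ x → t (x + ι (+ 1)) ≡ t x + μ * x

module TwistProperties {p : ℕ} .{{_ : NonZero p}} (C : CyclicRing p) (Tw : Twist C) where
  open CyclicRing C
  open Twist Tw
  open ≡-Reasoning

  0# 1# : R
  0# = ι (+ 0)
  1# = ι (+ 1)

  open CommutativeRing commutativeRing
    using (+-identityˡ; +-identityʳ; zeroˡ; zeroʳ; *-assoc; _-_)
  open import Algebra.Properties.Group (CommutativeRing.+-group commutativeRing) using () renaming (∙-cancelʳ to +-cancelʳ)


  private
    R-acr : AlmostCommutativeRing _ _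
    R-acr = fromCommutativeRing commutativeRing

    ℤ-raw : RawRing _ _
    ℤ-raw = record { _≈_ = _≡_ ; _+_ = ℤ._+_ ; _*_ = ℤ._*_ ; -_ = ℤ.-_ ; 0# = + 0 ; 1# = + 1 }

    ℤ⟶R : ℤ-raw -Raw-AlmostCommutative⟶ R-acr
    ℤ⟶R = record { ⟦_⟧ = ι ; +-homo = ι-+ ; *-homo = ι-* ; -‿homo = ι-neg
                 ; 0-homo = refl ; 1-homo = refl }

    ι-≟ : ∀ i j → Maybe (ι i ≡ ι j)
    ι-≟ i j with i ℤ.≟ j
    ... | yes i≡j = just (cong ι i≡j)
    ... | no _    = nothing

    module S = RingSolver ℤ-raw R-acr ℤ⟶R ι-≟

  -- A coefficient (a , b) stands for a + b μ, with b reduced modulo 4: the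
  -- solver then works modulo the relations 4 μ = 0 and μ² = 0.
  private
    Coeff : Set
    Coeff = ℤ × ℕ

    coeffRing : RawRing _ _
    coeffRing = record
      { Carrier = Coeff
      ; _≈_ = _≡_
      ; _+_ = λ { (a , b) (c , d) → a ℤ.+ c , (b ℕ.+ d) ℕ.% 4 }
      -- The term b d μ² is dropped. The integers a and c multiply μ only through their residues
      -- modulo 4, which keeps the second component in ℕ.
      ; _*_ = λ { (a , b) (c , d) → a ℤ.* c , ((a %ℕ 4) ℕ.* d ℕ.+ (c %ℕ 4) ℕ.* b) ℕ.% 4 }
      ; -_  = λ { (a , b) → ℤ.- a , (3 ℕ.* b) ℕ.% 4 }
      ; 0#  = + 0 , 0
      ; 1#  = + 1 , 0 }

    -- Integers and μ itself are evaluated without a redundant summand, so that the constants of the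
    -- solver are literally the terms in the goals. `value-general` restores the uniform formula.
    value : Coeff → R
    value (a   , 0)    = ι a
    value (+ 0 , 1)    = μ
    value (a   , b)    = ι a + ι (+ b) * μ

    value-general : ∀ a b → value (a , b) ≡ ι a + ι (+ b) * μ
    value-general a 0 = S.solve 2 (λ x m → x S.:= x S.:+ S.con (+ 0) S.:* m) refl (ι a) μ
    value-general (+ 0) 1 = S.solve 1 (λ m → m S.:= S.con (+ 0) S.:+ S.con (+ 1) S.:* m) refl μ
    value-general (+ suc _) 1 = refl
    value-general -[1+ _ ] 1 = refl
    value-general (+ 0) (suc (suc _)) = refl
    value-general (+ suc _) (suc (suc _)) = refl
    value-general -[1+ _ ] (suc (suc _)) = refl

    4k*μ : ∀ k → ι (k ℤ.* + 4) * μ ≡ 0#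
    4k*μ k = begin
      ι (k ℤ.* + 4) * μ   ≡⟨ cong (_* μ) (ι-* k (+ 4)) ⟩
      ι k * ι (+ 4) * μ   ≡⟨ *-assoc (ι k) (ι (+ 4)) μ ⟩
      ι k * (ι (+ 4) * μ) ≡⟨ cong (ι k *_) 4μ≡0 ⟩
      ι k * 0#            ≡⟨ zeroʳ (ι k) ⟩
      0#                  ∎

    reduce-ℤ : ∀ a → ι (+ (a %ℕ 4)) * μ ≡ ι a * μ
    reduce-ℤ a = sym (begin
      ι a * μ
        ≡⟨ cong (λ i → ι i * μ) (ℤ.a≡a%ℕn+[a/ℕn]*n a 4) ⟩
      ι (+ (a %ℕ 4) ℤ.+ (a /ℕ 4) ℤ.* + 4) * μ
        ≡⟨ cong (_* μ) (ι-+ _ ((a /ℕ 4) ℤ.* + 4)) ⟩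
      (ι (+ (a %ℕ 4)) + ι ((a /ℕ 4) ℤ.* + 4)) * μ
        ≡⟨ S.solve 3 (λ x y m → (x S.:+ y) S.:* m S.:= x S.:* m S.:+ y S.:* m) refl _ _ μ ⟩
      ι (+ (a %ℕ 4)) * μ + ι ((a /ℕ 4) ℤ.* + 4) * μ
        ≡⟨ cong (_+_ (ι (+ (a %ℕ 4)) * μ)) (4k*μ (a /ℕ 4)) ⟩
      ι (+ (a %ℕ 4)) * μ + 0#
        ≡⟨ +-identityʳ _ ⟩
      ι (+ (a %ℕ 4)) * μ ∎)

    value-reduce : ∀ a b → value (a , b ℕ.% 4) ≡ ι a + ι (+ b) * μ
    value-reduce a b = trans (value-general a (b ℕ.% 4)) (cong (_+_ (ι a)) (reduce-ℤ (+ b)))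

    value-+ : ∀ x y → value (RawRing._+_ coeffRing x y) ≡ value x + value y
    value-+ (a , b) (c , d) = begin
      value (a ℤ.+ c , (b ℕ.+ d) ℕ.% 4)
        ≡⟨ value-reduce (a ℤ.+ c) (b ℕ.+ d) ⟩
      ι (a ℤ.+ c) + ι (+ b ℤ.+ + d) * μ
        ≡⟨ cong₂ (λ x y → x + y * μ) (ι-+ a c) (ι-+ (+ b) (+ d)) ⟩
      (ι a + ι c) + (ι (+ b) + ι (+ d)) * μ
        ≡⟨ S.solve 5 (λ a b c d m → (a S.:+ c) S.:+ (b S.:+ d) S.:* m
             S.:= (a S.:+ b S.:* m) S.:+ (c S.:+ d S.:* m)) refl (ι a) (ι (+ b)) (ι c) (ι (+ d)) μ ⟩
      (ι a + ι (+ b) * μ) + (ι c + ι (+ d) * μ)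
        ≡⟨ cong₂ _+_ (value-general a b) (value-general c d) ⟨
      value (a , b) + value (c , d) ∎

    value-* : ∀ x y → value (RawRing._*_ coeffRing x y) ≡ value x * value y
    value-* (a , b) (c , d) = begin
      value (a ℤ.* c , ((a %ℕ 4) ℕ.* d ℕ.+ (c %ℕ 4) ℕ.* b) ℕ.% 4)
        ≡⟨ value-reduce (a ℤ.* c) _ ⟩
      ι (a ℤ.* c) + ι (+ ((a %ℕ 4) ℕ.* d) ℤ.+ + ((c %ℕ 4) ℕ.* b)) * μ
        ≡⟨ cong₂ (λ x y → x + y * μ) (ι-* a c) (trans (ι-+ (+ ((a %ℕ 4) ℕ.* d)) (+ ((c %ℕ 4) ℕ.* b)))
             (cong₂ _+_ (ι-pos-* (a %ℕ 4) d) (ι-pos-* (c %ℕ 4) b))) ⟩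
      ι a * ι c + (A * D + B′ * B) * μ
        ≡⟨ S.solve 7 (λ a A c B′ D B m → a S.:* c S.:+ (A S.:* D S.:+ B′ S.:* B) S.:* m
             S.:= a S.:* c S.:+ D S.:* (A S.:* m) S.:+ B S.:* (B′ S.:* m)) refl (ι a) A (ι c) B′ D B μ ⟩
      ι a * ι c + D * (A * μ) + B * (B′ * μ)
        ≡⟨ cong₂ (λ x y → ι a * ι c + D * x + B * y) (reduce-ℤ a) (reduce-ℤ c) ⟩
      ι a * ι c + D * (ι a * μ) + B * (ι c * μ)
        ≡⟨ S.solve 5 (λ a b c d m → a S.:* c S.:+ d S.:* (a S.:* m) S.:+ b S.:* (c S.:* m)
             S.:= (a S.:+ b S.:* m) S.:* (c S.:+ d S.:* m) S.:+ S.:- (b S.:* d S.:* (m S.:* m)))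
             refl (ι a) B (ι c) D μ ⟩
      (ι a + B * μ) * (ι c + D * μ) + - (B * D * (μ * μ))
        ≡⟨ cong (λ x → (ι a + B * μ) * (ι c + D * μ) + - (B * D * x)) μ*μ≡0 ⟩
      (ι a + B * μ) * (ι c + D * μ) + - (B * D * 0#)
        ≡⟨ S.solve 2 (λ x y → x S.:+ S.:- (y S.:* S.con (+ 0)) S.:= x) refl _ (B * D) ⟩
      (ι a + B * μ) * (ι c + D * μ)
        ≡⟨ cong₂ _*_ (value-general a b) (value-general c d) ⟨
      value (a , b) * value (c , d) ∎
      where
      A B B′ D : R
      A  = ι (+ (a %ℕ 4))
      B  = ι (+ b)
      B′ = ι (+ (c %ℕ 4))
      D  = ι (+ d)
      ι-pos-* : ∀ m n → ι (+ (m ℕ.* n)) ≡ ι (+ m) * ι (+ n)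
      ι-pos-* m n = trans (cong ι (ℤ.pos-* m n)) (ι-* (+ m) (+ n))

    value-neg : ∀ x → value (RawRing.-_ coeffRing x) ≡ - value x
    value-neg (a , b) = begin
      value (ℤ.- a , (3 ℕ.* b) ℕ.% 4)
        ≡⟨ value-reduce (ℤ.- a) (3 ℕ.* b) ⟩
      ι (ℤ.- a) + ι (+ (3 ℕ.* b)) * μ
        ≡⟨ cong₂ (λ x y → x + y * μ) (ι-neg a) (trans (cong ι (ℤ.pos-* 3 b)) (ι-* (+ 3) (+ b))) ⟩
      - ι a + (ι (+ 3) * ι (+ b)) * μ
        ≡⟨ S.solve 3 (λ a b m → S.:- a S.:+ (S.con (+ 3) S.:* b) S.:* m
             S.:= S.:- (a S.:+ b S.:* m) S.:+ b S.:* (S.con (+ 4) S.:* m)) refl (ι a) (ι (+ b)) μ ⟩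
      - (ι a + ι (+ b) * μ) + ι (+ b) * (ι (+ 4) * μ)
        ≡⟨ cong (λ x → - (ι a + ι (+ b) * μ) + ι (+ b) * x) 4μ≡0 ⟩
      - (ι a + ι (+ b) * μ) + ι (+ b) * 0#
        ≡⟨ S.solve 2 (λ x y → x S.:+ y S.:* S.con (+ 0) S.:= x) refl _ (ι (+ b)) ⟩
      - (ι a + ι (+ b) * μ)
        ≡⟨ cong -_ (value-general a b) ⟨
      - value (a , b) ∎

    coeff⟶R : coeffRing -Raw-AlmostCommutative⟶ R-acr
    coeff⟶R = record { ⟦_⟧ = value ; +-homo = value-+ ; *-homo = value-* ; -‿homo = value-neg
                     ; 0-homo = refl ; 1-homo = refl }

    value-≟ : ∀ x y → Maybe (value x ≡ value y)
    value-≟ (a , b) (c , d) with a ℤ.≟ c | b ℕ.≟ d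
    ... | yes a≡c | yes b≡d = just (cong₂ (λ a b → value (a , b)) a≡c b≡d)
    ... | _       | _       = nothing

  open RingSolver coeffRing R-acr coeff⟶R value-≟ public

  :0 :1 :μ :ν : ∀ {n} → Polynomial n
  :0 = con (+ 0 , 0)
  :1 = con (+ 1 , 0)
  :μ = con (+ 0 , 1)
  :ν = :μ :+ :μ

  -- The solver never discards the zero monomials that arise when zero divisors are
  -- multiplied, except in sums of two polynomials with the same monomials.
  -- Adding a dense polynomial to both sides of an equation makes it do so.
  dense : ∀ {n} → Polynomial n → Polynomial n → Polynomial n → Polynomial n
  dense x y z = (:1 :+ x) :^ 4 :* (:1 :+ y) :^ 4 :* (:1 :+ z) :^ 4

  cancel : ∀ d {x y} → x + d ≡ y + d → x ≡ y
  cancel d {x} {y} = +-cancelʳ d x y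

  ν : R
  ν = μ + μ

  -- Every residue has a natural representative, so adding 1 repeatedly reaches all of them. This
  -- induction takes the place of closed formulas that would divide by 2.
  R-ind : (P : R → Set) → P 0# → (∀ x → P x → P (x + 1#)) → ∀ x → P x
  R-ind P P0 P+ x with ι-surjective x
  ... | a , refl = go a
    where
    go : ∀ a → P (ι (+ a))
    go zero    = P0
    go (suc a) = subst P (trans (sym (ι-+ (+ a) (+ 1))) (cong (λ n → ι (+ n)) (ℕ.+-comm a 1)))
                   (P+ _ (go a))

  -- Lets the solver use a relation z = 0 that is not built into its coefficients: `w` is the
  -- cofactor, as in a certificate of ideal membership.
  modulo : ∀ {z x y} w → z ≡ 0# → x ≡ y + w * z → x ≡ y
  modulo {_} {x} {y} w refl e = trans e (solve 2 (λ y w → y :+ w :* :0 := y) refl y w)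

  -- The cross term is the polarisation of the quadratic form x(x - 1)/2.
  t-+ : ∀ x y → t (x + y) ≡ t x + t y + μ * (x * y)
  t-+ x = R-ind _ base step
    where
    base : t (x + 0#) ≡ t x + t 0# + μ * (x * 0#)
    base = begin
      t (x + 0#) ≡⟨ cong t (+-identityʳ x) ⟩
      t x        ≡⟨ solve 2 (λ x a → a := a :+ :0 :+ :μ :* (x :* :0)) refl x (t x) ⟩
      t x + 0# + μ * (x * 0#) ≡⟨ cong (λ z → t x + z + μ * (x * 0#)) t-zero ⟨
      t x + t 0# + μ * (x * 0#) ∎
    step : ∀ y → t (x + y) ≡ t x + t y + μ * (x * y) →
           t (x + (y + 1#)) ≡ t x + t (y + 1#) + μ * (x * (y + 1#))
    step y ih = begin
      t (x + (y + 1#))        ≡⟨ cong t (solve 2 (λ x y → x :+ (y :+ :1) := (x :+ y) :+ :1) refl x y) ⟩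
      t ((x + y) + 1#)        ≡⟨ t-suc (x + y) ⟩
      t (x + y) + μ * (x + y) ≡⟨ cong (_+ μ * (x + y)) ih ⟩
      t x + t y + μ * (x * y) + μ * (x + y)
        ≡⟨ solve 4 (λ x y a b → a :+ b :+ :μ :* (x :* y) :+ :μ :* (x :+ y)
             := a :+ (b :+ :μ :* y) :+ :μ :* (x :* (y :+ :1))) refl x y (t x) (t y) ⟩
      t x + (t y + μ * y) + μ * (x * (y + 1#))
        ≡⟨ cong (λ z → t x + z + μ * (x * (y + 1#))) (t-suc y) ⟨
      t x + t (y + 1#) + μ * (x * (y + 1#)) ∎

  -- The increments of `t` are multiples of μ, and μ² = 0.
  μ*t : ∀ x → μ * t x ≡ 0#
  μ*t = R-ind _ (trans (cong (μ *_) t-zero) (zeroʳ μ)) λ x ih → begin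
    μ * t (x + 1#)    ≡⟨ cong (μ *_) (t-suc x) ⟩
    μ * (t x + μ * x) ≡⟨ solve 2 (λ x a → :μ :* (a :+ :μ :* x) := :μ :* a) refl x (t x) ⟩
    μ * t x           ≡⟨ ih ⟩
    0#                ∎

  2t : ∀ x → t x + t x - μ * (x * x - x) ≡ 0#
  2t = R-ind _
    (trans (cong (λ z → z + z - μ * (0# * 0# - 0#)) t-zero)
           (solve 0 (:0 :+ :0 :- :μ :* (:0 :* :0 :- :0) := :0) refl))
    λ x ih → begin
    t (x + 1#) + t (x + 1#) - μ * ((x + 1#) * (x + 1#) - (x + 1#))
      ≡⟨ cong (λ z → z + z - μ * ((x + 1#) * (x + 1#) - (x + 1#))) (t-suc x) ⟩
    (t x + μ * x) + (t x + μ * x) - μ * ((x + 1#) * (x + 1#) - (x + 1#))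
      ≡⟨ solve 2 (λ x a → (a :+ :μ :* x) :+ (a :+ :μ :* x) :- :μ :* ((x :+ :1) :* (x :+ :1) :- (x :+ :1))
           := a :+ a :- :μ :* (x :* x :- x)) refl x (t x) ⟩
    t x + t x - μ * (x * x - x) ≡⟨ ih ⟩
    0# ∎

  -- x² - x is even and 2ν = 4μ = 0.
  ν-idem : ∀ x → ν * (x * x - x) ≡ 0#
  ν-idem = R-ind _ (solve 0 (:ν :* (:0 :* :0 :- :0) := :0) refl) λ x ih →
    trans (solve 1 (λ x → :ν :* ((x :+ :1) :* (x :+ :1) :- (x :+ :1)) := :ν :* (x :* x :- x)) refl x) ih

  t-one : t 1# ≡ 0#
  t-one = begin
    t 1#          ≡⟨ cong t (+-identityˡ 1#) ⟨
    t (0# + 1#)   ≡⟨ t-suc 0# ⟩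
    t 0# + μ * 0# ≡⟨ cong₂ _+_ t-zero (zeroʳ μ) ⟩
    0# + 0#       ≡⟨ +-identityʳ 0# ⟩
    0#            ∎

  t-double : ∀ z → μ * z ≡ 0# → t (z + z) ≡ 0#
  t-double z μz≡0 = begin
    t (z + z)                 ≡⟨ t-+ z z ⟩
    t z + t z + μ * (z * z)   ≡⟨ modulo 1# (2t z) (solve 2 (λ z a → a :+ a :+ :μ :* (z :* z)
                                   := :μ :* z :* (z :+ z :- :1) :+ :1 :* (a :+ a :- :μ :* (z :* z :- z))) refl z (t z)) ⟩
    μ * z * (z + z - 1#)      ≡⟨ cong (_* (z + z - 1#)) μz≡0 ⟩
    0# * (z + z - 1#)         ≡⟨ zeroˡ _ ⟩
    0#                        ∎

  -- Besides `t (z + z)`, which vanishes, only a cross term with the factor μz appears. Applied with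
  -- z a multiple of μ or a value of `t`, this makes the perturbations of the coordinates invisible
  -- to `t`.
  t-shift : ∀ x z → μ * z ≡ 0# → t (x + (z + z)) ≡ t x
  t-shift x z μz≡0 = begin
    t (x + (z + z))                       ≡⟨ t-+ x (z + z) ⟩
    t x + t (z + z) + μ * (x * (z + z))   ≡⟨ cong (λ s → t x + s + μ * (x * (z + z))) (t-double z μz≡0) ⟩
    t x + 0# + μ * (x * (z + z))          ≡⟨ modulo (x + x) μz≡0 (solve 3 (λ x z a →
                                               a :+ :0 :+ :μ :* (x :* (z :+ z)) := a :+ (x :+ x) :* (:μ :* z)) refl x z (t x)) ⟩
    t x                                   ∎

  t-shift-ν : ∀ x z → t (x + ν * z) ≡ t x
  t-shift-ν x z = trans
    (cong t (solve 2 (λ x z → x :+ :ν :* z := x :+ (:μ :* z :+ :μ :* z)) refl x z))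
    (t-shift x (μ * z) (solve 1 (λ z → :μ :* (:μ :* z) := :0) refl z))

  -- y(y - 1)/2 is symmetric under y ↦ 1 - y.
  t-neg : ∀ x → t (- x) ≡ t (x + 1#)
  t-neg x = begin
    t (- x)
      ≡⟨ modulo 1# t-0 (solve 3 (λ x a b → b := :μ :* (x :* x) :- a :+ :1 :* (a :+ b :+ :μ :* (x :* (:- x))))
           refl x (t x) (t (- x))) ⟩
    μ * (x * x) - t x
      ≡⟨ modulo (- 1#) (2t x) (solve 2 (λ x a → :μ :* (x :* x) :- a
           := (a :+ :μ :* x) :+ (:- :1) :* (a :+ a :- :μ :* (x :* x :- x))) refl x (t x)) ⟩
    t x + μ * x ≡⟨ t-suc x ⟨
    t (x + 1#)  ∎
    where
    t-0 : t x + t (- x) + μ * (x * (- x)) ≡ 0#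
    t-0 = begin
      t x + t (- x) + μ * (x * (- x)) ≡⟨ t-+ x (- x) ⟨
      t (x - x) ≡⟨ cong t (solve 1 (λ x → x :- x := :0) refl x) ⟩
      t 0#      ≡⟨ t-zero ⟩
      0#        ∎

-- Triangular numbers and the construction of the twist.

triangular : ℕ → ℕ
triangular zero    = 0
triangular (suc n) = n ℕ.+ triangular n

triangular-+ : ∀ m n → triangular (m ℕ.+ n) ≡ triangular m ℕ.+ triangular n ℕ.+ m ℕ.* n
triangular-+ zero    n = sym (ℕ.+-identityʳ _)
triangular-+ (suc m) n = trans (cong (m ℕ.+ n ℕ.+_) (triangular-+ m n))
  (solve 4 (λ m n x y → m :+ n :+ (x :+ y :+ m :* n) := m :+ x :+ y :+ (n :+ m :* n))
     refl m n (triangular m) (triangular n))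
  where open ℕ.+-*-Solver

-- The number is 8k(16k - 1). The factor 4 is what counts, because μ annihilates it; the cofactor is
-- written without subtraction.
triangular-16k : ∀ k → triangular (16 ℕ.* k) ≡ 4 ℕ.* (triangular (4 ℕ.* k) ℕ.+ 24 ℕ.* (k ℕ.* k))
triangular-16k k = begin
  triangular (16 ℕ.* k)
    ≡⟨ cong triangular (solve 1 (λ k → con 16 :* k := (con 4 :* k :+ con 4 :* k) :+ (con 4 :* k :+ con 4 :* k)) refl k) ⟩
  triangular (2l ℕ.+ 2l)
    ≡⟨ triangular-+ 2l 2l ⟩
  triangular 2l ℕ.+ triangular 2l ℕ.+ 2l ℕ.* 2l
    ≡⟨ cong (λ x → x ℕ.+ x ℕ.+ 2l ℕ.* 2l) (triangular-+ l l) ⟩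
  (triangular l ℕ.+ triangular l ℕ.+ l ℕ.* l) ℕ.+ (triangular l ℕ.+ triangular l ℕ.+ l ℕ.* l) ℕ.+ 2l ℕ.* 2l
    ≡⟨ solve 2 (λ k x → let l = con 4 :* k in
         (x :+ x :+ l :* l) :+ (x :+ x :+ l :* l) :+ (l :+ l) :* (l :+ l)
         := con 4 :* (x :+ con 24 :* (k :* k))) refl k (triangular l) ⟩
  4 ℕ.* (triangular l ℕ.+ 24 ℕ.* (k ℕ.* k)) ∎
  where
  open ≡-Reasoning
  open ℕ.+-*-Solver
  l  = 4 ℕ.* k
  2l = l ℕ.+ l

module TwistConstruction {p : ℕ} .{{_ : NonZero p}} (C : CyclicRing p) (m : ℤ) (x : ℕ)
  (4m≡0 : CyclicRing.ι C (+ 4 ℤ.* m) ≡ CyclicRing.ι C (+ 0))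
  (m²≡0 : CyclicRing.ι C (m ℤ.* m) ≡ CyclicRing.ι C (+ 0))
  (triangular-p : triangular p ≡ 4 ℕ.* x) where
  open CyclicRing C
  open CommutativeRing commutativeRing
    using (zeroˡ; zeroʳ; +-identityʳ; distribˡ; +-comm; *-comm; *-assoc)
  open ≡-Reasoning

  private
    μ 0# : R
    μ  = ι m
    0# = ι (+ 0)

    ι-ℕ-* : ∀ a b → ι (+ (a ℕ.* b)) ≡ ι (+ a) * ι (+ b)
    ι-ℕ-* a b = trans (cong ι (ℤ.pos-* a b)) (ι-* (+ a) (+ b))

    τ : ℕ → R
    τ a = μ * ι (+ triangular a)

    τ-+ : ∀ a b → τ (a ℕ.+ b) ≡ τ a + τ b + μ * (ι (+ a) * ι (+ b))
    τ-+ a b = begin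
      μ * ι (+ triangular (a ℕ.+ b))
        ≡⟨ cong (λ n → μ * ι (+ n)) (triangular-+ a b) ⟩
      μ * ι (+ (triangular a ℕ.+ triangular b) ℤ.+ + (a ℕ.* b))
        ≡⟨ cong (μ *_) (ι-+ (+ (triangular a ℕ.+ triangular b)) (+ (a ℕ.* b))) ⟩
      μ * (ι (+ triangular a ℤ.+ + triangular b) + ι (+ (a ℕ.* b)))
        ≡⟨ cong (μ *_) (cong₂ _+_ (ι-+ (+ triangular a) (+ triangular b)) (ι-ℕ-* a b)) ⟩
      μ * (ι (+ triangular a) + ι (+ triangular b) + ι (+ a) * ι (+ b))
        ≡⟨ distribˡ μ _ _ ⟩
      μ * (ι (+ triangular a) + ι (+ triangular b)) + μ * (ι (+ a) * ι (+ b))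
        ≡⟨ cong (_+ μ * (ι (+ a) * ι (+ b))) (distribˡ μ _ _) ⟩
      τ a + τ b + μ * (ι (+ a) * ι (+ b)) ∎

    τ-zero : τ 0 ≡ 0#
    τ-zero = zeroʳ μ

    τ-p : τ p ≡ 0#
    τ-p = begin
      μ * ι (+ triangular p)      ≡⟨ cong (λ n → μ * ι (+ n)) triangular-p ⟩
      μ * ι (+ (4 ℕ.* x))         ≡⟨ cong (μ *_) (ι-ℕ-* 4 x) ⟩
      μ * (ι (+ 4) * ι (+ x))     ≡⟨ *-assoc μ (ι (+ 4)) (ι (+ x)) ⟨
      μ * ι (+ 4) * ι (+ x)       ≡⟨ cong (_* ι (+ x)) (trans (*-comm μ (ι (+ 4))) (trans (sym (ι-* (+ 4) m)) 4m≡0)) ⟩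
      0# * ι (+ x)                ≡⟨ zeroˡ _ ⟩
      0#                          ∎

    -- Adding p contributes the triangular number of p, a multiple of 4 and hence killed by μ, and a
    -- cross term divisible by p. This makes `t` independent of the chosen representative.
    τ-+p : ∀ a d → τ (a ℕ.+ d ℕ.* p) ≡ τ a
    τ-+p a zero = cong τ (ℕ.+-identityʳ a)
    τ-+p a (suc d) = begin
      τ (a ℕ.+ (p ℕ.+ d ℕ.* p))   ≡⟨ cong τ (trans (cong (a ℕ.+_) (ℕ.+-comm p (d ℕ.* p))) (sym (ℕ.+-assoc a (d ℕ.* p) p))) ⟩
      τ ((a ℕ.+ d ℕ.* p) ℕ.+ p)   ≡⟨ τ-+ (a ℕ.+ d ℕ.* p) p ⟩
      τ (a ℕ.+ d ℕ.* p) + τ p + μ * (ι (+ (a ℕ.+ d ℕ.* p)) * ι (+ p))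
        ≡⟨ cong₂ (λ u w → τ (a ℕ.+ d ℕ.* p) + u + μ * (ι (+ (a ℕ.+ d ℕ.* p)) * w)) τ-p ι-modulus ⟩
      τ (a ℕ.+ d ℕ.* p) + 0# + μ * (ι (+ (a ℕ.+ d ℕ.* p)) * 0#)
        ≡⟨ cong₂ _+_ (+-identityʳ _) (trans (cong (μ *_) (zeroʳ _)) (zeroʳ μ)) ⟩
      τ (a ℕ.+ d ℕ.* p) + 0#      ≡⟨ +-identityʳ _ ⟩
      τ (a ℕ.+ d ℕ.* p)           ≡⟨ τ-+p a d ⟩
      τ a                         ∎

    τ-cong : ∀ {a b} → ι (+ a) ≡ ι (+ b) → τ a ≡ τ b
    τ-cong {a} {b} eq = begin
      τ a                              ≡⟨ cong τ (ℕ.m≡m%n+[m/n]*n a p) ⟩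
      τ (a ℕ.% p ℕ.+ (a ℕ./ p) ℕ.* p)  ≡⟨ τ-+p (a ℕ.% p) (a ℕ./ p) ⟩
      τ (a ℕ.% p)                      ≡⟨ cong τ (ι-kernel eq) ⟩
      τ (b ℕ.% p)                      ≡⟨ τ-+p (b ℕ.% p) (b ℕ./ p) ⟨
      τ (b ℕ.% p ℕ.+ (b ℕ./ p) ℕ.* p)  ≡⟨ cong τ (ℕ.m≡m%n+[m/n]*n b p) ⟨
      τ b                              ∎

    rep : R → ℕ
    rep y = proj₁ (ι-surjective y)

    ι-rep : ∀ y → ι (+ rep y) ≡ y
    ι-rep y = proj₂ (ι-surjective y)

    t-suc : ∀ y → τ (rep (y + ι (+ 1))) ≡ τ (rep y) + μ * y
    t-suc y = begin
      τ (rep (y + ι (+ 1)))        ≡⟨ τ-cong ι-suc-rep ⟩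
      μ * ι (+ rep y ℤ.+ + triangular (rep y))
                                   ≡⟨ cong (μ *_) (ι-+ (+ rep y) (+ triangular (rep y))) ⟩
      μ * (ι (+ rep y) + ι (+ triangular (rep y)))
                                   ≡⟨ distribˡ μ _ _ ⟩
      μ * ι (+ rep y) + τ (rep y)  ≡⟨ +-comm _ _ ⟩
      τ (rep y) + μ * ι (+ rep y)  ≡⟨ cong (λ z → τ (rep y) + μ * z) (ι-rep y) ⟩
      τ (rep y) + μ * y            ∎
      where
      ι-suc-rep : ι (+ rep (y + ι (+ 1))) ≡ ι (+ suc (rep y))
      ι-suc-rep = begin
        ι (+ rep (y + ι (+ 1)))  ≡⟨ ι-rep (y + ι (+ 1)) ⟩
        y + ι (+ 1)              ≡⟨ cong (_+ ι (+ 1)) (ι-rep y) ⟨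
        ι (+ rep y) + ι (+ 1)    ≡⟨ ι-+ (+ rep y) (+ 1) ⟨
        ι (+ (rep y ℕ.+ 1))      ≡⟨ cong (λ a → ι (+ a)) (ℕ.+-comm (rep y) 1) ⟩
        ι (+ suc (rep y))        ∎

  twist : Twist C
  twist = record
    { μ = μ
    ; 4μ≡0 = trans (sym (ι-* (+ 4) m)) 4m≡0
    ; μ*μ≡0 = trans (sym (ι-* m m)) m²≡0
    ; t = λ y → τ (rep y)
    ; t-zero = trans (τ-cong (ι-rep 0#)) τ-zero
    ; t-suc = t-suc }

-- Ends and sides of edges, and the two rotations.

module Incidence {p : ℕ} .{{_ : NonZero p}} (C : CyclicRing p) (Tw : Twist C) where
  open CyclicRing C
  open Twist Tw
  open TwistProperties C Tw
  open CommutativeRing commutativeRing using (_-_)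
  open ≡-Reasoning

  Edge Face : Set
  Edge = R × R
  Face = Bool × R

  end : Bool → Edge → R
  end false (a , h) = a
  end true  (a , h) = a + 1# + ν * h

  side : Bool → Edge → R
  side false (a , h) = h
  side true  (a , h) = h - a - 1# + ν * (h * a) - t (a + 1#)

  -- The solution `e` of `end b e ≡ v` and `side c e ≡ k`. Existence and uniqueness for all four
  -- choices of `b` and `c` yield the diamond condition, the type and the number of flags.
  edge : Bool → Bool → R → R → Edge
  edge false false v k = v , k
  edge true  false v k = v - 1# - ν * k , k
  edge false true  v k = v , k + v + 1# + t (v + 1#) + ν * (v * k)
  edge true  true  v k = v - 1# - ν * (k + v) , k + v + ν * (v * (1# + k)) + t v

  end-edge : ∀ b c v k → end b (edge b c v k) ≡ v
  end-edge false false v k = refl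
  end-edge false true  v k = refl
  end-edge true  false v k = solve 2 (λ v k → v :- :1 :- :ν :* k :+ :1 :+ :ν :* k := v) refl v k
  end-edge true  true  v k = modulo (1# + 1#) (μ*t v) (solve 3 (λ v k a →
      v :- :1 :- :ν :* (k :+ v) :+ :1 :+ :ν :* (k :+ v :+ :ν :* (v :* (:1 :+ k)) :+ a)
      := v :+ (:1 :+ :1) :* (:μ :* a)) refl v k (t v))

  side-edge : ∀ b c v k → side c (edge b c v k) ≡ k
  side-edge false false v k = refl
  side-edge true  false v k = refl
  side-edge false true  v k = modulo (v + v) (μ*t (v + 1#)) (modulo 1# (ν-idem v)
    (solve 3 (λ v k a → (k :+ v :+ :1 :+ a :+ :ν :* (v :* k)) :- v :- :1
         :+ :ν :* ((k :+ v :+ :1 :+ a :+ :ν :* (v :* k)) :* v) :- a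
      := k :+ (v :+ v) :* (:μ :* a) :+ :1 :* (:ν :* (v :* v :- v))) refl v k (t (v + 1#))))
  side-edge true  true  v k = begin
    h - a - 1# + ν * (h * a) - t (a + 1#)
      ≡⟨ cong (λ s → h - a - 1# + ν * (h * a) - s) t-a+1 ⟩
    h - a - 1# + ν * (h * a) - t v
      -- After substitution only multiples of μ · `t v` and of ν(v² - v) are left over; the
      -- cofactors passed to `modulo` remove them.
      ≡⟨ modulo ((1# + 1#) * (v - 1#)) (μ*t v) (modulo 1# (ν-idem v) (cancel _ (solve 3 (λ v k s →
           let h = k :+ v :+ :ν :* (v :* (:1 :+ k)) :+ s
               a = v :- :1 :- :ν :* (k :+ v)
           in h :- a :- :1 :+ :ν :* (h :* a) :- s :+ dense v k s
              := k :+ (:1 :+ :1) :* (v :- :1) :* (:μ :* s) :+ :1 :* (:ν :* (v :* v :- v)) :+ dense v k s)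
           refl v k (t v)))) ⟩
    k ∎
    where
    a = v - 1# - ν * (k + v)
    h = k + v + ν * (v * (1# + k)) + t v
    t-a+1 : t (a + 1#) ≡ t v
    t-a+1 = trans (cong t (solve 2 (λ v k → v :- :1 :- :ν :* (k :+ v) :+ :1
                    := v :+ :ν :* (:- (k :+ v))) refl v k)) (t-shift-ν v (- (k + v)))

  edge-end-side : ∀ b c e → edge b c (end b e) (side c e) ≡ e
  edge-end-side false false (a , h) = refl
  edge-end-side true  false (a , h) = cong (_, h)
    (solve 2 (λ a h → a :+ :1 :+ :ν :* h :- :1 :- :ν :* h := a) refl a h)
  edge-end-side false true  (a , h) = cong (a ,_)
    (modulo (- (a + a)) (μ*t (a + 1#)) (modulo (- 1#) (ν-idem a)
    (solve 3 (λ a h s →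
      let k = h :- a :- :1 :+ :ν :* (h :* a) :- s
      in k :+ a :+ :1 :+ s :+ :ν :* (a :* k)
         := h :+ (:- (a :+ a)) :* (:μ :* s) :+ (:- :1) :* (:ν :* (a :* a :- a)))
      refl a h (t (a + 1#)))))
  edge-end-side true  true  (a , h) = cong₂ _,_
    (modulo (1# + 1#) (μ*t (a + 1#)) (solve 3 (λ a h s →
      let k = h :- a :- :1 :+ :ν :* (h :* a) :- s
          v = a :+ :1 :+ :ν :* h
      in v :- :1 :- :ν :* (k :+ v) := a :+ (:1 :+ :1) :* (:μ :* s)) refl a h (t (a + 1#))))
    (begin
      k + v + ν * (v * (1# + k)) + t v
        ≡⟨ cong (λ s → k + v + ν * (v * (1# + k)) + s) (t-shift-ν (a + 1#) h) ⟩
      k + v + ν * (v * (1# + k)) + t (a + 1#)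
        ≡⟨ modulo (- (1# + 1#) * (a + 1#)) (μ*t (a + 1#)) (modulo (- 1#) (ν-idem a) (cancel _ (solve 3 (λ a h s →
             let k = h :- a :- :1 :+ :ν :* (h :* a) :- s
                 v = a :+ :1 :+ :ν :* h
             in k :+ v :+ :ν :* (v :* (:1 :+ k)) :+ s :+ dense a h s
                := h :+ (:- (:1 :+ :1)) :* (a :+ :1) :* (:μ :* s) :+ (:- :1) :* (:ν :* (a :* a :- a)) :+ dense a h s)
             refl a h (t (a + 1#))))) ⟩
      h ∎)
    where
    v = a + 1# + ν * h
    k = h - a - 1# + ν * (h * a) - t (a + 1#)

  rotV₁ rotV₁⁻¹ rotV₂ rotV₂⁻¹ : R → R
  rotV₁   v = v + 1#
  rotV₁⁻¹ v = v - 1#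
  rotV₂   v = - v + μ * (v * v - v)
  rotV₂⁻¹ v = - v + μ * (v * v + v)

  -- As μ² = 0, the factors 1 - μ and 1 + μ are inverse to each other. `rotF₂` passes from the face
  -- numbered 2h + c to the next number.
  rotF₁ rotF₁⁻¹ rotF₂ rotF₂⁻¹ : Face → Face
  rotF₁   (false , h) = false , h - μ * h
  rotF₁   (true  , k) = true  , k - 1# + μ * k
  rotF₁⁻¹ (false , h) = false , h + μ * h
  rotF₁⁻¹ (true  , k) = true  , k + 1# - μ * (k + 1#)
  rotF₂   (false , h) = true  , h
  rotF₂   (true  , k) = false , k + 1#
  rotF₂⁻¹ (false , h) = true  , h - 1#
  rotF₂⁻¹ (true  , k) = false , k

  -- σ₂ interchanges the two ends and the two sides, so the false end and side of `rotE₂ e` must be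
  -- the images of the true ones of `e`. Half of the compatibility then holds by definition; the
  -- other half needs the choice of formulas.
  rotE₁ rotE₁⁻¹ rotE₂ rotE₂⁻¹ : Edge → Edge
  rotE₁   (a , h) = a + 1# , h - μ * h
  rotE₁⁻¹ (a , h) = a - 1# , h + μ * h
  rotE₂   e       = rotV₂ (end true e) , side true e + 1#
  rotE₂⁻¹ (a , h) = edge true true (rotV₂⁻¹ a) (h - 1#)

  rotV₁-inverseˡ : ∀ v → rotV₁ (rotV₁⁻¹ v) ≡ v
  rotV₁-inverseˡ = solve 1 (λ v → v :- :1 :+ :1 := v) refl

  rotV₁-inverseʳ : ∀ v → rotV₁⁻¹ (rotV₁ v) ≡ v
  rotV₁-inverseʳ = solve 1 (λ v → v :+ :1 :- :1 := v) refl

  rotV₂-inverseˡ : ∀ v → rotV₂ (rotV₂⁻¹ v) ≡ v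
  rotV₂-inverseˡ v = cancel _ (solve 1 (λ v → let w = :- v :+ :μ :* (v :* v :+ v) in
    :- w :+ :μ :* (w :* w :- w) :+ dense v v v := v :+ dense v v v) refl v)

  rotV₂-inverseʳ : ∀ v → rotV₂⁻¹ (rotV₂ v) ≡ v
  rotV₂-inverseʳ v = cancel _ (solve 1 (λ v → let w = :- v :+ :μ :* (v :* v :- v) in
    :- w :+ :μ :* (w :* w :+ w) :+ dense v v v := v :+ dense v v v) refl v)

  rotF₁-inverseˡ : ∀ f → rotF₁ (rotF₁⁻¹ f) ≡ f
  rotF₁-inverseˡ (false , h) = cong (false ,_) (solve 1 (λ h → h :+ :μ :* h :- :μ :* (h :+ :μ :* h) := h) refl h)
  rotF₁-inverseˡ (true  , k) = cong (true ,_) (solve 1 (λ k → let l = k :+ :1 :- :μ :* (k :+ :1) in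
    l :- :1 :+ :μ :* l := k) refl k)

  rotF₁-inverseʳ : ∀ f → rotF₁⁻¹ (rotF₁ f) ≡ f
  rotF₁-inverseʳ (false , h) = cong (false ,_) (solve 1 (λ h → h :- :μ :* h :+ :μ :* (h :- :μ :* h) := h) refl h)
  rotF₁-inverseʳ (true  , k) = cong (true ,_) (solve 1 (λ k → let l = k :- :1 :+ :μ :* k in
    l :+ :1 :- :μ :* (l :+ :1) := k) refl k)

  rotF₂-inverseˡ : ∀ f → rotF₂ (rotF₂⁻¹ f) ≡ f
  rotF₂-inverseˡ (false , h) = cong (false ,_) (rotV₁-inverseˡ h)
  rotF₂-inverseˡ (true  , k) = refl

  rotF₂-inverseʳ : ∀ f → rotF₂⁻¹ (rotF₂ f) ≡ f
  rotF₂-inverseʳ (false , h) = refl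
  rotF₂-inverseʳ (true  , k) = cong (true ,_) (rotV₁-inverseʳ k)

  rotE₁-inverseˡ : ∀ e → rotE₁ (rotE₁⁻¹ e) ≡ e
  rotE₁-inverseˡ (a , h) = cong₂ _,_ (rotV₁-inverseˡ a) (cong proj₂ (rotF₁-inverseˡ (false , h)))

  rotE₁-inverseʳ : ∀ e → rotE₁⁻¹ (rotE₁ e) ≡ e
  rotE₁-inverseʳ (a , h) = cong₂ _,_ (rotV₁-inverseʳ a) (cong proj₂ (rotF₁-inverseʳ (false , h)))

  rotE₂-inverseˡ : ∀ e → rotE₂ (rotE₂⁻¹ e) ≡ e
  rotE₂-inverseˡ (a , h) = cong₂ _,_
    (trans (cong rotV₂ (end-edge true true (rotV₂⁻¹ a) (h - 1#))) (rotV₂-inverseˡ a))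
    (trans (cong rotV₁ (side-edge true true (rotV₂⁻¹ a) (h - 1#))) (rotV₁-inverseˡ h))

  rotE₂-inverseʳ : ∀ e → rotE₂⁻¹ (rotE₂ e) ≡ e
  rotE₂-inverseʳ e = trans
    (cong₂ (edge true true) (rotV₂-inverseʳ (end true e)) (rotV₁-inverseʳ (side true e)))
    (edge-end-side true true e)

  face : Bool → Edge → Face
  face c e = c , side c e

  end-rotE₁ : ∀ b e → end b (rotE₁ e) ≡ rotV₁ (end b e)
  end-rotE₁ false (a , h) = refl
  end-rotE₁ true  (a , h) = solve 2 (λ a h →
    a :+ :1 :+ :1 :+ :ν :* (h :- :μ :* h) := a :+ :1 :+ :ν :* h :+ :1) refl a h

  face-rotE₁ : ∀ c e → face c (rotE₁ e) ≡ rotF₁ (face c e)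
  face-rotE₁ false (a , h) = refl
  face-rotE₁ true  (a , h) = cong (true ,_) (begin
    h′ - a′ - 1# + ν * (h′ * a′) - t (a′ + 1#)
      ≡⟨ cong (λ s → h′ - a′ - 1# + ν * (h′ * a′) - s) (t-suc a′) ⟩
    h′ - a′ - 1# + ν * (h′ * a′) - (t a′ + μ * a′)
      ≡⟨ modulo 1# (μ*t a′) (solve 3 (λ a h s →
           let h′ = h :- :μ :* h
               a′ = a :+ :1
               k  = h :- a :- :1 :+ :ν :* (h :* a) :- s
           in h′ :- a′ :- :1 :+ :ν :* (h′ :* a′) :- (s :+ :μ :* a′)
              := k :- :1 :+ :μ :* k :+ :1 :* (:μ :* s)) refl a h (t a′)) ⟩
    k - 1# + μ * k ∎)
    where
    h′ = h - μ * h
    a′ = a + 1#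
    k  = h - a - 1# + ν * (h * a) - t a′

  end-rotE₂ : ∀ b e → end (not b) (rotE₂ e) ≡ rotV₂ (end b e)
  end-rotE₂ true  e       = refl
  end-rotE₂ false (a , h) = modulo (1# + 1#) (μ*t (a + 1#)) (solve 3 (λ a h s →
    let v = a :+ :1 :+ :ν :* h
        k = h :- a :- :1 :+ :ν :* (h :* a) :- s
    in :- v :+ :μ :* (v :* v :- v) :+ :1 :+ :ν :* (k :+ :1)
       := :- a :+ :μ :* (a :* a :- a) :+ (:1 :+ :1) :* (:μ :* s)) refl a h (t (a + 1#)))

  face-rotE₂ : ∀ c e → face (not c) (rotE₂ e) ≡ rotF₂ (face c e)
  face-rotE₂ true  e       = refl
  face-rotE₂ false (a , h) = cong (true ,_) (begin
    h′ - a′ - 1# + ν * (h′ * a′) - t (a′ + 1#)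
      ≡⟨ cong (λ s → h′ - a′ - 1# + ν * (h′ * a′) - s) t-a′+1 ⟩
    h′ - a′ - 1# + ν * (h′ * a′) - τ
      ≡⟨ modulo (- (1# + 1#) * a′) (μ*t (a + 1#)) (modulo (- 1#) 2τ (cancel _ (solve 3 (λ a h s →
           let v  = a :+ :1 :+ :ν :* h
               k  = h :- a :- :1 :+ :ν :* (h :* a) :- s
               a′ = :- v :+ :μ :* (v :* v :- v)
               h′ = k :+ :1
           in h′ :- a′ :- :1 :+ :ν :* (h′ :* a′) :- s :+ dense a h s
              := h :+ (:- (:1 :+ :1)) :* a′ :* (:μ :* s)
                   :+ (:- :1) :* (s :+ s :- :μ :* ((a :+ :1) :* (a :+ :1) :- (a :+ :1))) :+ dense a h s)
           refl a h τ))) ⟩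
    h ∎)
    where
    τ  = t (a + 1#)
    v  = a + 1# + ν * h
    k  = h - a - 1# + ν * (h * a) - τ
    a′ = - v + μ * (v * v - v)
    h′ = k + 1#
    2τ = 2t (a + 1#)
    -- Here a′ + 1 is -a up to the shifts by νh and 2τ, which `t` does not see.
    t-a′+1 : t (a′ + 1#) ≡ τ
    t-a′+1 = begin
      t (a′ + 1#)
        ≡⟨ cong t (modulo (- 1#) 2τ (solve 3 (λ a h s →
             let v = a :+ :1 :+ :ν :* h
             in :- v :+ :μ :* (v :* v :- v) :+ :1
                := (:- a :+ :ν :* h) :+ (s :+ s)
                   :+ (:- :1) :* (s :+ s :- :μ :* ((a :+ :1) :* (a :+ :1) :- (a :+ :1)))) refl a h τ)) ⟩
      t ((- a + ν * h) + (τ + τ)) ≡⟨ t-shift _ τ (μ*t (a + 1#)) ⟩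
      t (- a + ν * h)             ≡⟨ t-shift-ν (- a) h ⟩
      t (- a)                     ≡⟨ t-neg a ⟩
      τ                           ∎

  -- The ends differ by 1 + νh, a unit because its square is 1.
  end-distinct : 1# ≢ 0# → ∀ e → end false e ≢ end true e
  end-distinct 1≢0 (a , h) eq = 1≢0 (begin
    1# ≡⟨ modulo (1# + ν * h) (trans (cong (λ x → x - a) (sym eq)) (solve 1 (λ a → a :- a := :0) refl a))
           (solve 2 (λ a h → :1 := :0 :+ (:1 :+ :ν :* h) :* (a :+ :1 :+ :ν :* h :- a)) refl a h) ⟩
    0# ∎)

  -- The i-fold rotation about the base face, acting on the odd faces.
  turn : R → R → R
  turn i k = k - i + i * (μ * k) - t i

  turn-suc : ∀ i k → turn (i + 1#) k ≡ proj₂ (rotF₁ (true , turn i k))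
  turn-suc i k = trans (cong (λ s → k - (i + 1#) + (i + 1#) * (μ * k) - s) (t-suc i))
    (modulo 1# (μ*t i) (solve 3 (λ i k s → let l = k :- i :+ i :* (:μ :* k) :- s in
      k :- (i :+ :1) :+ (i :+ :1) :* (:μ :* k) :- (s :+ :μ :* i)
      := l :- :1 :+ :μ :* l :+ :1 :* (:μ :* s)) refl i k (t i)))

-- Words in the presented group and their sorted normal form.

module Words (Rel : Relations) where

  infix 4 _≈_
  _≈_ : Word → Word → Set
  u ≈ w = Equal u Rel w

  wordSetoid : Setoid _ _
  wordSetoid = record { _≈_ = _≈_ ; isEquivalence = record { refl = ≈-refl ; sym = ≈-sym ; trans = ≈-trans } }

  open SetoidReasoning wordSetoid

  ++-congˡ : ∀ u {v w} → v ≈ w → u ++ v ≈ u ++ w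
  ++-congˡ u = ≈-cong (≈-refl {u = u})

  ++-congʳ : ∀ {u v} w → u ≈ v → u ++ w ≈ v ++ w
  ++-congʳ w u≈v = ≈-cong u≈v ≈-refl

  ≈-reflexive : ∀ {u w} → u ≡ w → u ≈ w
  ≈-reflexive refl = ≈-refl

  pow-suc : ∀ g i → (g , false) ∷ pow g i ≈ pow g (ℤ.suc i)
  pow-suc g (+ n)          = ≈-refl
  pow-suc g -[1+ zero ]    = ≈-free (g , false)
  pow-suc g -[1+ suc n ]   = ++-congʳ _ (≈-free (g , false))

  pow-pred : ∀ g i → (g , true) ∷ pow g i ≈ pow g (ℤ.pred i)
  pow-pred g (+ zero)      = ≈-refl
  pow-pred g (+ suc n)     = ++-congʳ _ (≈-free (g , true))
  pow-pred g -[1+ n ]      = ≈-refl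

  pow-+ : ∀ g i j → pow g i ++ pow g j ≈ pow g (i ℤ.+ j)
  pow-+ g (+ zero)  j = ≈-reflexive (cong (pow g) (sym (ℤ.+-identityˡ j)))
  pow-+ g (+ suc n) j = begin
    (g , false) ∷ (pow g (+ n) ++ pow g j) ≈⟨ ++-congˡ ((g , false) ∷ []) (pow-+ g (+ n) j) ⟩
    (g , false) ∷ pow g (+ n ℤ.+ j)        ≈⟨ pow-suc g (+ n ℤ.+ j) ⟩
    pow g (ℤ.suc (+ n ℤ.+ j))              ≡⟨ cong (pow g) (sym (ℤ.+-assoc (+ 1) (+ n) j)) ⟩
    pow g (+ suc n ℤ.+ j)                  ∎
  pow-+ g -[1+ zero ] j  = pow-pred g j
  pow-+ g -[1+ suc n ] j = begin
    (g , true) ∷ (pow g -[1+ n ] ++ pow g j) ≈⟨ ++-congˡ ((g , true) ∷ []) (pow-+ g -[1+ n ] j) ⟩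
    (g , true) ∷ pow g (-[1+ n ] ℤ.+ j)      ≈⟨ pow-pred g (-[1+ n ] ℤ.+ j) ⟩
    pow g (ℤ.pred (-[1+ n ] ℤ.+ j))          ≡⟨ cong (pow g) (sym (ℤ.+-assoc -[1+ 0 ] -[1+ n ] j)) ⟩
    pow g (-[1+ suc n ] ℤ.+ j)               ∎

  -- Left multiplication by a power, which keeps all words bracketed to the right.
  infixr 6 _^_·_
  _^_·_ : Gen → ℤ → Word → Word
  g ^ i · w = pow g i ++ w

  ·-cong : ∀ g i {v w} → v ≈ w → g ^ i · v ≈ g ^ i · w
  ·-cong g i = ++-congˡ (pow g i)

  ·-· : ∀ g i j w → g ^ i · g ^ j · w ≈ g ^ (i ℤ.+ j) · w
  ·-· g i j w = ≈-trans (≈-reflexive (sym (++-assoc (pow g i) (pow g j) w))) (++-congʳ w (pow-+ g i j))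

  ·-≡ : ∀ g {i j} w → i ≡ j → g ^ i · w ≈ g ^ j · w
  ·-≡ g w refl = ≈-refl

  ·-merge : ∀ g i j {k} w → i ℤ.+ j ≡ k → g ^ i · g ^ j · w ≈ g ^ k · w
  ·-merge g i j w refl = ·-· g i j w

  move : ∀ g i {v w} → g ^ i · v ≈ w → v ≈ g ^ (ℤ.- i) · w
  move g i {v} {w} eq = begin
    v                       ≈⟨ ·-merge g (ℤ.- i) i v (ℤ.+-inverseˡ i) ⟨
    g ^ (ℤ.- i) · g ^ i · v ≈⟨ ·-cong g (ℤ.- i) eq ⟩
    g ^ (ℤ.- i) · w         ∎

  pow-multiple : ∀ g {i} → pow g i ≈ ε → ∀ k → pow g (k ℤ.* i) ≈ ε
  pow-multiple g {i} triv = go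
    where
    natural : ∀ {j} n → pow g j ≈ ε → pow g (+ n ℤ.* j) ≈ ε
    natural {j} zero    _ = ≈-reflexive (cong (pow g) (ℤ.*-zeroˡ j))
    natural {j} (suc n) j-triv = begin
      pow g (+ suc n ℤ.* j)           ≡⟨ cong (pow g) (ℤ.suc-* (+ n) j) ⟩
      pow g (j ℤ.+ + n ℤ.* j)         ≈⟨ pow-+ g j (+ n ℤ.* j) ⟨
      pow g j ++ pow g (+ n ℤ.* j)    ≈⟨ ≈-cong j-triv (natural n j-triv) ⟩
      ε                               ∎
    negative : pow g (ℤ.- i) ≈ ε
    negative = begin
      pow g (ℤ.- i)            ≡⟨ ++-identityʳ (pow g (ℤ.- i)) ⟨
      pow g (ℤ.- i) ++ ε       ≈⟨ move g i (≈-trans (≈-reflexive (++-identityʳ (pow g i))) triv) ⟨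
      ε                        ∎
    go : ∀ k → pow g (k ℤ.* i) ≈ ε
    go (+ n)    = natural n triv
    go -[1+ n ] = ≈-trans (≈-reflexive (cong (pow g)
        (solve 2 (λ m i → (:- m) :* i := m :* (:- i)) refl (+ suc n) i))) (natural {ℤ.- i} (suc n) negative)
      where open +-*-Solver

  ·-period : ∀ g {P} → pow g P ≈ ε → ∀ {i j} k w → i ≡ j ℤ.+ k ℤ.* P → g ^ i · w ≈ g ^ j · w
  ·-period g {P} triv {i} {j} k w refl = begin
    g ^ (j ℤ.+ k ℤ.* P) · w     ≈⟨ ·-· g j (k ℤ.* P) w ⟨
    g ^ j · g ^ (k ℤ.* P) · w   ≈⟨ ·-cong g j (++-congʳ w (pow-multiple g triv k)) ⟩
    g ^ j · w                   ∎

  ·-mod : ∀ g p .{{_ : NonZero p}} → pow g (+ p) ≈ ε → ∀ i w → g ^ i · w ≈ g ^ (+ (i %ℕ p)) · w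
  ·-mod g p triv i w = ·-period g {+ p} triv {i} {+ (i %ℕ p)} (i /ℕ p) w (ℤ.a≡a%ℕn+[a/ℕn]*n i p)

-- The relations with exponents -1 + n, -3 + δ, 1 - n, 3 + δ force σ₂^(4 - δ) σ₁ = σ₁ σ₂^(4 + δ).
-- With δ = 4 r, the geometric series 1 + r + r² inverts 1 - r modulo r³, so that σ₁
-- normalises ⟨ σ₂⁴ ⟩, and ⟨ σ₁ ⟩⟨ σ₂ ⟩ is closed under right multiplication by σ₁.
module NormalForm (p q : ℕ) .{{_ : NonZero p}} (n δ r c : ℤ)
                  (δ≡4r : δ ≡ + 4 ℤ.* r) (4r³≡cq : + 4 ℤ.* (r ℤ.* r ℤ.* r) ≡ c ℤ.* + q) where

  i₁ j₁ i₂ j₂ : ℤ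
  i₁ = ℤ.- (+ 1) ℤ.+ n
  j₁ = ℤ.- (+ 3) ℤ.+ δ
  i₂ = + 1 ℤ.- n
  j₂ = + 3 ℤ.+ δ

  Γ : Relations
  Γ = ΓRels (+ p) (+ q) i₁ j₁ i₂ j₂

  open Words Γ
  open SetoidReasoning wordSetoid

  σ₁-period : pow g₁ (+ p) ≈ ε
  σ₁-period = ≈-rel (here refl)

  σ₂-period : pow g₂ (+ q) ≈ ε
  σ₂-period = ≈-rel (there (here refl))

  private
    -1ℤ = ℤ.- (+ 1)

    a b : ℤ → Word → Word
    a i w = g₁ ^ i · w
    b j w = g₂ ^ j · w

    aa : ∀ i j w → a i (a j w) ≈ a (i ℤ.+ j) w
    aa = ·-· g₁

    bb : ∀ i j w → b i (b j w) ≈ b (i ℤ.+ j) w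
    bb = ·-· g₂

    a-cong : ∀ i {v w} → v ≈ w → a i v ≈ a i w
    a-cong = ·-cong g₁

    b-cong : ∀ j {v w} → v ≈ w → b j v ≈ b j w
    b-cong = ·-cong g₂

    baba : ∀ w → a (+ 1) (b (+ 1) (a (+ 1) (b (+ 1) w))) ≈ w
    baba w = ++-congʳ w (≈-rel (there (there (here refl))))

    b⁻¹a⁻¹ : ∀ w → b -1ℤ (a -1ℤ w) ≈ a (+ 1) (b (+ 1) w)
    b⁻¹a⁻¹ w = ≈-sym (move g₂ (+ 1) (move g₁ (+ 1) (baba w)))

    ba : ∀ w → b (+ 1) (a (+ 1) w) ≈ a -1ℤ (b -1ℤ w)
    ba w = move g₁ (+ 1) (begin
      a (+ 1) (b (+ 1) (a (+ 1) w))
        ≈⟨ a-cong (+ 1) (b-cong (+ 1) (a-cong (+ 1) (bb (+ 1) -1ℤ w))) ⟨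
      a (+ 1) (b (+ 1) (a (+ 1) (b (+ 1) (b -1ℤ w))))
        ≈⟨ baba (b -1ℤ w) ⟩
      b -1ℤ w ∎)

    b⁻¹a : ∀ w → b -1ℤ (a (+ 1) w) ≈ a i₁ (b j₁ w)
    b⁻¹a w = ≈-trans (++-congʳ w (≈-rel (there (there (there (here refl))))))
                     (≈-reflexive (++-assoc (pow g₁ i₁) (pow g₂ j₁) w))

    ba⁻¹ : ∀ w → b (+ 1) (a -1ℤ w) ≈ a i₂ (b j₂ w)
    ba⁻¹ w = ≈-trans (++-congʳ w (≈-rel (there (there (there (there (here refl)))))))
                     (≈-reflexive (++-assoc (pow g₁ i₂) (pow g₂ j₂) w))

    -- By (σ₁σ₂)² = 1 the product σ₂σ₁ is σ₁⁻¹σ₂⁻¹, so the fifth relation applies after the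
    -- remaining σ₂.
    b²a : ∀ w → b (+ 2) (a (+ 1) w) ≈ a i₂ (b (j₂ ℤ.+ -1ℤ) w)
    b²a w = begin
      b (+ 2) (a (+ 1) w)                   ≈⟨ b-cong (+ 2) (a-cong (+ 1) (bb (+ 1) -1ℤ w)) ⟨
      b (+ 2) (a (+ 1) (b (+ 1) (b -1ℤ w))) ≈⟨ b-cong (+ 2) (b⁻¹a⁻¹ (b -1ℤ w)) ⟨
      b (+ 2) (b -1ℤ (a -1ℤ (b -1ℤ w)))     ≈⟨ bb (+ 2) -1ℤ (a -1ℤ (b -1ℤ w)) ⟩
      b (+ 1) (a -1ℤ (b -1ℤ w))             ≈⟨ ba⁻¹ (b -1ℤ w) ⟩
      a i₂ (b j₂ (b -1ℤ w))                 ≈⟨ a-cong i₂ (bb j₂ -1ℤ w) ⟩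
      a i₂ (b (j₂ ℤ.+ -1ℤ) w)               ∎

    -- σ₁^i₂ is the inverse of σ₁^i₁. Multiplying the fourth relation by σ₂σ₁σ₂² and using σ₁σ₂σ₁ =
    -- σ₂⁻¹ collapses its left side to 1.
    a^i₂ : ∀ w → a i₂ w ≈ b (j₁ ℤ.+ + 1) (a (+ 1) (b (+ 2) w))
    a^i₂ w = begin
      a i₂ w                                        ≈⟨ ·-≡ g₁ w -i₁≡i₂ ⟨
      a (ℤ.- i₁) w                                  ≈⟨ move g₁ i₁ lemma ⟨
      b j₁ (b (+ 1) (a (+ 1) (b (+ 2) w)))          ≈⟨ bb j₁ (+ 1) _ ⟩
      b (j₁ ℤ.+ + 1) (a (+ 1) (b (+ 2) w))          ∎
      where
      open +-*-Solver
      -i₁≡i₂ : ℤ.- i₁ ≡ i₂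
      -i₁≡i₂ = solve 1 (λ n → :- (con -1ℤ :+ n) := con (+ 1) :- n) refl n
      u = b (+ 2) w
      lemma : a i₁ (b j₁ (b (+ 1) (a (+ 1) u))) ≈ w
      lemma = begin
        a i₁ (b j₁ (b (+ 1) (a (+ 1) u)))         ≈⟨ b⁻¹a (b (+ 1) (a (+ 1) u)) ⟨
        b -1ℤ (a (+ 1) (b (+ 1) (a (+ 1) u)))     ≈⟨ b-cong -1ℤ (a-cong (+ 1) (ba u)) ⟩
        b -1ℤ (a (+ 1) (a -1ℤ (b -1ℤ u)))         ≈⟨ b-cong -1ℤ (aa (+ 1) -1ℤ (b -1ℤ u)) ⟩
        b -1ℤ (b -1ℤ u)                           ≈⟨ bb -1ℤ -1ℤ u ⟩
        b (ℤ.- (+ 2)) (b (+ 2) w)                 ≈⟨ bb (ℤ.- (+ 2)) (+ 2) w ⟩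
        w                                         ∎

    -- `b²a` and `a^i₂` together express σ₂²σ₁ through σ₁ and powers of σ₂ alone, since the power
    -- σ₁^i₂ is eliminated between them.
    normalises : ∀ w → b (+ 4 ℤ.- δ) (a (+ 1) w) ≈ a (+ 1) (b (+ 4 ℤ.+ δ) w)
    normalises w = begin
      b (+ 4 ℤ.- δ) (a (+ 1) w)
        ≈⟨ ·-merge g₂ (ℤ.- (j₁ ℤ.+ + 1)) (+ 2) (a (+ 1) w)
             (solve 1 (λ d → :- ((con (ℤ.- (+ 3)) :+ d) :+ con (+ 1)) :+ con (+ 2) := con (+ 4) :- d) refl δ) ⟨
      b (ℤ.- (j₁ ℤ.+ + 1)) (b (+ 2) (a (+ 1) w))
        ≈⟨ move g₂ (j₁ ℤ.+ + 1) (≈-sym step) ⟨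
      a (+ 1) (b (+ 4 ℤ.+ δ) w) ∎
      where
      open +-*-Solver
      step : b (+ 2) (a (+ 1) w) ≈ b (j₁ ℤ.+ + 1) (a (+ 1) (b (+ 4 ℤ.+ δ) w))
      step = begin
        b (+ 2) (a (+ 1) w)                    ≈⟨ b²a w ⟩
        a i₂ (b (j₂ ℤ.+ -1ℤ) w)                ≈⟨ a^i₂ (b (j₂ ℤ.+ -1ℤ) w) ⟩
        b (j₁ ℤ.+ + 1) (a (+ 1) (b (+ 2) (b (j₂ ℤ.+ -1ℤ) w)))
          ≈⟨ b-cong (j₁ ℤ.+ + 1) (a-cong (+ 1) (·-merge g₂ (+ 2) (j₂ ℤ.+ -1ℤ) w
               (solve 1 (λ d → con (+ 2) :+ ((con (+ 3) :+ d) :+ con -1ℤ) := con (+ 4) :+ d) refl δ))) ⟩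
        b (j₁ ℤ.+ + 1) (a (+ 1) (b (+ 4 ℤ.+ δ) w)) ∎

    Commutes : ℤ → ℤ → Set
    Commutes x y = ∀ w → b x (a (+ 1) w) ≈ a (+ 1) (b y w)

    commutes-multiple : ∀ {x y} → Commutes x y → ∀ k → Commutes (k ℤ.* x) (k ℤ.* y)
    commutes-multiple {x} {y} comm = go
      where
      open +-*-Solver
      natural : ∀ {x y} n → Commutes x y → Commutes (+ n ℤ.* x) (+ n ℤ.* y)
      natural {x} {y} zero comm w = ≈-trans (·-≡ g₂ _ (ℤ.*-zeroˡ x))
        (a-cong (+ 1) (≈-sym (·-≡ g₂ w (ℤ.*-zeroˡ y))))
      natural {x} {y} (suc n) comm w = begin
        b (+ suc n ℤ.* x) (a (+ 1) w)      ≈⟨ ·-merge g₂ x (+ n ℤ.* x) _ (sym (ℤ.suc-* (+ n) x)) ⟨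
        b x (b (+ n ℤ.* x) (a (+ 1) w))    ≈⟨ b-cong x (natural n comm w) ⟩
        b x (a (+ 1) (b (+ n ℤ.* y) w))    ≈⟨ comm (b (+ n ℤ.* y) w) ⟩
        a (+ 1) (b y (b (+ n ℤ.* y) w))    ≈⟨ a-cong (+ 1) (·-merge g₂ y (+ n ℤ.* y) w (sym (ℤ.suc-* (+ n) y))) ⟩
        a (+ 1) (b (+ suc n ℤ.* y) w)      ∎
      negative : Commutes (ℤ.- x) (ℤ.- y)
      negative w = ≈-sym (move g₂ x (begin
        b x (a (+ 1) (b (ℤ.- y) w))    ≈⟨ comm (b (ℤ.- y) w) ⟩
        a (+ 1) (b y (b (ℤ.- y) w))    ≈⟨ a-cong (+ 1) (·-merge g₂ y (ℤ.- y) w (ℤ.+-inverseʳ y)) ⟩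
        a (+ 1) w                      ∎))
      flip : ∀ m z → m ℤ.* (ℤ.- z) ≡ (ℤ.- m) ℤ.* z
      flip = solve 2 (λ m z → m :* (:- z) := (:- m) :* z) refl
      go : ∀ k → Commutes (k ℤ.* x) (k ℤ.* y)
      go (+ n)    = natural n comm
      go -[1+ n ] w = subst₂ (λ X Y → b X (a (+ 1) w) ≈ a (+ 1) (b Y w))
                        (flip (+ suc n) x) (flip (+ suc n) y) (natural {ℤ.- x} {ℤ.- y} (suc n) negative w)

    series : ℤ
    series = + 1 ℤ.+ r ℤ.+ r ℤ.* r

    b^4e : ∀ e → Commutes (e ℤ.* + 4) (e ℤ.* series ℤ.* (+ 4 ℤ.+ δ))
    b^4e e w = begin
      b (e ℤ.* + 4) (a (+ 1) w)
        ≈⟨ ·-period g₂ {+ q} σ₂-period {e ℤ.* + 4} {e ℤ.* series ℤ.* (+ 4 ℤ.- δ)} (e ℤ.* c) (a (+ 1) w) split ⟩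
      b (e ℤ.* series ℤ.* (+ 4 ℤ.- δ)) (a (+ 1) w)
        ≈⟨ commutes-multiple normalises (e ℤ.* series) w ⟩
      a (+ 1) (b (e ℤ.* series ℤ.* (+ 4 ℤ.+ δ)) w) ∎
      where
      open +-*-Solver
      split : e ℤ.* + 4 ≡ e ℤ.* series ℤ.* (+ 4 ℤ.- δ) ℤ.+ e ℤ.* c ℤ.* + q
      split = trans
        (solve 2 (λ e r → e :* con (+ 4) :=
            e :* (con (+ 1) :+ r :+ r :* r) :* (con (+ 4) :- con (+ 4) :* r)
            :+ e :* (con (+ 4) :* (r :* r :* r))) refl e r)
        (cong₂ ℤ._+_ (cong (λ d → e ℤ.* series ℤ.* (+ 4 ℤ.- d)) (sym δ≡4r))
          (trans (cong (e ℤ.*_) 4r³≡cq) (sym (ℤ.*-assoc e c (+ q)))))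

    Sorts : ℤ → ℤ → Set
    Sorts j i = ∃[ i′ ] ∃[ j′ ] (∀ w → b j (a i w) ≈ a i′ (b j′ w))

    -- Powers of σ₂⁴ pass through σ₁ by `b^4e`, so a sorting rule is needed only for one exponent in
    -- each class modulo 4.
    sorts-head : ∀ x e i j → (∀ w → b x (a (+ 1) w) ≈ a i (b j w)) →
                 ∀ {y} → y ≡ x ℤ.+ e ℤ.* + 4 → Sorts y (+ 1)
    sorts-head x e i j head refl = i , j ℤ.+ f , λ w → begin
      b (x ℤ.+ e ℤ.* + 4) (a (+ 1) w)     ≈⟨ bb x (e ℤ.* + 4) (a (+ 1) w) ⟨
      b x (b (e ℤ.* + 4) (a (+ 1) w))     ≈⟨ b-cong x (b^4e e w) ⟩
      b x (a (+ 1) (b f w))               ≈⟨ head (b f w) ⟩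
      a i (b j (b f w))                   ≈⟨ a-cong i (bb j f w) ⟩
      a i (b (j ℤ.+ f) w)                 ∎
      where f = e ℤ.* series ℤ.* (+ 4 ℤ.+ δ)

    sorts-one : ∀ j → Sorts j (+ 1)
    sorts-one j with j %ℕ 4 | j /ℕ 4 | ℤ.a≡a%ℕn+[a/ℕn]*n j 4 | ℤ.n%ℕd<d j 4
    ... | 0 | e | eq | _ = sorts-head (+ 0) e (+ 1) (+ 0) (λ w → ≈-refl) eq
    ... | 1 | e | eq | _ = sorts-head (+ 1) e -1ℤ -1ℤ ba eq
    ... | 2 | e | eq | _ = sorts-head (+ 2) e i₂ (j₂ ℤ.+ -1ℤ) b²a eq
    -- The residue 3 is read as -1, for which the fourth relation is the rule.
    ... | 3 | e | eq | _ = sorts-head -1ℤ (e ℤ.+ + 1) i₁ j₁ b⁻¹a (trans eq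
            (solve 1 (λ e → con (+ 3) :+ e :* con (+ 4) := con -1ℤ :+ (e :+ con (+ 1)) :* con (+ 4)) refl e))
      where open +-*-Solver
    ... | suc (suc (suc (suc _))) | _ | _ | s≤s (s≤s (s≤s (s≤s ())))

    sorts-natural : ∀ n j → Sorts j (+ n)
    sorts-natural zero    j = + 0 , j , λ w → ≈-refl
    sorts-natural (suc n) j with sorts-one j
    ... | i₁′ , j₁′ , eq₁ with sorts-natural n j₁′
    ... | i₂′ , j₂′ , eq₂ = i₁′ ℤ.+ i₂′ , j₂′ , λ w → begin
      b j (a (+ suc n) w)        ≈⟨ b-cong j (aa (+ 1) (+ n) w) ⟨
      b j (a (+ 1) (a (+ n) w))  ≈⟨ eq₁ (a (+ n) w) ⟩
      a i₁′ (b j₁′ (a (+ n) w))  ≈⟨ a-cong i₁′ (eq₂ w) ⟩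
      a i₁′ (a i₂′ (b j₂′ w))    ≈⟨ aa i₁′ i₂′ (b j₂′ w) ⟩
      a (i₁′ ℤ.+ i₂′) (b j₂′ w)  ∎

    sorts : ∀ j i → Sorts j i
    -- Reducing `i` modulo p makes it a natural number, so that only positive powers of σ₁ have to
    -- be sorted.
    sorts j i with sorts-natural (i %ℕ p) j
    ... | i′ , j′ , eq = i′ , j′ , λ w → ≈-trans (b-cong j (·-mod g₁ p σ₁-period i w)) (eq w)

    letter-pow : ∀ g s → ∃[ i ] pow g i ≡ (g , s) ∷ []
    letter-pow g false = + 1 , refl
    letter-pow g true  = -1ℤ , refl

  normalForm : ∀ w → ∃[ i ] ∃[ j ] w ≈ pow g₁ i ++ pow g₂ j
  normalForm [] = + 0 , + 0 , ≈-refl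
  normalForm ((g₁ , s) ∷ w) with normalForm w | letter-pow g₁ s
  ... | i , j , eq | k , letter≡ = k ℤ.+ i , j , (begin
    (g₁ , s) ∷ w           ≡⟨ cong (_++ w) letter≡ ⟨
    a k w                  ≈⟨ a-cong k eq ⟩
    a k (a i (pow g₂ j))   ≈⟨ aa k i (pow g₂ j) ⟩
    a (k ℤ.+ i) (pow g₂ j) ∎)
  normalForm ((g₂ , s) ∷ w) with normalForm w | letter-pow g₂ s
  ... | i , j , eq | k , letter≡ with sorts k i
  ... | i′ , j′ , sorted = i′ , j′ ℤ.+ j , (begin
    (g₂ , s) ∷ w                 ≡⟨ cong (_++ w) letter≡ ⟨
    b k w                        ≈⟨ b-cong k eq ⟩
    b k (a i (pow g₂ j))         ≈⟨ sorted (pow g₂ j) ⟩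
    a i′ (b j′ (pow g₂ j))       ≈⟨ a-cong i′ (pow-+ g₂ j′ j) ⟩
    a i′ (pow g₂ (j′ ℤ.+ j))     ∎)

-- Adjacent flags, rigidity of automorphisms, and reflections.

↔-injective : {A B : Set} (f : A ↔ B) → ∀ {x y} → Inverse.to f x ≡ Inverse.to f y → x ≡ y
↔-injective f {x} {y} eq = trans (sym (Inverse.strictlyInverseʳ f x))
  (trans (cong (Inverse.from f) eq) (Inverse.strictlyInverseʳ f y))

-- Applied to the vertices of an edge, the edges at a vertex and face, and the faces of an edge,
-- this makes the i-adjacent flag unique.
third-of-two : {A : Set} → A ↔ Fin 2 → ∀ {x y z : A} → x ≢ y → x ≢ z → y ≡ z
third-of-two f {x} {y} {z} x≢y x≢z =
  ↔-injective f (go _ _ _ (x≢y ∘ ↔-injective f) (x≢z ∘ ↔-injective f))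
  where
  go : ∀ (i j k : Fin 2) → i ≢ j → i ≢ k → j ≡ k
  go zero       zero       _          i≢j _   = contradiction refl i≢j
  go zero       (suc zero) zero       _   i≢k = contradiction refl i≢k
  go zero       (suc zero) (suc zero) _   _   = refl
  go (suc zero) zero       zero       _   _   = refl
  go (suc zero) zero       (suc zero) _   i≢k = contradiction refl i≢k
  go (suc zero) (suc zero) _          i≢j _   = contradiction refl i≢j

module Flags {P : Poset₂} (isP : IsPolyhedron P) where
  open Poset₂ P
  open IsPolyhedron isP
  open Aut

  -- _≈F_ and IsAdj, wrapped so that their arguments can be inferred.
  infix 4 _∼_
  record _∼_ (Φ Ψ : Flag) : Set where
    constructor same
    field unsame : Φ ≈F Ψ
  open _∼_ public

  record Adj (i : Fin 3) (Φ Ψ : Flag) : Set where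
    constructor adj
    field unadj : IsAdj i Φ Ψ
  open Adj public

  ∼-refl : ∀ {Φ} → Φ ∼ Φ
  ∼-refl = same (refl , refl , refl)

  ∼-sym : ∀ {Φ Ψ} → Φ ∼ Ψ → Ψ ∼ Φ
  ∼-sym (same (p , q , r)) = same (sym p , sym q , sym r)

  ∼-trans : ∀ {Φ Ψ Ω} → Φ ∼ Ψ → Ψ ∼ Ω → Φ ∼ Ω
  ∼-trans (same (p , q , r)) (same (p′ , q′ , r′)) = same (trans p p′ , trans q q′ , trans r r′)

  adj-sym : ∀ {i Φ Ψ} → Adj i Φ Ψ → Adj i Ψ Φ
  adj-sym {zero}           (adj (p , q , r)) = adj (≢-sym p , sym q , sym r)
  adj-sym {suc zero}       (adj (p , q , r)) = adj (sym p , ≢-sym q , sym r)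
  adj-sym {suc (suc zero)} (adj (p , q , r)) = adj (sym p , sym q , ≢-sym r)

  adj-resp : ∀ {i Φ Φ′ Ψ Ψ′} → Φ ∼ Φ′ → Ψ ∼ Ψ′ → Adj i Φ Ψ → Adj i Φ′ Ψ′
  adj-resp {zero}           (same (p , q , r)) (same (p′ , q′ , r′)) (adj (a , b , c)) =
    adj (subst₂ _≢_ p p′ a , subst₂ _≡_ q q′ b , subst₂ _≡_ r r′ c)
  adj-resp {suc zero}       (same (p , q , r)) (same (p′ , q′ , r′)) (adj (a , b , c)) =
    adj (subst₂ _≡_ p p′ a , subst₂ _≢_ q q′ b , subst₂ _≡_ r r′ c)
  adj-resp {suc (suc zero)} (same (p , q , r)) (same (p′ , q′ , r′)) (adj (a , b , c)) =
    adj (subst₂ _≡_ p p′ a , subst₂ _≡_ q q′ b , subst₂ _≢_ r r′ c)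

  private
    adj-unique₀ : ∀ {i Φ Ψ Ω} → Adj i Φ Ψ → Adj i Φ Ω → Ψ ∼ Ω
    adj-unique₀ {zero} {flag v e f p _ _} {flag v₁ .e .f p₁ _ _} {flag v₂ .e .f p₂ _ _}
      (adj (v≢v₁ , refl , refl)) (adj (v≢v₂ , refl , refl)) =
      same (cong proj₁ (third-of-two (edge-two-vertices e) {v , p} {v₁ , p₁} {v₂ , p₂}
        (v≢v₁ ∘ cong proj₁) (v≢v₂ ∘ cong proj₁)) , refl , refl)
    adj-unique₀ {suc zero} {flag v e f p q r} {flag .v e₁ .f p₁ q₁ _} {flag .v e₂ .f p₂ q₂ _}
      (adj (refl , e≢e₁ , refl)) (adj (refl , e≢e₂ , refl)) =
      same (refl , cong proj₁ (third-of-two (diamond v f r) {e , p , q} {e₁ , p₁ , q₁} {e₂ , p₂ , q₂}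
        (e≢e₁ ∘ cong proj₁) (e≢e₂ ∘ cong proj₁)) , refl)
    adj-unique₀ {suc (suc zero)} {flag v e f _ q _} {flag .v .e f₁ _ q₁ _} {flag .v .e f₂ _ q₂ _}
      (adj (refl , refl , f≢f₁)) (adj (refl , refl , f≢f₂)) =
      same (refl , refl , cong proj₁ (third-of-two (edge-two-faces e) {f , q} {f₁ , q₁} {f₂ , q₂}
        (f≢f₁ ∘ cong proj₁) (f≢f₂ ∘ cong proj₁)))

  adj-unique : ∀ {i Φ Φ′ Ψ Ψ′} → Φ ∼ Φ′ → Adj i Φ Ψ → Adj i Φ′ Ψ′ → Ψ ∼ Ψ′
  adj-unique Φ∼Φ′ a a′ = adj-unique₀ (adj-resp Φ∼Φ′ ∼-refl a) a′

  act-adj : ∀ a {i Φ Ψ} → Adj i Φ Ψ → Adj i (act a Φ) (act a Ψ)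
  act-adj a {zero}           (adj (p , q , r)) =
    adj (p ∘ ↔-injective (aV a) , cong (Inverse.to (aE a)) q , cong (Inverse.to (aF a)) r)
  act-adj a {suc zero}       (adj (p , q , r)) =
    adj (cong (Inverse.to (aV a)) p , q ∘ ↔-injective (aE a) , cong (Inverse.to (aF a)) r)
  act-adj a {suc (suc zero)} (adj (p , q , r)) =
    adj (cong (Inverse.to (aV a)) p , cong (Inverse.to (aE a)) q , r ∘ ↔-injective (aF a))

  act-cong : ∀ a {Φ Ψ} → Φ ∼ Ψ → act a Φ ∼ act a Ψ
  act-cong a (same (p , q , r)) =
    same (cong (Inverse.to (aV a)) p , cong (Inverse.to (aE a)) q , cong (Inverse.to (aF a)) r)

  act-inverseˡ : ∀ a {Φ} → act a (act (invA a) Φ) ∼ Φ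
  act-inverseˡ a = same (Inverse.strictlyInverseˡ (aV a) _ ,
    Inverse.strictlyInverseˡ (aE a) _ , Inverse.strictlyInverseˡ (aF a) _)

  act-inverseʳ : ∀ a {Φ} → act (invA a) (act a Φ) ∼ Φ
  act-inverseʳ a = same (Inverse.strictlyInverseʳ (aV a) _ ,
    Inverse.strictlyInverseʳ (aE a) _ , Inverse.strictlyInverseʳ (aF a) _)

  ≐-trans : ∀ {a b c : Aut P} → a ≐ b → b ≐ c → a ≐ c
  ≐-trans (p , q , r) (p′ , q′ , r′) =
    (λ v → trans (p v) (p′ v)) , (λ e → trans (q e) (q′ e)) , (λ f → trans (r f) (r′ f))

  ≐-sym : ∀ {a b : Aut P} → a ≐ b → b ≐ a
  ≐-sym (p , q , r) = (λ v → sym (p v)) , (λ e → sym (q e)) , (λ f → sym (r f))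

  ∘-cong : ∀ {a a′ b b′ : Aut P} → a ≐ a′ → b ≐ b′ → (a ∘A b) ≐ (a′ ∘A b′)
  ∘-cong {a} (p , q , r) (p′ , q′ , r′) =
    (λ v → trans (cong (Inverse.to (aV a)) (p′ v)) (p _)) ,
    (λ e → trans (cong (Inverse.to (aE a)) (q′ e)) (q _)) ,
    (λ f → trans (cong (Inverse.to (aF a)) (r′ f)) (r _))

  eval-++ : ∀ (s₁ s₂ : Aut P) u w → eval s₁ s₂ (u ++ w) ≐ (eval s₁ s₂ u ∘A eval s₁ s₂ w)
  eval-++ s₁ s₂ []      w = (λ _ → refl) , (λ _ → refl) , (λ _ → refl)
  eval-++ s₁ s₂ (x ∷ u) w = ∘-cong {a = evalLetter s₁ s₂ x} {a′ = evalLetter s₁ s₂ x} {b = eval s₁ s₂ (u ++ w)} {b′ = eval s₁ s₂ u ∘A eval s₁ s₂ w}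
    ((λ _ → refl) , (λ _ → refl) , (λ _ → refl)) (eval-++ s₁ s₂ u w)

  -- Automorphisms preserve adjacency and the adjacent flag is unique, so agreement spreads from a
  -- flag to its neighbours.
  agree-adj : ∀ a b {i Φ Ψ} → Adj i Φ Ψ → act a Φ ∼ act b Φ → act a Ψ ∼ act b Ψ
  agree-adj a b Φ-Ψ agree = adj-unique agree (act-adj a Φ-Ψ) (act-adj b Φ-Ψ)

barWord : Word → Word
barWord = map letterInv

barWord-pow : ∀ g i → barWord (pow g i) ≡ pow g (ℤ.- i)
barWord-pow g (+ zero)  = refl
barWord-pow g (+ suc n) = map-replicate letterInv (suc n) (g , false)
barWord-pow g -[1+ n ]  = map-replicate letterInv (suc n) (g , true)

-- The three covering hypotheses stand in for connectedness of flags: agreement of two automorphisms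
-- at Φ spreads along words, and every element occurs in the image of Φ under some word.
module Rotations {P : Poset₂} (isP : IsPolyhedron P) (Φ : Poset₂.Flag P) (s₁ s₂ : Aut P)
  (adj₁ : ∃[ Ψ ] (Poset₂.IsAdj P (suc zero) Φ Ψ × Poset₂.IsAdj P zero Ψ (act s₁ Φ)))
  (adj₂ : ∃[ Ψ ] (Poset₂.IsAdj P (suc (suc zero)) Φ Ψ × Poset₂.IsAdj P (suc zero) Ψ (act s₂ Φ)))
  (coverV : ∀ v → ∃[ w ] Poset₂.fv (act (eval s₁ s₂ w) Φ) ≡ v)
  (coverE : ∀ e → ∃[ w ] Poset₂.fe (act (eval s₁ s₂ w) Φ) ≡ e)
  (coverF : ∀ f → ∃[ w ] Poset₂.ff (act (eval s₁ s₂ w) Φ) ≡ f)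
  where
  open Poset₂ P
  open Flags isP
  open Aut

  letter : Letter → Aut P
  letter = evalLetter s₁ s₂

  ev : Word → Aut P
  ev = eval s₁ s₂

  private
    inverse-adj : ∀ s {i Ψ} → Adj i Ψ (act s Φ) → Adj i Φ (act (invA s) Ψ)
    inverse-adj s Ψ-sΦ = adj-resp (act-inverseʳ s) ∼-refl (act-adj (invA s) (adj-sym Ψ-sΦ))

    agree-letter : ∀ a b x → act a Φ ∼ act b Φ → act a (act (letter x) Φ) ∼ act b (act (letter x) Φ)
    agree-letter a b (g₁ , false) agree = let Ψ , p , q = adj₁ in
      agree-adj a b {zero} {Ψ} (adj q) (agree-adj a b {suc zero} (adj p) agree)
    agree-letter a b (g₂ , false) agree = let Ψ , p , q = adj₂ in
      agree-adj a b {suc zero} {Ψ} (adj q) (agree-adj a b {suc (suc zero)} (adj p) agree)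
    -- The inverse rotation reaches its image of Φ along the reversed path, from Φ to s₁⁻¹Ψ to
    -- s₁⁻¹Φ.
    agree-letter a b (g₁ , true) agree = let Ψ , p , q = adj₁ in
      agree-adj a b (act-adj (invA s₁) {suc zero} (adj-sym {Φ = Φ} {Ψ} (adj p)))
        (agree-adj a b (inverse-adj s₁ {zero} (adj q)) agree)
    agree-letter a b (g₂ , true) agree = let Ψ , p , q = adj₂ in
      agree-adj a b (act-adj (invA s₂) {suc (suc zero)} (adj-sym {Φ = Φ} {Ψ} (adj p)))
        (agree-adj a b (inverse-adj s₂ {suc zero} (adj q)) agree)

    agree-word : ∀ w a b → act a Φ ∼ act b Φ → act a (act (ev w) Φ) ∼ act b (act (ev w) Φ)
    agree-word []      a b agree = agree
    agree-word (x ∷ w) a b agree =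
      same (unsame (agree-word w (a ∘A letter x) (b ∘A letter x) (same (unsame (agree-letter a b x agree)))))

  rigid : ∀ a b → act a Φ ∼ act b Φ → a ≐ b
  rigid a b agree = onV , onE , onF
    where
    onV : ∀ v → Inverse.to (aV a) v ≡ Inverse.to (aV b) v
    onV v with coverV v
    ... | w , refl = proj₁ (unsame (agree-word w a b agree))
    onE : ∀ e → Inverse.to (aE a) e ≡ Inverse.to (aE b) e
    onE e with coverE e
    ... | w , refl = proj₁ (proj₂ (unsame (agree-word w a b agree)))
    onF : ∀ f → Inverse.to (aF a) f ≡ Inverse.to (aF b) f
    onF f with coverF f
    ... | w , refl = proj₂ (proj₂ (unsame (agree-word w a b agree)))

  letter-inverse : ∀ x → (letter x ∘A letter (letterInv x)) ≐ idA
  letter-inverse (g₁ , false) = Inverse.strictlyInverseˡ (aV s₁) , Inverse.strictlyInverseˡ (aE s₁) , Inverse.strictlyInverseˡ (aF s₁)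
  letter-inverse (g₁ , true)  = Inverse.strictlyInverseʳ (aV s₁) , Inverse.strictlyInverseʳ (aE s₁) , Inverse.strictlyInverseʳ (aF s₁)
  letter-inverse (g₂ , false) = Inverse.strictlyInverseˡ (aV s₂) , Inverse.strictlyInverseˡ (aE s₂) , Inverse.strictlyInverseˡ (aF s₂)
  letter-inverse (g₂ , true)  = Inverse.strictlyInverseʳ (aV s₂) , Inverse.strictlyInverseʳ (aE s₂) , Inverse.strictlyInverseʳ (aF s₂)

  well-defined : ∀ {R} → (∀ {l r} → (l , r) ∈ R → act (ev l) Φ ∼ act (ev r) Φ) →
                 ∀ {u w} → Equal u R w → ev u ≐ ev w
  well-defined rels = go
    where
    go : ∀ {u w} → Equal u _ w → ev u ≐ ev w
    go ≈-refl        = (λ _ → refl) , (λ _ → refl) , (λ _ → refl)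
    go (≈-sym {u = u} {v} u≈v)     = ≐-sym {ev u} {ev v} (go u≈v)
    go (≈-trans {u = u} {v} {w} u≈v v≈w) = ≐-trans {ev u} {ev v} {ev w} (go u≈v) (go v≈w)
    go (≈-cong {u = u} {u′} {v} {v′} u≈u′ v≈v′) =
      ≐-trans {ev (u ++ v)} {ev u ∘A ev v} {ev (u′ ++ v′)} (eval-++ s₁ s₂ u v)
        (≐-trans {ev u ∘A ev v} {ev u′ ∘A ev v′} {ev (u′ ++ v′)}
          (∘-cong {ev u} {ev u′} {ev v} {ev v′} (go u≈u′) (go v≈v′))
          (≐-sym {ev (u′ ++ v′)} {ev u′ ∘A ev v′} (eval-++ s₁ s₂ u′ v′)))
    go (≈-free x)    = letter-inverse x
    go (≈-rel {l = l} {r} l≡r) = rigid (ev l) (ev r) (rels l≡r)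

  module Reflection {Φ¹ : Flag} (Φ-Φ¹ : Adj (suc zero) Φ Φ¹) (ρ : Aut P) (ρΦ∼Φ¹ : act ρ Φ ∼ Φ¹) where

    private
      ρΦ¹∼Φ : act ρ Φ¹ ∼ Φ
      ρΦ¹∼Φ = adj-unique ρΦ∼Φ¹ (act-adj ρ Φ-Φ¹) (adj-sym Φ-Φ¹)

      -- Both sides send Φ to its 0-adjacent flag: ρ moves Φ¹ back to Φ, and s₁Φ is 0-adjacent to
      -- Φ¹.
      invert₁ : (ρ ∘A s₁) ≐ (invA s₁ ∘A ρ)
      invert₁ = rigid (ρ ∘A s₁) (invA s₁ ∘A ρ) (same (unsame goal))
        where
        Ψ∼Φ¹ : proj₁ adj₁ ∼ Φ¹
        Ψ∼Φ¹ = adj-unique {suc zero} ∼-refl (adj (proj₁ (proj₂ adj₁))) Φ-Φ¹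
        Ψ-s₁Φ : Adj zero (proj₁ adj₁) (act s₁ Φ)
        Ψ-s₁Φ = adj (proj₂ (proj₂ adj₁))
        goal : act ρ (act s₁ Φ) ∼ act (invA s₁) (act ρ Φ)
        goal = ∼-trans
          (adj-unique (∼-trans (act-cong ρ Ψ∼Φ¹) ρΦ¹∼Φ) (act-adj ρ Ψ-s₁Φ) (inverse-adj s₁ Ψ-s₁Φ))
          (act-cong (invA s₁) (∼-trans Ψ∼Φ¹ (∼-sym ρΦ∼Φ¹)))

      -- Since s₂⁻¹ sends Φ² to Φ¹, the flag s₂⁻¹Φ is 2-adjacent to Φ¹, as is ρΦ². Passing to
      -- 1-adjacent flags gives the claim at Φ.
      invert₂ : (ρ ∘A s₂) ≐ (invA s₂ ∘A ρ)
      invert₂ = rigid (ρ ∘A s₂) (invA s₂ ∘A ρ) (same (unsame goal))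
        where
        Φ-Ψ : Adj (suc (suc zero)) Φ (proj₁ adj₂)
        Φ-Ψ = adj (proj₁ (proj₂ adj₂))
        Ψ-s₂Φ : Adj (suc zero) (proj₁ adj₂) (act s₂ Φ)
        Ψ-s₂Φ = adj (proj₂ (proj₂ adj₂))
        s₂⁻¹Ψ∼Φ¹ : act (invA s₂) (proj₁ adj₂) ∼ Φ¹
        s₂⁻¹Ψ∼Φ¹ = adj-unique ∼-refl (inverse-adj s₂ Ψ-s₂Φ) Φ-Φ¹
        ρΨ∼s₂⁻¹Φ : act ρ (proj₁ adj₂) ∼ act (invA s₂) Φ
        ρΨ∼s₂⁻¹Φ = adj-unique (∼-trans ρΦ∼Φ¹ (∼-sym s₂⁻¹Ψ∼Φ¹))
          (act-adj ρ Φ-Ψ) (act-adj (invA s₂) (adj-sym Φ-Ψ))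
        goal : act ρ (act s₂ Φ) ∼ act (invA s₂) (act ρ Φ)
        goal = adj-unique ρΨ∼s₂⁻¹Φ (act-adj ρ Ψ-s₂Φ)
          (act-adj (invA s₂) (adj-resp ∼-refl (∼-sym ρΦ∼Φ¹) Φ-Φ¹))

      invert⁻¹ : ∀ s → (ρ ∘A s) ≐ (invA s ∘A ρ) → (ρ ∘A invA s) ≐ (s ∘A ρ)
      invert⁻¹ s (p , q , r) = turn (aV s) (aV ρ) p , turn (aE s) (aE ρ) q , turn (aF s) (aF ρ) r
        where
        turn : {X : Set} (s ρ : X ↔ X) →
               (∀ x → Inverse.to ρ (Inverse.to s x) ≡ Inverse.from s (Inverse.to ρ x)) →
               ∀ x → Inverse.to ρ (Inverse.from s x) ≡ Inverse.to s (Inverse.to ρ x)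
        turn s ρ h x = sym (begin
          Inverse.to s (Inverse.to ρ x)
            ≡⟨ cong (Inverse.to s ∘ Inverse.to ρ) (Inverse.strictlyInverseˡ s x) ⟨
          Inverse.to s (Inverse.to ρ (Inverse.to s (Inverse.from s x)))
            ≡⟨ cong (Inverse.to s) (h (Inverse.from s x)) ⟩
          Inverse.to s (Inverse.from s (Inverse.to ρ (Inverse.from s x)))
            ≡⟨ Inverse.strictlyInverseˡ s _ ⟩
          Inverse.to ρ (Inverse.from s x) ∎)
          where open ≡-Reasoning

      invert : ∀ x → (ρ ∘A letter x) ≐ (letter (letterInv x) ∘A ρ)
      invert (g₁ , false) = invert₁
      invert (g₂ , false) = invert₂
      invert (g₁ , true)  = invert⁻¹ s₁ invert₁
      invert (g₂ , true)  = invert⁻¹ s₂ invert₂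

    conjugate : ∀ w → (ρ ∘A ev w) ≐ (ev (barWord w) ∘A ρ)
    conjugate []      = (λ _ → refl) , (λ _ → refl) , (λ _ → refl)
    conjugate (x ∷ w) with invert x | conjugate w
    ... | p , q , r | p′ , q′ , r′ =
      (λ v → trans (p _) (cong (Inverse.to (aV (letter (letterInv x)))) (p′ v))) ,
      (λ e → trans (q _) (cong (Inverse.to (aE (letter (letterInv x)))) (q′ e))) ,
      (λ f → trans (r _) (cong (Inverse.to (aF (letter (letterInv x)))) (r′ f)))

    -- Conjugation by ρ inverts every letter, so identities between words in the automorphism group
    -- survive this substitution.
    bar-cong : ∀ u w → ev u ≐ ev w → ev (barWord u) ≐ ev (barWord w)
    bar-cong u w (p , q , r) with conjugate u | conjugate w
    ... | pu , qu , ru | pw , qw , rw =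
      on (aV ρ) pu pw p , on (aE ρ) qu qw q , on (aF ρ) ru rw r
      where
      on : {X : Set} (ρ : X ↔ X) {u w ū w̄ : X → X} →
           (∀ x → Inverse.to ρ (u x) ≡ ū (Inverse.to ρ x)) →
           (∀ x → Inverse.to ρ (w x) ≡ w̄ (Inverse.to ρ x)) →
           (∀ x → u x ≡ w x) → ∀ x → ū x ≡ w̄ x
      on ρ {ū = ū} {w̄} hu hw u≡w x = begin
        ū x                                      ≡⟨ cong ū (Inverse.strictlyInverseˡ ρ x) ⟨
        ū (Inverse.to ρ (Inverse.from ρ x))      ≡⟨ hu _ ⟨
        Inverse.to ρ _                           ≡⟨ cong (Inverse.to ρ) (u≡w _) ⟩
        Inverse.to ρ _                           ≡⟨ hw _ ⟩
        w̄ (Inverse.to ρ (Inverse.from ρ x))      ≡⟨ cong w̄ (Inverse.strictlyInverseˡ ρ x) ⟩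
        w̄ x                                      ∎
        where open ≡-Reasoning

-- Auxiliary facts on subtypes, orbits, parity and sections.

subtype-↔ : {A X : Set} {Q : X → Set} (Q-irr : ∀ {x} (p q : Q x) → p ≡ q)
            (f : A → X) (g : ∀ x → Q x → A) (Qf : ∀ a → Q (f a)) →
            (∀ x q → f (g x q) ≡ x) → (∀ a q → g (f a) q ≡ a) → Σ X Q ↔ A
subtype-↔ {A} {X} {Q} Q-irr f g Qf fg gf =
  mk↔ₛ′ (λ (x , q) → g x q) (λ a → f a , Qf a) (λ a → gf a (Qf a)) (λ (x , q) → pair (fg x q))
  where
  pair : ∀ {x y} {p : Q x} {q : Q y} → x ≡ y → (x , p) ≡ (y , q)
  pair {x} refl = cong (x ,_) (Q-irr _ _)

T-ext : ∀ {x y} → (T x → T y) → (T y → T x) → x ≡ y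
T-ext {false} {false} _ _ = refl
T-ext {false} {true}  _ g = contradiction (g tt) id
T-ext {true}  {false} f _ = contradiction (f tt) id
T-ext {true}  {true}  _ _ = refl

-- An invariant indexed by the exponent is carried along positive and negative powers alike. `π`
-- selects the action on vertices or on faces.
power-orbit : ∀ {P : Poset₂} {X : Set} (π : Aut P → X → X) → (∀ x → π idA x ≡ x) →
              (∀ a b x → π (a ∘A b) x ≡ π a (π b x)) → ∀ s₁ s₂ g (Q : ℤ → X → Set) →
              (∀ {j x} → Q j x → Q (ℤ.suc j) (π (evalLetter s₁ s₂ (g , false)) x)) →
              (∀ {j x} → Q j x → Q (ℤ.pred j) (π (evalLetter s₁ s₂ (g , true)) x)) →
              ∀ i {j x} → Q j x → Q (i ℤ.+ j) (π (eval s₁ s₂ (pow g i)) x)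
power-orbit π π-id π-∘ s₁ s₂ g Q up down = go
  where
  go : ∀ i {j x} → Q j x → Q (i ℤ.+ j) (π (eval s₁ s₂ (pow g i)) x)
  go (+ zero)       {j} {x} Qx = subst₂ Q (sym (ℤ.+-identityˡ j)) (sym (π-id x)) Qx
  go (+ suc n)      {j} {x} Qx = subst₂ Q (sym (ℤ.+-assoc (+ 1) (+ n) j)) (sym (π-∘ _ _ x)) (up (go (+ n) Qx))
  go -[1+ zero ]    {j} {x} Qx = subst (Q _) (trans (cong (π _) (sym (π-id x))) (sym (π-∘ _ _ x))) (down Qx)
  go -[1+ suc n ]   {j} {x} Qx = subst₂ Q (sym (ℤ.+-assoc -[1+ 0 ] -[1+ n ] j)) (sym (π-∘ _ _ x)) (down (go -[1+ n ] Qx))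

double-injective : ∀ i j → i ℤ.+ i ≡ j ℤ.+ j → i ≡ j
double-injective i j eq = ℤ.*-cancelˡ-≡ (+ 2) i j (trans (double i) (trans eq (sym (double j))))
  where
  open +-*-Solver
  double : ∀ i → + 2 ℤ.* i ≡ i ℤ.+ i
  double = solve 1 (λ i → con (+ 2) :* i := i :+ i) refl

even≢odd : ∀ i j → i ℤ.+ i ≢ ℤ.suc (j ℤ.+ j)
even≢odd i j eq = no-half (i ℤ.- j) (begin
  (i ℤ.- j) ℤ.+ (i ℤ.- j)          ≡⟨ solve 2 (λ i j → (i :- j) :+ (i :- j) := (i :+ i) :- (j :+ j)) refl i j ⟩
  (i ℤ.+ i) ℤ.- (j ℤ.+ j)          ≡⟨ cong (ℤ._- (j ℤ.+ j)) eq ⟩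
  ℤ.suc (j ℤ.+ j) ℤ.- (j ℤ.+ j)    ≡⟨ solve 1 (λ x → con (+ 1) :+ x :- x := con (+ 1)) refl (j ℤ.+ j) ⟩
  + 1                              ∎)
  where
  open ≡-Reasoning
  open +-*-Solver
  no-half : ∀ x → x ℤ.+ x ≢ + 1
  no-half (+ zero)        ()
  no-half (+ suc zero)    ()
  no-half (+ suc (suc n)) ()
  no-half -[1+ n ]        ()

module Sections (P : Poset₂) where
  open Poset₂ P
  open Aut

  Inc-sym : ∀ x y → Inc x y → Inc y x
  Inc-sym (inj₁ _)        (inj₂ (inj₁ _)) i = i
  Inc-sym (inj₁ _)        (inj₂ (inj₂ _)) i = i
  Inc-sym (inj₂ (inj₁ _)) (inj₁ _)        i = i
  Inc-sym (inj₂ (inj₁ _)) (inj₂ (inj₂ _)) i = i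
  Inc-sym (inj₂ (inj₂ _)) (inj₁ _)        i = i
  Inc-sym (inj₂ (inj₂ _)) (inj₂ (inj₁ _)) i = i

  image : Aut P → Elt → Elt
  image a (inj₁ v)        = inj₁ (Inverse.to (aV a) v)
  image a (inj₂ (inj₁ e)) = inj₂ (inj₁ (Inverse.to (aE a) e))
  image a (inj₂ (inj₂ f)) = inj₂ (inj₂ (Inverse.to (aF a) f))

  image-inverseˡ : ∀ a x → image a (image (invA a) x) ≡ x
  image-inverseˡ a (inj₁ v)        = cong inj₁ (Inverse.strictlyInverseˡ (aV a) v)
  image-inverseˡ a (inj₂ (inj₁ e)) = cong (inj₂ ∘ inj₁) (Inverse.strictlyInverseˡ (aE a) e)
  image-inverseˡ a (inj₂ (inj₂ f)) = cong (inj₂ ∘ inj₂) (Inverse.strictlyInverseˡ (aF a) f)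

  image-inverseʳ : ∀ a x → image (invA a) (image a x) ≡ x
  image-inverseʳ a (inj₁ v)        = cong inj₁ (Inverse.strictlyInverseʳ (aV a) v)
  image-inverseʳ a (inj₂ (inj₁ e)) = cong (inj₂ ∘ inj₁) (Inverse.strictlyInverseʳ (aE a) e)
  image-inverseʳ a (inj₂ (inj₂ f)) = cong (inj₂ ∘ inj₂) (Inverse.strictlyInverseʳ (aF a) f)

  Inc-image : ∀ a x y → Inc x y → Inc (image a x) (image a y)
  Inc-image a (inj₁ v)        (inj₂ (inj₁ e)) = subst T (sym (pVE a v e))
  Inc-image a (inj₂ (inj₁ e)) (inj₁ v)        = subst T (sym (pVE a v e))
  Inc-image a (inj₂ (inj₁ e)) (inj₂ (inj₂ f)) = subst T (sym (pEF a e f))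
  Inc-image a (inj₂ (inj₂ f)) (inj₂ (inj₁ e)) = subst T (sym (pEF a e f))
  Inc-image a (inj₁ v)        (inj₂ (inj₂ f)) = subst T (sym (pVF a v f))
  Inc-image a (inj₂ (inj₂ f)) (inj₁ v)        = subst T (sym (pVF a v f))

  Section : Elt → Elt → Elt → Set
  Section z x y = Inc z x × Inc z y × Inc x y

  hub⇒connected : ∀ z c → (∀ x → Inc z x → Star (Section z) x c) → InducedConnected (Inc z)
  hub⇒connected z c toHub x y zx zy = toHub x zx ◅◅ reverse flip (toHub y zy)
    where
    flip : ∀ {x y} → Section z x y → Section z y x
    flip {x} {y} (zx , zy , xy) = zy , zx , Inc-sym x y xy

  -- By transitivity, the sections then need to be examined only at the base vertex and the base
  -- face.
  image-connected : ∀ a z → InducedConnected (Inc z) → InducedConnected (Inc (image a z))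
  image-connected a z conn x y zx zy =
    subst₂ (Star _) (image-inverseˡ a x) (image-inverseˡ a y)
      (gmap (image a) (λ {u} {w} (zu , zw , uw) → Inc-image a z u zu , Inc-image a z w zw , Inc-image a u w uw)
        (conn (image (invA a) x) (image (invA a) y) (pull x zx) (pull y zy)))
    where
    pull : ∀ x → Inc (image a z) x → Inc z (image (invA a) x)
    pull x zx = subst (λ z → Inc z (image (invA a) x)) (image-inverseʳ a z) (Inc-image (invA a) (image a z) x zx)

-- The polyhedron, its counts and its rotations.

module Polyhedron {p : ℕ} .{{_ : NonZero p}} (C : CyclicRing p) (Tw : Twist C)
                  (1≢0 : CyclicRing.ι C (+ 1) ≢ CyclicRing.ι C (+ 0)) where
  open CyclicRing C
  open Twist Tw
  open TwistProperties C Tw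
  open Incidence C Tw

  infix 4 _≟_
  -- The decision is opaque, so that incidence proofs rest on its witnesses and never on its
  -- evaluation.
  abstract
    _≟_ : (x y : R) → Dec (x ≡ y)
    x ≟ y = map′ (↔-injective enumeration) (cong (Inverse.to enumeration))
                 (Inverse.to enumeration x Fin.≟ Inverse.to enumeration y)

  𝒫 : Poset₂
  𝒫 = record
    { V = R ; E = Edge ; F = Face
    ; IVE = λ v e → ⌊ end false e ≟ v ⌋ ∨ ⌊ end true e ≟ v ⌋
    ; IEF = λ { e (c , k) → ⌊ side c e ≟ k ⌋ }
    ; IVF = λ _ _ → true
    ; trans-VEF = λ _ _ _ _ _ → tt }

  open Poset₂ 𝒫
  open Sections 𝒫
  open Aut

  end-injective : ∀ {b c} e → end b e ≡ end c e → b ≡ c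
  end-injective {false} {false} e _  = refl
  end-injective {false} {true}  e eq = contradiction eq (end-distinct 1≢0 e)
  end-injective {true}  {false} e eq = contradiction (sym eq) (end-distinct 1≢0 e)
  end-injective {true}  {true}  e _  = refl

  incident-VE : ∀ b {v e} → end b e ≡ v → T (IVE v e)
  incident-VE false {v} {e} eq = Equivalence.from (T-∨ {⌊ end false e ≟ v ⌋}) (inj₁ (fromWitness eq))
  incident-VE true {v} {e} eq = Equivalence.from (T-∨ {⌊ end false e ≟ v ⌋}) (inj₂ (fromWitness eq))

  abstract
    whichEnd : ∀ {v e} → T (IVE v e) → ∃[ b ] end b e ≡ v
    whichEnd {v} {e} i with Equivalence.to (T-∨ {⌊ end false e ≟ v ⌋}) i
    ... | inj₁ w = false , toWitness w
    ... | inj₂ w = true , toWitness w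

  incident-EF : ∀ c e → T (IEF e (face c e))
  incident-EF c e = fromWitness refl

  incident-EF′ : ∀ c e {k} → side c e ≡ k → T (IEF e (c , k))
  incident-EF′ c e = fromWitness

  face-of : ∀ {e c k} → T (IEF e (c , k)) → side c e ≡ k
  face-of = toWitness

  edge-determined : ∀ b c {v k e} → end b e ≡ v → side c e ≡ k → edge b c v k ≡ e
  edge-determined b c {e = e} refl refl = edge-end-side b c e

  whichEnd-unique : ∀ b {v e} (i : T (IVE v e)) → end b e ≡ v → proj₁ (whichEnd {v} {e} i) ≡ b
  whichEnd-unique b {e = e} i eq = end-injective e (trans (proj₂ (whichEnd i)) (sym eq))

  vertices-of-edge : ∀ e → Σ V (λ v → T (IVE v e)) ↔ Bool
  vertices-of-edge e = subtype-↔ T-irrelevant (λ b → end b e) (λ v i → proj₁ (whichEnd i))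
    (λ b → incident-VE b refl) (λ v i → proj₂ (whichEnd i)) (λ b i → whichEnd-unique b i refl)

  faces-of-edge : ∀ e → Σ F (λ f → T (IEF e f)) ↔ Bool
  faces-of-edge e = subtype-↔ T-irrelevant (λ c → face c e) (λ f i → proj₁ f)
    (λ c → incident-EF c e) (λ { (c , k) i → cong (c ,_) (face-of {e} {c} {k} i) }) (λ c i → refl)

  -- The face fixes the side; what remains is a choice of the end at which `v` lies.
  edges-at-flag : ∀ v f → Σ E (λ e → T (IVE v e) × T (IEF e f)) ↔ Bool
  edges-at-flag v (c , k) = subtype-↔ (λ (i , j) (i′ , j′) → cong₂ _,_ (T-irrelevant i i′) (T-irrelevant j j′))
    (λ b → edge b c v k) (λ e (i , _) → proj₁ (whichEnd i))
    (λ b → incident-VE b (end-edge b c v k) , incident-EF′ c _ (side-edge b c v k))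
    (λ e (i , j) → edge-determined (proj₁ (whichEnd i)) c (proj₂ (whichEnd i)) (face-of {e} {c} {k} j))
    (λ b (i , _) → whichEnd-unique b i (end-edge b c v k))

  edges-of-face : ∀ f → Σ E (λ e → T (IEF e f)) ↔ R
  edges-of-face (c , k) = subtype-↔ T-irrelevant (λ v → edge false c v k) (λ e _ → end false e)
    (λ v → incident-EF′ c _ (side-edge false c v k))
    (λ e i → edge-determined false c refl (face-of {e} {c} {k} i))
    (λ v _ → end-edge false c v k)

  -- `v` may be either end, and in both cases the false side is free: this doubling is why q = 2p.
  edges-of-vertex : ∀ v → Σ E (λ e → T (IVE v e)) ↔ (Bool × R)
  edges-of-vertex v = subtype-↔ T-irrelevant (λ (b , k) → edge b false v k)
    (λ e i → proj₁ (whichEnd i) , side false e)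
    (λ (b , k) → incident-VE b (end-edge b false v k))
    (λ e i → edge-determined (proj₁ (whichEnd i)) false (proj₂ (whichEnd i)) refl)
    (λ (b , k) i → cong₂ _,_ (whichEnd-unique b i (end-edge b false v k)) (side-edge b false v k))

  -- A flag amounts to an edge together with one of its ends and one of its sides.
  flags : Flag ↔ ((Bool × R) × (Bool × R))
  flags = mk↔ₛ′ encode decode encode-decode (λ Φ → decode-encode Φ)
    where
    encode : Flag → (Bool × R) × (Bool × R)
    encode (flag v (a , h) (c , k) i _ _) = (proj₁ (whichEnd i) , a) , (c , h)
    decode : (Bool × R) × (Bool × R) → Flag
    decode ((b , a) , (c , h)) = flag (end b (a , h)) (a , h) (face c (a , h))
      (incident-VE b refl) (incident-EF c (a , h)) tt
    encode-decode : ∀ x → encode (decode x) ≡ x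
    encode-decode ((b , a) , (c , h)) = cong (λ b → (b , a) , (c , h)) (whichEnd-unique b (incident-VE b {e = a , h} refl) refl)
    flag-≡ : ∀ {v v′ e f f′} {i j k i′ j′ k′} → v ≡ v′ → f ≡ f′ → flag v e f i j k ≡ flag v′ e f′ i′ j′ k′
    flag-≡ {v} {_} {e} {f} {_} {i} {j} {tt} {i′} {j′} {tt} refl refl =
      cong₂ (λ i j → flag v e f i j tt) (T-irrelevant i i′) (T-irrelevant j j′)
    decode-encode : ∀ Φ → decode (encode Φ) ≡ Φ
    decode-encode (flag v e (c , k) i j _) =
      flag-≡ (proj₂ (whichEnd i)) (cong (c ,_) (face-of {e} {c} {k} j))

  Bool↔2 : Bool ↔ Fin 2
  Bool↔2 = ↔-sym Fin.2↔Bool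

  Bool×R↔2p : (Bool × R) ↔ Fin (2 ℕ.* p)
  Bool×R↔2p = ↔-sym Fin.*↔× ↔-∘ (Bool↔2 ×-↔ enumeration)

  hasType : HasType 𝒫 p (2 ℕ.* p)
  hasType = (λ f → enumeration ↔-∘ edges-of-face f) , (λ v → Bool×R↔2p ↔-∘ edges-of-vertex v)

  tight : Tight 𝒫 p (2 ℕ.* p)
  tight = ↔-sym Fin.*↔× ↔-∘ ((Bool×R↔2p ×-↔ Bool×R↔2p) ↔-∘ flags)

  -- Either all ends and sides of edges are kept, or all are interchanged.
  record Rotation : Set where
    field
      rV : R ↔ R
      rE : Edge ↔ Edge
      rF : Face ↔ Face
      φ  : Bool → Bool
      φ-involutive : ∀ b → φ (φ b) ≡ b
      φ-xor  : ∀ b c → φ b xor φ c ≡ b xor c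
      on-end  : ∀ b e → end (φ b) (Inverse.to rE e) ≡ Inverse.to rV (end b e)
      on-face : ∀ c e → face (φ c) (Inverse.to rE e) ≡ Inverse.to rF (face c e)

    aut : Aut 𝒫
    aut = record
      { aV = rV ; aE = rE ; aF = rF
      ; pVE = λ v e → T-ext (backVE v e) (λ i → let b , eq = whichEnd {v} {e} i in
          incident-VE (φ b) (trans (on-end b e) (cong (Inverse.to rV) eq)))
      ; pEF = λ e f → T-ext (backEF e f) (forthEF e f)
      ; pVF = λ _ _ → refl }
      where
      backVE : ∀ v e → T (IVE (Inverse.to rV v) (Inverse.to rE e)) → T (IVE v e)
      backVE v e i with whichEnd i
      ... | b , eq = incident-VE (φ b) (↔-injective rV (begin
        Inverse.to rV (end (φ b) e)     ≡⟨ on-end (φ b) e ⟨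
        end (φ (φ b)) (Inverse.to rE e) ≡⟨ cong (λ b → end b (Inverse.to rE e)) (φ-involutive b) ⟩
        end b (Inverse.to rE e)         ≡⟨ eq ⟩
        Inverse.to rV v                 ∎))
        where open ≡-Reasoning
      forthEF : ∀ e f → T (IEF e f) → T (IEF (Inverse.to rE e) (Inverse.to rF f))
      forthEF e (c , k) i = subst (λ f → T (IEF (Inverse.to rE e) f))
        (trans (on-face c e) (cong (λ k → Inverse.to rF (c , k)) (face-of {e} {c} {k} i)))
        (incident-EF (φ c) (Inverse.to rE e))
      backEF : ∀ e f → T (IEF (Inverse.to rE e) (Inverse.to rF f)) → T (IEF e f)
      backEF e f i = subst (λ f → T (IEF e f)) (↔-injective rF (begin
        Inverse.to rF (face (φ c) e)        ≡⟨ on-face (φ c) e ⟨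
        face (φ (φ c)) (Inverse.to rE e)    ≡⟨ cong (λ c → face c (Inverse.to rE e)) (φ-involutive c) ⟩
        face c (Inverse.to rE e)            ≡⟨ cong (c ,_) (face-of {Inverse.to rE e} {c} {k} i) ⟩
        (c , k)                             ∎)) (incident-EF (φ c) e)
        where
        open ≡-Reasoning
        c = proj₁ (Inverse.to rF f)
        k = proj₂ (Inverse.to rF f)

  rotation₁ rotation₂ : Rotation
  rotation₁ = record
    { rV = mk↔ₛ′ rotV₁ rotV₁⁻¹ rotV₁-inverseˡ rotV₁-inverseʳ
    ; rE = mk↔ₛ′ rotE₁ rotE₁⁻¹ rotE₁-inverseˡ rotE₁-inverseʳ
    ; rF = mk↔ₛ′ rotF₁ rotF₁⁻¹ rotF₁-inverseˡ rotF₁-inverseʳ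
    ; φ = id ; φ-involutive = λ _ → refl ; φ-xor = λ _ _ → refl
    ; on-end = end-rotE₁ ; on-face = face-rotE₁ }
  rotation₂ = record
    { rV = mk↔ₛ′ rotV₂ rotV₂⁻¹ rotV₂-inverseˡ rotV₂-inverseʳ
    ; rE = mk↔ₛ′ rotE₂ rotE₂⁻¹ rotE₂-inverseˡ rotE₂-inverseʳ
    ; rF = mk↔ₛ′ rotF₂ rotF₂⁻¹ rotF₂-inverseˡ rotF₂-inverseʳ
    ; φ = not ; φ-involutive = not-involutive ; φ-xor = xor-annihilates-not
    ; on-end = end-rotE₂ ; on-face = face-rotE₂ }

  s₁ s₂ : Aut 𝒫
  s₁ = Rotation.aut rotation₁
  s₂ = Rotation.aut rotation₂

  ev : Word → Aut 𝒫
  ev = eval s₁ s₂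

  onV : Aut 𝒫 → R → R
  onV a = Inverse.to (aV a)

  onF : Aut 𝒫 → Face → Face
  onF a = Inverse.to (aF a)

  orbitV : ∀ g (Q : ℤ → R → Set) →
           (∀ {j x} → Q j x → Q (ℤ.suc j) (onV (evalLetter s₁ s₂ (g , false)) x)) →
           (∀ {j x} → Q j x → Q (ℤ.pred j) (onV (evalLetter s₁ s₂ (g , true)) x)) →
           ∀ i {j x} → Q j x → Q (i ℤ.+ j) (onV (ev (pow g i)) x)
  orbitV = power-orbit onV (λ _ → refl) (λ _ _ _ → refl) s₁ s₂

  orbitF : ∀ g (Q : ℤ → Face → Set) →
           (∀ {j x} → Q j x → Q (ℤ.suc j) (onF (evalLetter s₁ s₂ (g , false)) x)) →
           (∀ {j x} → Q j x → Q (ℤ.pred j) (onF (evalLetter s₁ s₂ (g , true)) x)) →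
           ∀ i {j x} → Q j x → Q (i ℤ.+ j) (onF (ev (pow g i)) x)
  orbitF = power-orbit onF (λ _ → refl) (λ _ _ _ → refl) s₁ s₂

  open CommutativeRing commutativeRing using (_-_; +-identityˡ)

  ι-suc : ∀ i → ι (ℤ.suc i) ≡ ι i + 1#
  ι-suc i = trans (cong ι (ℤ.+-comm (+ 1) i)) (ι-+ i (+ 1))

  ι-pred : ∀ i → ι (ℤ.pred i) ≡ ι i - 1#
  ι-pred i = trans (cong ι (ℤ.+-comm -[1+ 0 ] i)) (trans (ι-+ i -[1+ 0 ]) (cong (_+_ (ι i)) (ι-neg (+ 1))))

  base-face : Face
  base-face = false , 0#

  σ₁-powerV : ∀ i → onV (ev (pow g₁ i)) 0# ≡ ι i
  σ₁-powerV i = trans (orbitV g₁ (λ j x → x ≡ ι j)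
    (λ {j} eq → trans (cong rotV₁ eq) (sym (ι-suc j)))
    (λ {j} eq → trans (cong rotV₁⁻¹ eq) (sym (ι-pred j))) i {+ 0} refl)
    (cong ι (ℤ.+-identityʳ i))

  σ₂-powerV : ∀ i → onV (ev (pow g₂ i)) 0# ≡ 0#
  σ₂-powerV i = orbitV g₂ (λ _ x → x ≡ 0#)
    (λ eq → trans (cong rotV₂ eq) (solve 0 (:- :0 :+ :μ :* (:0 :* :0 :- :0) := :0) refl))
    (λ eq → trans (cong rotV₂⁻¹ eq) (solve 0 (:- :0 :+ :μ :* (:0 :* :0 :+ :0) := :0) refl)) i {+ 0} refl

  σ₁-power-base : ∀ i → onF (ev (pow g₁ i)) base-face ≡ base-face
  σ₁-power-base i = orbitF g₁ (λ _ f → f ≡ base-face)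
    (λ eq → trans (cong rotF₁ eq) (cong (false ,_) (solve 0 (:0 :- :μ :* :0 := :0) refl)))
    (λ eq → trans (cong rotF₁⁻¹ eq) (cong (false ,_) (solve 0 (:0 :+ :μ :* :0 := :0) refl))) i {+ 0} refl

  σ₁-power-odd : ∀ i k → onF (ev (pow g₁ i)) (true , k) ≡ (true , turn (ι i) k)
  σ₁-power-odd i k = trans (orbitF g₁ (λ j f → f ≡ (true , turn (ι j) k))
    (λ {j} eq → trans (cong rotF₁ eq) (sym (up j)))
    -- A backward step undoes the forward step out of the predecessor, so the upward recurrence of
    -- `turn` suffices.
    (λ {j} eq → trans (cong rotF₁⁻¹ eq) (trans (cong rotF₁⁻¹ (down j)) (rotF₁-inverseʳ _))) i {+ 0}
    (cong (true ,_) (sym turn-zero)))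
    (cong (λ j → true , turn (ι j) k) (ℤ.+-identityʳ i))
    where
    up : ∀ j → (true , turn (ι (ℤ.suc j)) k) ≡ rotF₁ (true , turn (ι j) k)
    up j = cong (true ,_) (trans (cong (λ i → turn i k) (ι-suc j)) (turn-suc (ι j) k))
    down : ∀ j → (true , turn (ι j) k) ≡ rotF₁ (true , turn (ι (ℤ.pred j)) k)
    down j = trans (cong (λ j → true , turn (ι j) k) (sym (ℤ.suc-pred j))) (up (ℤ.pred j))
    turn-zero : turn 0# k ≡ k
    turn-zero = trans (cong (λ s → k - 0# + 0# * (μ * k) - s) t-zero)
      (solve 1 (λ k → k :- :0 :+ :0 :* (:μ :* k) :- :0 := k) refl k)

  -- The face (c , ι i) is the image of the base face under σ₂^(2i + c).

  Numbered : ℤ → Face → Set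
  Numbered j f = ∃[ i ] ((j ≡ i ℤ.+ i × f ≡ (false , ι i)) ⊎ (j ≡ ℤ.suc (i ℤ.+ i) × f ≡ (true , ι i)))

  numbered : ∀ j → Numbered j (onF (ev (pow g₂ j)) base-face)
  numbered j = subst (λ j′ → Numbered j′ (onF (ev (pow g₂ j)) base-face)) (ℤ.+-identityʳ j)
    (orbitF g₂ Numbered up down j {+ 0} (+ 0 , inj₁ (refl , refl)))
    where
    open +-*-Solver using () renaming (solve to solveℤ; _:+_ to _⊕_; _:=_ to _⊜_; con to κ)
    up : ∀ {j f} → Numbered j f → Numbered (ℤ.suc j) (rotF₂ f)
    up (i , inj₁ (refl , refl)) = i , inj₂ (refl , refl)
    up (i , inj₂ (refl , refl)) = ℤ.suc i , inj₁
      ( solveℤ 1 (λ i → κ (+ 1) ⊕ (κ (+ 1) ⊕ (i ⊕ i)) ⊜ (κ (+ 1) ⊕ i) ⊕ (κ (+ 1) ⊕ i)) refl i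
      , cong (false ,_) (sym (ι-suc i)))
    down : ∀ {j f} → Numbered j f → Numbered (ℤ.pred j) (rotF₂⁻¹ f)
    down (i , inj₁ (refl , refl)) = ℤ.pred i , inj₂
      ( solveℤ 1 (λ i → κ -[1+ 0 ] ⊕ (i ⊕ i) ⊜ κ (+ 1) ⊕ ((κ -[1+ 0 ] ⊕ i) ⊕ (κ -[1+ 0 ] ⊕ i))) refl i
      , cong (true ,_) (sym (ι-pred i)))
    down (i , inj₂ (refl , refl)) = i , inj₁ (ℤ.pred-suc (i ℤ.+ i) , refl)

  numbered-unique : ∀ {j f f′} → Numbered j f → Numbered j f′ → f ≡ f′
  numbered-unique (i , inj₁ (eq , refl)) (i′ , inj₁ (eq′ , refl)) =
    cong (λ i → false , ι i) (double-injective i i′ (trans (sym eq) eq′))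
  numbered-unique (i , inj₁ (eq , refl)) (i′ , inj₂ (eq′ , refl)) =
    contradiction (trans (sym eq) eq′) (even≢odd i i′)
  numbered-unique (i , inj₂ (eq , refl)) (i′ , inj₁ (eq′ , refl)) =
    contradiction (trans (sym eq′) eq) (even≢odd i′ i)
  numbered-unique (i , inj₂ (eq , refl)) (i′ , inj₂ (eq′ , refl)) =
    cong (λ i → true , ι i) (double-injective i i′ (trans (sym (ℤ.pred-suc (i ℤ.+ i)))
      (trans (cong ℤ.pred (trans (sym eq) eq′)) (ℤ.pred-suc (i′ ℤ.+ i′)))))

  -- The face shows the parity of its number, and halves congruent modulo p give numbers congruent
  -- modulo 2p. Hence the powers of σ₂ are separated modulo exactly 2p.
  numbered-congruent : ∀ {j j′ f} → Numbered j f → Numbered j′ f → ∃[ k ] j ≡ j′ ℤ.+ k ℤ.* (+ p ℤ.+ + p)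
  numbered-congruent (i , inj₁ (refl , refl)) (i′ , inj₁ (refl , eq))
    with k , refl ← ι-≡⇒congruent (cong proj₂ eq) = k ,
      Z.solve 3 (λ i k P → (i Z.:+ k Z.:* P) Z.:+ (i Z.:+ k Z.:* P) Z.:= i Z.:+ i Z.:+ k Z.:* (P Z.:+ P)) refl i′ k (+ p)
    where module Z = +-*-Solver
  numbered-congruent (i , inj₂ (refl , refl)) (i′ , inj₂ (refl , eq))
    with k , refl ← ι-≡⇒congruent (cong proj₂ eq) = k ,
      Z.solve 3 (λ i k P → Z.con (+ 1) Z.:+ ((i Z.:+ k Z.:* P) Z.:+ (i Z.:+ k Z.:* P)) Z.:=
        (Z.con (+ 1) Z.:+ (i Z.:+ i)) Z.:+ k Z.:* (P Z.:+ P)) refl i′ k (+ p)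
    where module Z = +-*-Solver

  σ₂-power-even : ∀ i → onF (ev (pow g₂ (i ℤ.+ i))) base-face ≡ (false , ι i)
  σ₂-power-even i = numbered-unique (numbered (i ℤ.+ i)) (i , inj₁ (refl , refl))

  σ₂-power-odd : ∀ i → onF (ev (pow g₂ (ℤ.suc (i ℤ.+ i)))) base-face ≡ (true , ι i)
  σ₂-power-odd i = numbered-unique (numbered (ℤ.suc (i ℤ.+ i))) (i , inj₂ (refl , refl))

  σ₂-transitive : ∀ f → ∃[ j ] onF (ev (pow g₂ j)) base-face ≡ f
  σ₂-transitive (false , k) with ι-surjective k
  ... | i , refl = + i ℤ.+ + i , σ₂-power-even (+ i)
  σ₂-transitive (true , k) with ι-surjective k
  ... | i , refl = ℤ.suc (+ i ℤ.+ + i) , σ₂-power-odd (+ i)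

  σ₁-transitive : ∀ v → ∃[ i ] onV (ev (pow g₁ i)) 0# ≡ v
  σ₁-transitive v with ι-surjective v
  ... | i , refl = + i , σ₁-powerV (+ i)

  -- With `side-odd-even`, this orders the faces around the vertex 0: its edges link 2h to 2h + 1
  -- and 2h + 1 to 2h + 2, which makes the vertex section connected.
  side-even-odd : ∀ h → side true (edge true false 0# h) ≡ h
  side-even-odd h = trans
    (cong (λ s → h - a - 1# + ν * (h * a) - s) (trans (cong t (solve 1 (λ h →
      :0 :- :1 :- :ν :* h :+ :1 := :0 :+ :ν :* (:- h)) refl h)) (trans (t-shift-ν 0# (- h)) t-zero)))
    (cancel _ (solve 1 (λ h → let a = :0 :- :1 :- :ν :* h in
      h :- a :- :1 :+ :ν :* (h :* a) :- :0 :+ dense h h h := h :+ dense h h h) refl h))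
    where a = 0# - 1# - ν * h

  side-odd-even : ∀ h → side true (0# , h + 1#) ≡ h
  side-odd-even h = trans
    (cong (λ s → (h + 1#) - 0# - 1# + ν * ((h + 1#) * 0#) - s) (trans (cong t (+-identityˡ 1#)) t-one))
    (solve 1 (λ h → (h :+ :1) :- :0 :- :1 :+ :ν :* ((h :+ :1) :* :0) :- :0 := h) refl h)

  private
    vertexᵉ : R → Elt
    vertexᵉ = inj₁
    edgeᵉ : Edge → Elt
    edgeᵉ e = inj₂ (inj₁ e)
    faceᵉ : Face → Elt
    faceᵉ f = inj₂ (inj₂ f)

  connected : Connected
  connected x y = toBase x ◅◅ reverse (λ {x} {y} → Inc-sym x y) (toBase y)
    where
    toBase : ∀ x → Star Inc x (faceᵉ base-face)
    toBase (inj₁ v)        = _◅_ {j = faceᵉ base-face} tt done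
    toBase (inj₂ (inj₁ e)) = _◅_ {j = vertexᵉ (end false e)} (incident-VE false {e = e} refl)
                               (_◅_ {j = faceᵉ base-face} tt done)
    toBase (inj₂ (inj₂ f)) = _◅_ {j = vertexᵉ 0#} tt (_◅_ {j = faceᵉ base-face} tt done)

  base-vertex-section : InducedConnected (Inc (vertexᵉ 0#))
  base-vertex-section = hub⇒connected (vertexᵉ 0#) (faceᵉ base-face) toHub
    where
    Path : Elt → Set
    Path x = Star (Section (vertexᵉ 0#)) x (faceᵉ base-face)
    odd-step : ∀ h → Path (faceᵉ (false , h)) → Path (faceᵉ (true , h))
    odd-step h path = _◅_ {j = edgeᵉ e} (tt , at0 , incident-EF′ true e (side-even-odd h))
      (_◅_ {j = faceᵉ (false , h)} (at0 , tt , incident-EF false e) path)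
      where
      e = edge true false 0# h
      at0 = incident-VE true {e = e} (end-edge true false 0# h)
    even-step : ∀ h → Path (faceᵉ (true , h)) → Path (faceᵉ (false , h + 1#))
    even-step h path = _◅_ {j = edgeᵉ e} (tt , at0 , incident-EF false e)
      (_◅_ {j = faceᵉ (true , h)} (at0 , tt , incident-EF′ true e (side-odd-even h)) path)
      where
      e = 0# , h + 1#
      at0 = incident-VE false {e = e} refl
    even : ∀ h → Path (faceᵉ (false , h))
    even = R-ind _ done (λ h path → even-step h (odd-step h path))
    toHub : ∀ x → Inc (vertexᵉ 0#) x → Path x
    toHub (inj₂ (inj₁ e)) i           = _◅_ {j = faceᵉ (face false e)} (i , tt , incident-EF false e) (even (side false e))
    toHub (inj₂ (inj₂ (false , h))) _ = even h
    toHub (inj₂ (inj₂ (true , h))) _  = odd-step h (even h)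

  base-face-section : InducedConnected (Inc (faceᵉ base-face))
  base-face-section = hub⇒connected (faceᵉ base-face) (vertexᵉ 0#) toHub
    where
    Path : Elt → Set
    Path x = Star (Section (faceᵉ base-face)) x (vertexᵉ 0#)
    step : ∀ a → Path (vertexᵉ a) → Path (vertexᵉ (a + 1#))
    step a path = _◅_ {j = edgeᵉ e} (tt , on-base , incident-VE true {e = e} (solve 1 (λ a → a :+ :1 :+ :ν :* :0 := a :+ :1) refl a))
      (_◅_ {j = vertexᵉ a} (on-base , tt , incident-VE false {e = e} refl) path)
      where
      e = a , 0#
      on-base = incident-EF false e
    vertex : ∀ a → Path (vertexᵉ a)
    vertex = R-ind _ done step
    toHub : ∀ x → Inc (faceᵉ base-face) x → Path x
    toHub (inj₁ v)        _ = vertex v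
    toHub (inj₂ (inj₁ e)) i = _◅_ {j = vertexᵉ (end false e)} (i , tt , incident-VE false {e = e} refl) (vertex (end false e))

  abstract
    isPolyhedron : IsPolyhedron 𝒫
    isPolyhedron = record
      { edge-two-vertices = λ e → Bool↔2 ↔-∘ vertices-of-edge e
      ; edge-two-faces    = λ e → Bool↔2 ↔-∘ faces-of-edge e
      ; diamond           = λ v f _ → Bool↔2 ↔-∘ edges-at-flag v f
      ; connected         = connected
      ; vertex-section    = λ v → let i , eq = σ₁-transitive v in
          subst (λ v → InducedConnected (Inc (vertexᵉ v))) eq
            (image-connected (ev (pow g₁ i)) (vertexᵉ 0#) base-vertex-section)
      ; face-section      = λ f → let j , eq = σ₂-transitive f in
          subst (λ f → InducedConnected (Inc (faceᵉ f))) eq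
            (image-connected (ev (pow g₂ j)) (faceᵉ base-face) base-face-section) }

-- The two flag classes and transitivity on each.

xor-cancelˡ : ∀ b c c′ → b xor c ≡ b xor c′ → c ≡ c′
xor-cancelˡ false c c′ eq = eq
xor-cancelˡ true  c c′ eq = not-injective eq

xor-cancelʳ : ∀ b b′ c → b xor c ≡ b′ xor c → b ≡ b′
xor-cancelʳ false false c     _ = refl
xor-cancelʳ true  true  c     _ = refl
xor-cancelʳ false true  false ()
xor-cancelʳ false true  true  ()
xor-cancelʳ true  false false ()
xor-cancelʳ true  false true  ()

module FlagClasses {p : ℕ} .{{_ : NonZero p}} (C : CyclicRing p) (Tw : Twist C)
                   (1≢0 : CyclicRing.ι C (+ 1) ≢ CyclicRing.ι C (+ 0)) where
  open CyclicRing C using (R)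
  open TwistProperties C Tw
  open Incidence C Tw
  open Polyhedron C Tw 1≢0
  open Poset₂ 𝒫
  open Flags isPolyhedron
  open Aut

  -- A 0- or 1-adjacency changes the end and keeps the side, a 2-adjacency does the opposite; a
  -- rotation changes both or neither. The sum of the two bits is therefore the class.
  cls : Flag → Bool
  cls Ψ = proj₁ (whichEnd (ive Ψ)) xor proj₁ (ff Ψ)

  cls-end : ∀ b Ψ → end b (fe Ψ) ≡ fv Ψ → cls Ψ ≡ b xor proj₁ (ff Ψ)
  cls-end b Ψ eq = cong (_xor proj₁ (ff Ψ)) (whichEnd-unique b (ive Ψ) eq)

  cls-resp : ∀ {Ψ Ω} → Ψ ∼ Ω → cls Ψ ≡ cls Ω
  cls-resp {flag v e f i _ _} {flag v e f i′ _ _} (same (refl , refl , refl)) =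
    cong (_xor proj₁ f) (whichEnd-unique (proj₁ (whichEnd i′)) i (proj₂ (whichEnd i′)))

  -- Vertex and face leave two edges, told apart by the end at which the vertex lies; the class and
  -- the side of the face recover that end.
  flag-determined : ∀ Ψ Ω → fv Ψ ≡ fv Ω → ff Ψ ≡ ff Ω → cls Ψ ≡ cls Ω → Ψ ∼ Ω
  flag-determined (flag v e (c , k) i j _) (flag v e′ (c , k) i′ j′ _) refl refl eq = same (refl , e≡e′ , refl)
    where
    b b′ : Bool
    b  = proj₁ (whichEnd i)
    b′ = proj₁ (whichEnd i′)
    open ≡-Reasoning
    e≡e′ : e ≡ e′
    e≡e′ = begin
      e             ≡⟨ edge-determined b c (proj₂ (whichEnd i)) (face-of {e} {c} {k} j) ⟨
      edge b c v k  ≡⟨ cong (λ b → edge b c v k) (xor-cancelʳ b b′ c eq) ⟩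
      edge b′ c v k ≡⟨ edge-determined b′ c (proj₂ (whichEnd i′)) (face-of {e′} {c} {k} j′) ⟩
      e′            ∎

  cls-adj : ∀ i Ψ Ω → IsAdj i Ψ Ω → cls Ψ ≢ cls Ω
  cls-adj zero (flag v e (c , k) i _ _) (flag v′ e (c , k) i′ _ _) (v≢v′ , refl , refl) eq =
    v≢v′ (trans (sym (proj₂ (whichEnd i)))
      (trans (cong (λ b → end b e) (xor-cancelʳ (proj₁ (whichEnd i)) (proj₁ (whichEnd i′)) c eq)) (proj₂ (whichEnd i′))))
  cls-adj (suc zero) Ψ Ω (p , e≢e′ , r) eq = e≢e′ (proj₁ (proj₂ (unsame (flag-determined Ψ Ω p r eq))))
  cls-adj (suc (suc zero)) (flag v e (c , k) i j _) (flag v e (c′ , k′) i′ j′ _) (refl , refl , f≢f′) eq = f≢f′ (begin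
    (c , k)       ≡⟨ cong (c ,_) (face-of {e} {c} {k} j) ⟨
    face c e      ≡⟨ cong (λ c → face c e) (xor-cancelˡ b c c′ (trans eq (cong (_xor c′) (whichEnd-unique b i′ (proj₂ (whichEnd i)))))) ⟩
    face c′ e     ≡⟨ cong (c′ ,_) (face-of {e} {c′} {k′} j′) ⟩
    (c′ , k′)     ∎)
    where
    open ≡-Reasoning
    b = proj₁ (whichEnd i)

  cls-rotation : ∀ r Ψ → cls (act (Rotation.aut r) Ψ) ≡ cls Ψ
  cls-rotation r Ψ@(flag v e (c , k) i j _) = begin
    cls (act aut Ψ)
      ≡⟨ cls-end (φ b) (act aut Ψ) (trans (on-end b e) (cong (Inverse.to rV) (proj₂ (whichEnd i)))) ⟩
    φ b xor proj₁ (Inverse.to rF (c , k))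
      ≡⟨ cong (φ b xor_) (cong proj₁ (trans (cong (λ k → Inverse.to rF (c , k)) (sym (face-of {e} {c} {k} j))) (sym (on-face c e)))) ⟩
    φ b xor φ c ≡⟨ φ-xor b c ⟩
    b xor c     ∎
    where
    open ≡-Reasoning
    open Rotation r
    b = proj₁ (whichEnd i)

  cls-inverse : ∀ r Ψ → cls (act (invA (Rotation.aut r)) Ψ) ≡ cls Ψ
  cls-inverse r Ψ = trans (sym (cls-rotation r (act (invA (Rotation.aut r)) Ψ)))
                          (cls-resp {act (Rotation.aut r) (act (invA (Rotation.aut r)) Ψ)} {Ψ} (act-inverseˡ (Rotation.aut r)))

  cls-letter : ∀ x Ψ → cls (act (evalLetter s₁ s₂ x) Ψ) ≡ cls Ψ
  cls-letter (g₁ , false) = cls-rotation rotation₁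
  cls-letter (g₁ , true)  = cls-inverse rotation₁
  cls-letter (g₂ , false) = cls-rotation rotation₂
  cls-letter (g₂ , true)  = cls-inverse rotation₂

  cls-ev : ∀ w Ψ → cls (act (ev w) Ψ) ≡ cls Ψ
  cls-ev []      Ψ = cls-resp {act (ev []) Ψ} {Ψ} (same (refl , refl , refl))
  cls-ev (x ∷ w) Ψ = trans (cls-resp {act (ev (x ∷ w)) Ψ} {act (evalLetter s₁ s₂ x) (act (ev w) Ψ)} (same (refl , refl , refl)))
    (trans (cls-letter x (act (ev w) Ψ)) (cls-ev w Ψ))

  -- The vertex 0 is its true end, so σ₁ moves this edge to (0 , 0), the edge that `Φ¹` shares with
  -- the image of `Φ`.
  base-edge : Edge
  base-edge = edge true false 0# 0#

  base-end : end true base-edge ≡ 0#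
  base-end = end-edge true false 0# 0#

  Φ : Flag
  Φ = flag 0# base-edge base-face (incident-VE true {e = base-edge} base-end) (incident-EF false base-edge) tt

  cls-Φ : cls Φ ≡ true
  cls-Φ = cls-end true Φ base-end

  reach : ∀ v f → ∃[ w ] (onV (ev w) 0# ≡ v × onF (ev w) base-face ≡ f)
  reach v f with σ₁-transitive v
  -- σ₂ fixes the vertex 0, so `v` dictates `i`; then `j` is chosen for the face `f` pulled back
  -- along σ₁^i.
  ... | i , toV with σ₂-transitive (Inverse.from (aF (ev (pow g₁ i))) f)
  ... | j , toF = pow g₁ i ++ pow g₂ j ,
    trans (proj₁ (eval-++ s₁ s₂ (pow g₁ i) (pow g₂ j)) 0#) (trans (cong (onV (ev (pow g₁ i))) (σ₂-powerV j)) toV) ,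
    trans (proj₂ (proj₂ (eval-++ s₁ s₂ (pow g₁ i) (pow g₂ j))) base-face)
      (trans (cong (onF (ev (pow g₁ i))) toF) (Inverse.strictlyInverseˡ (aF (ev (pow g₁ i))) f))

  reach-flag : ∀ Ψ → cls Ψ ≡ true → ∃[ w ] act (ev w) Φ ∼ Ψ
  reach-flag Ψ eq = let w , v≡ , f≡ = reach (fv Ψ) (ff Ψ) in
    w , flag-determined (act (ev w) Φ) Ψ v≡ f≡ (trans (cls-ev w Φ) (trans cls-Φ (sym eq)))

  flagAt : Edge → Flag
  flagAt e = flag (end true e) e (face false e) (incident-VE true {e = e} refl) (incident-EF false e) tt

  coverV : ∀ v → ∃[ w ] fv (act (ev w) Φ) ≡ v
  coverV v = let w , eq , _ = reach v base-face in w , eq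

  coverF : ∀ f → ∃[ w ] ff (act (ev w) Φ) ≡ f
  coverF f = let w , _ , eq = reach 0# f in w , eq

  coverE : ∀ e → ∃[ w ] fe (act (ev w) Φ) ≡ e
  coverE e = let w , wΦ∼ = reach-flag (flagAt e) (cls-end true (flagAt e) refl) in
    w , proj₁ (proj₂ (unsame wΦ∼))

  Φ¹ : Flag
  Φ¹ = flag 0# (0# , 0#) base-face (incident-VE false {e = 0# , 0#} refl) (incident-EF false (0# , 0#)) tt

  Φ-Φ¹ : IsAdj (suc zero) Φ Φ¹
  Φ-Φ¹ = refl , (λ eq → end-distinct 1≢0 (0# , 0#) (trans (sym base-end) (cong (end true) eq))) , refl

  adj₁ : ∃[ Ψ ] (IsAdj (suc zero) Φ Ψ × IsAdj zero Ψ (act s₁ Φ))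
  adj₁ = Φ¹ , Φ-Φ¹ ,
    ( (λ eq → 1≢0 (sym (trans eq (solve 0 (:0 :+ :1 := :1) refl))))
    , cong₂ _,_ (solve 0 (:0 := :0 :- :1 :- :ν :* :0 :+ :1) refl) (solve 0 (:0 := :0 :- :μ :* :0) refl)
    , sym (σ₁-power-base (+ 1)))

  adj₂ : ∃[ Ψ ] (IsAdj (suc (suc zero)) Φ Ψ × IsAdj (suc zero) Ψ (act s₂ Φ))
  adj₂ = flag 0# base-edge (true , 0#) (incident-VE true {e = base-edge} base-end)
           (incident-EF′ true base-edge (side-even-odd 0#)) tt ,
    (refl , refl , λ ()) ,
    ( sym (σ₂-powerV (+ 1))
    , (λ eq → end-distinct 1≢0 base-edge (begin
        end false base-edge           ≡⟨ cong (end false) eq ⟩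
        end false (rotE₂ base-edge)   ≡⟨ end-rotE₂ true base-edge ⟩
        rotV₂ (end true base-edge)    ≡⟨ cong rotV₂ base-end ⟩
        rotV₂ 0#                      ≡⟨ σ₂-powerV (+ 1) ⟩
        0#                            ≡⟨ base-end ⟨
        end true base-edge            ∎))
    , refl)
    where open ≡-Reasoning

  module Rot = Rotations isPolyhedron Φ s₁ s₂ adj₁ adj₂ coverV coverE coverF

  transitive-true : ∀ Ψ Ω → cls Ψ ≡ true → cls Ω ≡ true → ∃[ a ] act a Ψ ∼ Ω
  transitive-true Ψ Ω Ψ+ Ω+ = let u , uΦ∼Ψ = reach-flag Ψ Ψ+ ; w , wΦ∼Ω = reach-flag Ω Ω+ in
    (ev w ∘A invA (ev u)) ,
    same (unsame (∼-trans (act-cong (ev w) (∼-trans (act-cong (invA (ev u)) (∼-sym uΦ∼Ψ)) (act-inverseʳ (ev u)))) wΦ∼Ω))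

  opposite : ∀ Ψ → ∃[ Ω ] Adj (suc (suc zero)) Ψ Ω
  opposite (flag v e (c , k) i j _) = flag v e (face (not c) e) i (incident-EF (not c) e) tt ,
    adj (refl , refl , λ eq → not-¬ refl (cong proj₁ eq))

  -- Flags of the false class are replaced by their 2-adjacent flags, which lie in the true class.
  transitive : ∀ Ψ Ω → cls Ψ ≡ cls Ω → ∃[ a ] act a Ψ ∼ Ω
  transitive Ψ Ω eq = go (cls Ψ) refl
    where
    other : ∀ Ψ Ψ′ → IsAdj (suc (suc zero)) Ψ Ψ′ → cls Ψ ≡ false → cls Ψ′ ≡ true
    other Ψ Ψ′ Ψ-Ψ′ Ψ⁻ = ¬-not (λ Ψ′⁻ → cls-adj (suc (suc zero)) Ψ Ψ′ Ψ-Ψ′ (trans Ψ⁻ (sym Ψ′⁻)))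
    go : ∀ b → cls Ψ ≡ b → ∃[ a ] act a Ψ ∼ Ω
    go true  Ψ⁺ = transitive-true Ψ Ω Ψ⁺ (trans (sym eq) Ψ⁺)
    go false Ψ⁻ =
      let Ψ′ , Ψ-Ψ′ = opposite Ψ
          Ω′ , Ω-Ω′ = opposite Ω
          a , aΨ′∼Ω′ = transitive-true Ψ′ Ω′ (other Ψ Ψ′ (unadj Ψ-Ψ′) Ψ⁻)
                         (other Ω Ω′ (unadj Ω-Ω′) (trans (sym eq) Ψ⁻))
      in a , adj-unique aΨ′∼Ω′ (act-adj a (adj-sym Ψ-Ψ′)) (adj-sym Ω-Ω′)

  module _ (no-reflection : ∀ a → ¬ (act a Φ ∼ Φ¹)) where

    chiral : Chiral {𝒫}
    chiral = cls , cls-adj ,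
      (λ Ψ Ω eq → let a , aΨ∼Ω = transitive Ψ Ω eq in a , unsame aΨ∼Ω) ,
      λ all → let a , eq = all Φ Φ¹ in no-reflection a (same eq)

    -- If `a` keeps the class of `Φ`, it agrees with a word at `Φ`, hence everywhere. Otherwise a
    -- motion taking the image of `Φ` to `Φ¹` turns it into a reflection.
    surjective : ∀ a → ∃[ w ] ev w ≐ a
    surjective a = go (cls (act a Φ)) refl
      where
      go : ∀ b → cls (act a Φ) ≡ b → ∃[ w ] ev w ≐ a
      go true  eq = let w , wΦ∼aΦ = reach-flag (act a Φ) eq in w , Rot.rigid (ev w) a wΦ∼aΦ
      go false eq = let b , baΦ∼Φ¹ = transitive (act a Φ) Φ¹ (trans eq (sym (cls-end false Φ¹ refl))) in
        contradiction (same (unsame baΦ∼Φ¹)) (no-reflection (b ∘A a))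

-- The two presentations and their action on the polyhedron.

open import Data.Integer using (-_; _+_; _-_)

-- s is the sign in the exponents, and z = (1 - s) / 2.
module Construction (p n k : ℕ) .{{_ : NonZero p}} .{{_ : NonZero k}} (C : CyclicRing p)
                    (p≡16k : p ≡ 16 ℕ.* k) (n≡8k : n ≡ 8 ℕ.* k)
                    (s z : ℤ) (s+2z≡1 : s + (z + z) ≡ + 1) where

  -- `m` is the integer s p/4 behind μ. The sorting argument wants 4r³ divisible by 2p = 32K, and r
  -- = δ/4 = 2κ gives 32κ³.
  K κ m δ r : ℤ
  K = + k
  κ = s ℤ.* K
  m = + 4 ℤ.* κ
  δ = m + m
  r = + 2 ℤ.* κ

  private
    module Z = +-*-Solver
    module Cᵣ = CyclicRing C
  open Cᵣ using (ι)

  +p≡ : + p ≡ + 16 ℤ.* K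
  +p≡ = trans (cong +_ p≡16k) (ℤ.pos-* 16 k)

  +n≡ : + n ≡ + 8 ℤ.* K
  +n≡ = trans (cong +_ n≡8k) (ℤ.pos-* 8 k)

  +2p≡ : + (2 ℕ.* p) ≡ + 32 ℤ.* K
  +2p≡ = trans (ℤ.pos-* 2 p) (trans (cong (+ 2 ℤ.*_) +p≡)
    (Z.solve 1 (λ K → Z.con (+ 2) Z.:* (Z.con (+ 16) Z.:* K) Z.:= Z.con (+ 32) Z.:* K) refl K))

  ι-cong : ∀ {i j} x → i ≡ j + x ℤ.* + p → ι i ≡ ι j
  ι-cong {i} {j} x refl = begin
    ι (j + x ℤ.* + p)         ≡⟨ Cᵣ.ι-+ j (x ℤ.* + p) ⟩
    ι j Cᵣ.+ ι (x ℤ.* + p)    ≡⟨ cong (Cᵣ._+_ (ι j)) (trans (Cᵣ.ι-* x (+ p)) (trans (cong (ι x Cᵣ.*_) Cᵣ.ι-modulus) (sym (Cᵣ.ι-* x (+ 0))))) ⟩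
    ι j Cᵣ.+ ι (x ℤ.* + 0)    ≡⟨ Cᵣ.ι-+ j (x ℤ.* + 0) ⟨
    ι (j + x ℤ.* + 0)         ≡⟨ cong ι (Z.solve 2 (λ j x → j Z.:+ x Z.:* Z.con (+ 0) Z.:= j) refl j x) ⟩
    ι j                       ∎
    where open ≡-Reasoning

  Tw : Twist C
  -- The quotients by p are s for 4m and sκ for m².
  Tw = TwistConstruction.twist C m (triangular (4 ℕ.* k) ℕ.+ 24 ℕ.* (k ℕ.* k))
    (ι-cong s (trans (Z.solve 2 (λ s K → Z.con (+ 4) Z.:* (Z.con (+ 4) Z.:* (s Z.:* K)) Z.:= Z.con (+ 0) Z.:+ s Z.:* (Z.con (+ 16) Z.:* K)) refl s K)
      (cong (λ P → + 0 + s ℤ.* P) (sym +p≡))))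
    (ι-cong (s ℤ.* κ) (trans (Z.solve 2 (λ s K → (Z.con (+ 4) Z.:* (s Z.:* K)) Z.:* (Z.con (+ 4) Z.:* (s Z.:* K))
        Z.:= Z.con (+ 0) Z.:+ (s Z.:* (s Z.:* K)) Z.:* (Z.con (+ 16) Z.:* K)) refl s K)
      (cong (λ P → + 0 + s ℤ.* κ ℤ.* P) (sym +p≡))))
    (trans (cong triangular p≡16k) (triangular-16k k))

  1≢0 : ι (+ 1) ≢ ι (+ 0)
  1≢0 eq with Cᵣ.ι-≡⇒congruent eq
  ... | x , 1≡xp = even≢odd (x ℤ.* (+ 8 ℤ.* K)) (+ 0) (sym (trans 1≡xp (trans (cong (λ P → + 0 + x ℤ.* P) +p≡)
    (Z.solve 2 (λ x K → Z.con (+ 0) Z.:+ x Z.:* (Z.con (+ 16) Z.:* K)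
      Z.:= x Z.:* (Z.con (+ 8) Z.:* K) Z.:+ x Z.:* (Z.con (+ 8) Z.:* K)) refl x K))))

  δ≡4r : δ ≡ + 4 ℤ.* r
  δ≡4r = Z.solve 1 (λ κ → Z.con (+ 4) Z.:* κ Z.:+ Z.con (+ 4) Z.:* κ Z.:= Z.con (+ 4) Z.:* (Z.con (+ 2) Z.:* κ)) refl κ

  4r³≡cq : + 4 ℤ.* (r ℤ.* r ℤ.* r) ≡ s ℤ.* κ ℤ.* κ ℤ.* + (2 ℕ.* p)
  4r³≡cq = trans
    (Z.solve 2 (λ s K → let r = Z.con (+ 2) Z.:* (s Z.:* K) in Z.con (+ 4) Z.:* (r Z.:* r Z.:* r)
      Z.:= s Z.:* (s Z.:* K) Z.:* (s Z.:* K) Z.:* (Z.con (+ 32) Z.:* K)) refl s K)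
    (cong (s ℤ.* κ ℤ.* κ ℤ.*_) (sym +2p≡))

  open NormalForm p (2 ℕ.* p) (+ n) δ r (s ℤ.* κ ℤ.* κ) δ≡4r 4r³≡cq
  open Twist Tw using (μ; t; t-suc)
  open TwistProperties C Tw
  open Incidence C Tw
  open Polyhedron C Tw 1≢0
  open FlagClasses C Tw 1≢0
  open Poset₂ 𝒫
  open Flags isPolyhedron
  open Aut

  -- n = 8K and δ = 8sK differ by 8K(1 - s) = zp; only modulo 2p is the sign visible.
  ι-n : ι (+ n) ≡ ν
  ι-n = trans (ι-cong z (trans +n≡ (begin
    + 8 ℤ.* K
      ≡⟨ cong (ℤ._* K) (cong (+ 8 ℤ.*_) (sym s+2z≡1)) ⟩
    + 8 ℤ.* (s + (z + z)) ℤ.* K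
      ≡⟨ Z.solve 3 (λ s z K → Z.con (+ 8) Z.:* (s Z.:+ (z Z.:+ z)) Z.:* K
           Z.:= Z.con (+ 4) Z.:* (s Z.:* K) Z.:+ Z.con (+ 4) Z.:* (s Z.:* K) Z.:+ z Z.:* (Z.con (+ 16) Z.:* K)) refl s z K ⟩
    δ + z ℤ.* (+ 16 ℤ.* K)
      ≡⟨ cong (λ P → δ + z ℤ.* P) (sym +p≡) ⟩
    δ + z ℤ.* + p ∎))) (Cᵣ.ι-+ m m)
    where open ≡-Reasoning

  onV-normal : ∀ i j → onV (ev (pow g₁ i ++ pow g₂ j)) 0# ≡ ι i
  onV-normal i j = trans (proj₁ (eval-++ s₁ s₂ (pow g₁ i) (pow g₂ j)) 0#)
    (trans (cong (onV (ev (pow g₁ i))) (σ₂-powerV j)) (σ₁-powerV i))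

  onF-normal : ∀ i j → onF (ev (pow g₁ i ++ pow g₂ j)) base-face
                       ≡ onF (ev (pow g₁ i)) (onF (ev (pow g₂ j)) base-face)
  onF-normal i j = proj₂ (proj₂ (eval-++ s₁ s₂ (pow g₁ i) (pow g₂ j))) base-face

  onF-normal-odd : ∀ i j l → j ≡ ℤ.suc (l + l) →
                   onF (ev (pow g₁ i ++ pow g₂ j)) base-face ≡ (true , turn (ι i) (ι l))
  onF-normal-odd i j l refl = trans (onF-normal i j)
    (trans (cong (onF (ev (pow g₁ i))) (σ₂-power-odd l)) (σ₁-power-odd i (ι l)))

  -- Words preserve flag classes, so base vertex and base face decide where the whole base flag
  -- goes.
  agree : ∀ u w → onV (ev u) 0# ≡ onV (ev w) 0# → onF (ev u) base-face ≡ onF (ev w) base-face →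
          act (ev u) Φ ∼ act (ev w) Φ
  agree u w v≡ f≡ = flag-determined (act (ev u) Φ) (act (ev w) Φ) v≡ f≡ (trans (cls-ev u Φ) (sym (cls-ev w Φ)))

  ι-i₁ : ι i₁ ≡ Cᵣ.- 1# Cᵣ.+ ν
  ι-i₁ = trans (Cᵣ.ι-+ (- (+ 1)) (+ n)) (cong₂ Cᵣ._+_ (Cᵣ.ι-neg (+ 1)) ι-n)

  ι-i₂ : ι i₂ ≡ 1# Cᵣ.+ Cᵣ.- ν
  ι-i₂ = trans (Cᵣ.ι-+ (+ 1) (- (+ n))) (cong (Cᵣ._+_ 1#) (trans (Cᵣ.ι-neg (+ n)) (cong Cᵣ.-_ ι-n)))

  -- m - 2 appears because j₁ = 2(m - 2) + 1; likewise j₂ = 2(m + 1) + 1 in `turn-i₂`. The right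
  -- side is the form to which σ₂⁻¹σ₁ evaluates on the base face.
  turn-i₁ : turn (ι i₁) (ι (m - + 2)) ≡ 0# Cᵣ.+ Cᵣ.- (μ Cᵣ.* 0#) Cᵣ.+ Cᵣ.- 1#
  turn-i₁ = begin
    turn (ι i₁) (ι (m - + 2))
      ≡⟨ cong₂ turn ι-i₁ (trans (Cᵣ.ι-+ m -[1+ 1 ]) (cong (Cᵣ._+_ μ) (trans (Cᵣ.ι-neg (+ 2)) (cong Cᵣ.-_ (Cᵣ.ι-+ (+ 1) (+ 1)))))) ⟩
    turn i l
      ≡⟨ cong (λ x → l Cᵣ.+ Cᵣ.- i Cᵣ.+ i Cᵣ.* (μ Cᵣ.* l) Cᵣ.+ Cᵣ.- x) t-i ⟩
    l Cᵣ.+ Cᵣ.- i Cᵣ.+ i Cᵣ.* (μ Cᵣ.* l) Cᵣ.+ Cᵣ.- μ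
      ≡⟨ solve 0 (let i = :- :1 :+ :ν ; l = :μ :+ :- (:1 :+ :1) in
           l :- i :+ i :* (:μ :* l) :- :μ := :0 :- :μ :* :0 :- :1) refl ⟩
    0# Cᵣ.+ Cᵣ.- (μ Cᵣ.* 0#) Cᵣ.+ Cᵣ.- 1# ∎
    where
    open ≡-Reasoning
    i = Cᵣ.- 1# Cᵣ.+ ν
    l = μ Cᵣ.+ Cᵣ.- (1# Cᵣ.+ 1#)
    t-i : t i ≡ μ
    t-i = begin
      t i                         ≡⟨ cong t (solve 0 (:- :1 :+ :ν := :- :1 :+ :ν :* :1) refl) ⟩
      t (Cᵣ.- 1# Cᵣ.+ ν Cᵣ.* 1#)  ≡⟨ t-shift-ν (Cᵣ.- 1#) 1# ⟩
      t (Cᵣ.- 1#)                 ≡⟨ t-neg 1# ⟩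
      t (1# Cᵣ.+ 1#)              ≡⟨ t-suc 1# ⟩
      t 1# Cᵣ.+ μ Cᵣ.* 1#         ≡⟨ cong (Cᵣ._+ μ Cᵣ.* 1#) t-one ⟩
      0# Cᵣ.+ μ Cᵣ.* 1#           ≡⟨ solve 0 (:0 :+ :μ :* :1 := :μ) refl ⟩
      μ                           ∎

  turn-i₂ : turn (ι i₂) (ι (m + + 1)) ≡ 0# Cᵣ.+ μ Cᵣ.* 0#
  turn-i₂ = begin
    turn (ι i₂) (ι (m + + 1))
      ≡⟨ cong₂ turn ι-i₂ (Cᵣ.ι-+ m (+ 1)) ⟩
    turn i l
      ≡⟨ cong (λ x → l Cᵣ.+ Cᵣ.- i Cᵣ.+ i Cᵣ.* (μ Cᵣ.* l) Cᵣ.+ Cᵣ.- x) t-i ⟩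
    l Cᵣ.+ Cᵣ.- i Cᵣ.+ i Cᵣ.* (μ Cᵣ.* l) Cᵣ.+ Cᵣ.- 0#
      ≡⟨ solve 0 (let i = :1 :- :ν ; l = :μ :+ :1 in
           l :- i :+ i :* (:μ :* l) :- :0 := :0 :+ :μ :* :0) refl ⟩
    0# Cᵣ.+ μ Cᵣ.* 0# ∎
    where
    open ≡-Reasoning
    i = 1# Cᵣ.+ Cᵣ.- ν
    l = μ Cᵣ.+ 1#
    t-i : t i ≡ 0#
    t-i = begin
      t i                              ≡⟨ cong t (solve 0 (:1 :- :ν := :1 :+ :ν :* (:- :1)) refl) ⟩
      t (1# Cᵣ.+ ν Cᵣ.* (Cᵣ.- 1#))     ≡⟨ t-shift-ν 1# (Cᵣ.- 1#) ⟩
      t 1#                             ≡⟨ t-one ⟩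
      0#                               ∎

  relations-hold : ∀ {u w} → (u , w) ∈ Γ → act (ev u) Φ ∼ act (ev w) Φ
  relations-hold (here refl) = agree (pow g₁ (+ p)) []
    (trans (σ₁-powerV (+ p)) Cᵣ.ι-modulus) (σ₁-power-base (+ p))
  relations-hold (there (here refl)) = agree (pow g₂ (+ (2 ℕ.* p))) [] (σ₂-powerV (+ (2 ℕ.* p)))
    (trans (cong (λ j → onF (ev (pow g₂ j)) base-face) (cong (λ x → + (p ℕ.+ x)) (ℕ.+-identityʳ p)))
      (trans (σ₂-power-even (+ p)) (cong (false ,_) Cᵣ.ι-modulus)))
  relations-hold (there (there (here refl))) = agree (σ₁ ++ σ₂ ++ σ₁ ++ σ₂) []
    (solve 0 (let a = :- :0 :+ :μ :* (:0 :* :0 :- :0) :+ :1 in :- a :+ :μ :* (a :* a :- a) :+ :1 := :0) refl)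
    (cong (false ,_) (solve 0 (let x = :0 :- :1 :+ :μ :* :0 :+ :1 in x :- :μ :* x := :0) refl))
  relations-hold (there (there (there (here refl)))) = agree (σ₂⁻¹ ++ σ₁) (pow g₁ i₁ ++ pow g₂ j₁)
    (trans (solve 0 (let v = :0 :+ :1 in :- v :+ :μ :* (v :* v :+ v) := :- :1 :+ :ν) refl)
      (sym (trans (onV-normal i₁ j₁) ι-i₁)))
    (sym (trans (onF-normal-odd i₁ j₁ (m - + 2)
        (Z.solve 1 (λ m → Z.con (- (+ 3)) Z.:+ (m Z.:+ m) Z.:= Z.con (+ 1) Z.:+ ((m Z.:- Z.con (+ 2)) Z.:+ (m Z.:- Z.con (+ 2)))) refl m))
      (cong (true ,_) turn-i₁)))
  relations-hold (there (there (there (there (here refl))))) = agree (σ₂ ++ σ₁⁻¹) (pow g₁ i₂ ++ pow g₂ j₂)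
    (trans (solve 0 (let v = :0 :- :1 in :- v :+ :μ :* (v :* v :- v) := :1 :- :ν) refl)
      (sym (trans (onV-normal i₂ j₂) ι-i₂)))
    (sym (trans (onF-normal-odd i₂ j₂ (m + + 1)
        (Z.solve 1 (λ m → Z.con (+ 3) Z.:+ (m Z.:+ m) Z.:= Z.con (+ 1) Z.:+ ((m Z.:+ Z.con (+ 1)) Z.:+ (m Z.:+ Z.con (+ 1)))) refl m))
      (cong (true ,_) turn-i₂)))

  open Words Γ

  well-defined : ∀ {u w} → u ≈ w → ev u ≐ ev w
  well-defined = Rot.well-defined relations-hold

  +p++p : + p + + p ≡ + (2 ℕ.* p)
  +p++p = cong (λ x → + (p ℕ.+ x)) (sym (ℕ.+-identityʳ p))

  -- The base vertex is fixed by σ₂ and reveals `i` modulo p. Then σ₁^i can be cancelled, and the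
  -- number of the remaining face reveals `j` modulo 2p.
  normal-faithful : ∀ i j i′ j′ → ev (pow g₁ i ++ pow g₂ j) ≐ ev (pow g₁ i′ ++ pow g₂ j′) →
                    (∃[ x ] i ≡ i′ + x ℤ.* + p) × (∃[ x ] j ≡ j′ + x ℤ.* + (2 ℕ.* p))
  normal-faithful i j i′ j′ eq = (x , i≡i′) , (y , trans j≡j′ (cong (λ q → j′ + y ℤ.* q) +p++p))
    where
    open ≡-Reasoning
    i-congruent : ∃[ x ] i ≡ i′ + x ℤ.* + p
    i-congruent = Cᵣ.ι-≡⇒congruent (trans (sym (onV-normal i j)) (trans (proj₁ eq 0#) (onV-normal i′ j′)))
    x = proj₁ i-congruent
    i≡i′ = proj₂ i-congruent
    same-rotation : ev (pow g₁ i) ≐ ev (pow g₁ i′)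
    same-rotation = well-defined (subst₂ _≈_ (++-identityʳ (pow g₁ i)) (++-identityʳ (pow g₁ i′))
      (·-period g₁ {+ p} σ₁-period {i} {i′} x [] i≡i′))
    f′≡f : onF (ev (pow g₂ j′)) base-face ≡ onF (ev (pow g₂ j)) base-face
    f′≡f = ↔-injective (aF (ev (pow g₁ i′))) (begin
      onF (ev (pow g₁ i′)) (onF (ev (pow g₂ j′)) base-face) ≡⟨ onF-normal i′ j′ ⟨
      onF (ev (pow g₁ i′ ++ pow g₂ j′)) base-face           ≡⟨ proj₂ (proj₂ eq) base-face ⟨
      onF (ev (pow g₁ i ++ pow g₂ j)) base-face             ≡⟨ onF-normal i j ⟩
      onF (ev (pow g₁ i)) (onF (ev (pow g₂ j)) base-face)   ≡⟨ proj₂ (proj₂ same-rotation) _ ⟩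
      onF (ev (pow g₁ i′)) (onF (ev (pow g₂ j)) base-face)  ∎)
    j-congruent : ∃[ y ] j ≡ j′ + y ℤ.* (+ p + + p)
    j-congruent = numbered-congruent (numbered j) (subst (Numbered j′) f′≡f (numbered j′))
    y = proj₁ j-congruent
    j≡j′ = proj₂ j-congruent

  faithful : ∀ u w → ev u ≐ ev w → u ≈ w
  faithful u w eq =
    let i  , j  , u≈ = normalForm u
        i′ , j′ , w≈ = normalForm w
        (x , i≡i′) , (y , j≡j′) = normal-faithful i j i′ j′
          (≐-trans {ev (pow g₁ i ++ pow g₂ j)} {ev u} {ev (pow g₁ i′ ++ pow g₂ j′)} (well-defined (≈-sym u≈))
            (≐-trans {ev u} {ev w} {ev (pow g₁ i′ ++ pow g₂ j′)} eq (well-defined w≈)))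
    in begin
      u                                        ≈⟨ u≈ ⟩
      g₁ ^ i · pow g₂ j                        ≈⟨ ·-period g₁ {+ p} σ₁-period {i} {i′} x (pow g₂ j) i≡i′ ⟩
      g₁ ^ i′ · pow g₂ j                       ≈⟨ ·-cong g₁ i′ (subst₂ _≈_ (++-identityʳ (pow g₂ j)) (++-identityʳ (pow g₂ j′))
                                                    (·-period g₂ {+ (2 ℕ.* p)} σ₂-period {j} {j′} y [] j≡j′)) ⟩
      g₁ ^ i′ · pow g₂ j′                      ≈⟨ w≈ ⟨
      w                                        ∎
    where open SetoidReasoning wordSetoid

  -- A reflection would turn σ₂⁻¹σ₁ = σ₁^i₁ σ₂^j₁ into σ₂σ₁⁻¹ = σ₁^-i₁ σ₂^-j₁; together
  -- with σ₂σ₁⁻¹ = σ₁^i₂ σ₂^j₂ this gives σ₂^2δ = 1.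
  no-reflection : ∀ ρ → ¬ (act ρ Φ ∼ Φ¹)
  no-reflection ρ ρΦ∼Φ¹ = even≢odd x (- z) (begin
    x + x            ≡⟨ ℤ.*-cancelʳ-≡ (x + x) s (+ 16 ℤ.* K) {{ℤ.i*j≢0 (+ 16) K}} (sym 16Ks≡) ⟩
    s                ≡⟨ Z.solve 2 (λ s z → s Z.:= s Z.:+ (z Z.:+ z) Z.:- (z Z.:+ z)) refl s z ⟩
    s + (z + z) - (z + z)  ≡⟨ cong (_- (z + z)) s+2z≡1 ⟩
    + 1 - (z + z)    ≡⟨ Z.solve 1 (λ z → Z.con (+ 1) Z.:- (z Z.:+ z) Z.:= Z.con (+ 1) Z.:+ (Z.:- z Z.:+ Z.:- z)) refl z ⟩
    ℤ.suc (- z + - z) ∎)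
    where
    open ≡-Reasoning
    reflected : ev (σ₂ ++ σ₁⁻¹) ≐ ev (barWord (pow g₁ i₁ ++ pow g₂ j₁))
    reflected = Rot.Reflection.bar-cong (adj Φ-Φ¹) ρ ρΦ∼Φ¹ (σ₂⁻¹ ++ σ₁) (pow g₁ i₁ ++ pow g₂ j₁)
      (well-defined (≈-rel (there (there (there (here refl))))))
    bar-normal : barWord (pow g₁ i₁ ++ pow g₂ j₁) ≡ pow g₁ (- i₁) ++ pow g₂ (- j₁)
    bar-normal = trans (map-++ letterInv (pow g₁ i₁) (pow g₂ j₁)) (cong₂ _++_ (barWord-pow g₁ i₁) (barWord-pow g₂ j₁))
    congruent : ∃[ x ] j₂ ≡ - j₁ + x ℤ.* + (2 ℕ.* p)
    congruent = proj₂ (normal-faithful i₂ j₂ (- i₁) (- j₁)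
      (≐-trans {ev (pow g₁ i₂ ++ pow g₂ j₂)} {ev (σ₂ ++ σ₁⁻¹)} {ev (pow g₁ (- i₁) ++ pow g₂ (- j₁))}
        (well-defined (≈-sym (≈-rel (there (there (there (there (here refl))))))))
        (subst (λ w → ev (σ₂ ++ σ₁⁻¹) ≐ ev w) bar-normal reflected)))
    x = proj₁ congruent
    j₂≡ = proj₂ congruent
    -- j₁ + j₂ = 2δ = 16Ks would be the multiple 32Kx of 2p, which makes s even, whereas s = 1 - 2z
    -- is odd.
    16Ks≡ : s ℤ.* (+ 16 ℤ.* K) ≡ (x + x) ℤ.* (+ 16 ℤ.* K)
    16Ks≡ = begin
      s ℤ.* (+ 16 ℤ.* K)
        ≡⟨ Z.solve 2 (λ s K → let d = Z.con (+ 4) Z.:* (s Z.:* K) Z.:+ Z.con (+ 4) Z.:* (s Z.:* K) in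
             s Z.:* (Z.con (+ 16) Z.:* K) Z.:= (Z.con (+ 3) Z.:+ d) Z.:+ (Z.con (- (+ 3)) Z.:+ d)) refl s K ⟩
      j₂ + j₁                                ≡⟨ cong (_+ j₁) j₂≡ ⟩
      - j₁ + x ℤ.* + (2 ℕ.* p) + j₁          ≡⟨ cong (λ q → - j₁ + x ℤ.* q + j₁) +2p≡ ⟩
      - j₁ + x ℤ.* (+ 32 ℤ.* K) + j₁
        ≡⟨ Z.solve 3 (λ j x K → Z.:- j Z.:+ x Z.:* (Z.con (+ 32) Z.:* K) Z.:+ j Z.:= (x Z.:+ x) Z.:* (Z.con (+ 16) Z.:* K)) refl j₁ x K ⟩
      (x + x) ℤ.* (+ 16 ℤ.* K) ∎

  isAutGroup : IsAutGroupOfTightChiral Γ p (2 ℕ.* p)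
  isAutGroup = 𝒫 , isPolyhedron , hasType , tight , chiral no-reflection , Φ ,
    s₁ , s₂ , adj₁ , adj₂ , (λ _ _ → well-defined) , faithful , surjective no-reflection

theorem3p8 : (β : ℕ) → 5 ≤ β →
    IsAutGroupOfTightChiral
    (ΓRels (+ (2 ^ (β ∸ 1))) (+ (2 ^ β))
    (- (+ 1) + + (2 ^ (β ∸ 2))) (- (+ 3) + + (2 ^ (β ∸ 2)))
    (+ 1 - + (2 ^ (β ∸ 2))) (+ 3 + + (2 ^ (β ∸ 2))))
    (2 ^ (β ∸ 1)) (2 ^ β)
    ×
    IsAutGroupOfTightChiral
    (ΓRels (+ (2 ^ (β ∸ 1))) (+ (2 ^ β))
    (- (+ 1) + + (2 ^ (β ∸ 2))) (- (+ 3) - + (2 ^ (β ∸ 2)))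
    (+ 1 - + (2 ^ (β ∸ 2))) (+ 3 - + (2 ^ (β ∸ 2))))
    (2 ^ (β ∸ 1)) (2 ^ β)
-- Writing β = 5 + b gives p = 16 · 2^b. The signs 1 and -1 come with z = 0 and z = 1.
theorem3p8 (suc (suc (suc (suc (suc b))))) (s≤s (s≤s (s≤s (s≤s (s≤s z≤n))))) =
  for-sign (+ 1) (+ 0) refl (+ n) (sym (ℤ.*-identityˡ (+ n))) ,
  for-sign -[1+ 0 ] (+ 1) refl (- (+ n)) (sym (ℤ.-1*i≡-i (+ n)))
  where
  p n k : ℕ
  p = 2 ^ (4 ℕ.+ b)
  n = 2 ^ (3 ℕ.+ b)
  k = 2 ^ b

  instance
    p≢0 : NonZero p
    p≢0 = ℕ.m^n≢0 2 (4 ℕ.+ b)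
    k≢0 : NonZero k
    k≢0 = ℕ.m^n≢0 2 b

  n≡8k : n ≡ 8 ℕ.* k
  n≡8k = ℕ.^-distribˡ-+-* 2 3 b

  -- The perturbation `d` is a variable because -3 - n unfolds to -3 + (-n): both statements then
  -- have the same shape.
  for-sign : ∀ s z → s + (z + z) ≡ + 1 → ∀ d → d ≡ s ℤ.* + n → IsAutGroupOfTightChiral
    (ΓRels (+ p) (+ (2 ℕ.* p)) (- (+ 1) + + n) (- (+ 3) + d) (+ 1 - + n) (+ 3 + d)) p (2 ℕ.* p)
  for-sign s z s+2z≡1 d refl = subst
    (λ d → IsAutGroupOfTightChiral
      (ΓRels (+ p) (+ (2 ℕ.* p)) (- (+ 1) + + n) (- (+ 3) + d) (+ 1 - + n) (+ 3 + d)) p (2 ℕ.* p))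
    (trans (solve 2 (λ s K → con (+ 4) :* (s :* K) :+ con (+ 4) :* (s :* K) := s :* (con (+ 8) :* K)) refl s (+ k))
      (cong (s ℤ.*_) (sym (trans (cong +_ n≡8k) (ℤ.pos-* 8 k)))))
    (Construction.isAutGroup p n k (ResidueRing.residueRing p) (ℕ.^-distribˡ-+-* 2 4 b) n≡8k s z s+2z≡1)
    where open +-*-Solver
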